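{- The difference between $\mathrm{lsfw}$ and $\mathrm{sfw}$ is unbounded, even on trees: for every integer $N$ there is a tree $T$ with $\mathrm{lsfw}(T)-\mathrm{sfw}(T)\ge N$. More precisely, every forest $F$ satisfies $$\mathrm{lsfw}(F)\ge 2\,\mathrm{pw}(F),$$ where $\mathrm{pw}$ denotes path-width, while every tree $T$ satisfies $\mathrm{sfw}(T)\le 4$.
   Context: All graphs are finite, simple and undirected. Both $\mathrm{sfw}$ and $\mathrm{lsfw}$ are assigned value $0$ on the empty graph. Split-free cable expressions. A cable is a nonempty set of vertices treated as one indivisible live unit. A split-free cable expression is a typed term; a term of type $p\to q$ receives $p$ ordered live cables and returns $q$ ordered live cables, and its cable rank is $\mathrm{cr}(p\to q)=p+q$. The generators are: $e:1\to1$ (keep one cable unchanged); $\nu_S:0\to1$ (birth a fresh nonempty vertex set $S$ as one cable); $\kappa:1\to0$ (close, i.e. remove, one cable); $\varphi:2\to1$ (fold two cables into their union); $B:2\to2$ (add all edges between the two cables, which both remain live); $K:1\to1$ (add all internal edges of the cable). Terms are combined by serial composition: if $s:p\to q$ and $t:q\to r$ then $s\circ t:p\to r$, where $s$ is performed before $t$; and by parallel product: if $s:p\to q$ and $t:p'\to q'$ then $s\mathbin{\Box}t:p+p'\to q+q'$, which executes the two terms on disjoint vertex sets and concatenates their output cables. Cable permutations are structural reindexings of the ordered interface; they create no vertices or edges and do not change cable rank. The value of a closed expression $t:0\to0$ is the graph on the born vertices whose edges are those added by its block ($B$) and clique ($K$) operations (edge additions use set union). A closed expression is legal for $G$ if every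 vertex is born exactly once, every added edge belongs to $G$, and the final graph is $G$. The width of an expression is the largest cable rank of a subterm occurrence, where the rank of a subterm is that of its own interface type in the parse tree (identity wires placed in parallel with a subterm are counted only in the enclosing subterm). $\mathrm{sfw}(G)$ is the minimum width of a legal closed expression for $G$. Sequential cable plays. A configuration on $G$ consists of the set of born vertices, a family $\mathcal L$ of pairwise disjoint nonempty sets of born vertices (the live cables), and a set of already placed edges; initially all are empty. With $\ell=|\mathcal L|$ the number of live cables before a move, the moves are: (i) birth$(S)$: introduces a nonempty set $S$ of fresh (not yet born) vertices of $G$ as one live cable; cost $2\ell+1$. (ii) fold$(X,Y)$: replaces two distinct live cables $X,Y$ by $X\cup Y$; cost $2\ell-1$. (iii) block$(X,Y)$: places every edge between two distinct live cables $X,Y$; legal when all these pairs are edges of $G$ and at least one has not already been placed; cost $2\ell$. (iv) clique$(X)$: places every edge inside a live cable $X$; legal when $X$ is a clique of $G$ and at least one internal edge has not already been placed; cost $2\ell$. (v) close$(X)$: removes the live cable $X$; legal when every edge of $G$ incident with a vertex of $X$ has already been placed; cost $2\ell-1$. A play (a finite sequence of legal moves from the initial configuration) constructs $G$ if every vertex is born, every edge of $G$ is placed, and every cable is closed. The width of a play is the maximum cost of its moves, and $\mathrm{lsfw}(G)$ is the minimum width of a play constructing $G$. -}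

module Defs where

open import Data.Bool.Base using (true; false; _∨_; if_then_else_)
import Data.Bool.Properties as Bool
open import Data.Fin.Base using (Fin; zero; suc; punchOut)
import Data.Fin.Base as Fin
import Data.Fin.Properties as Fin
open import Data.Fin.Permutation using (Permutation′; permutation; insert; flip; _⟨$⟩ʳ_; _⟨$⟩ˡ_)
import Data.Fin.Permutation as Perm
open import Data.Fin.Subset
  using (Subset; inside; outside; _∈_; _∉_; _⊆_; _∪_; _∩_; _-_; ∣_∣; ⁅_⁆; Nonempty; Empty; ⊤; ⊥)
open import Data.Fin.Subset.Properties
  using (_∈?_; _⊆?_; anySubset?; nonempty?; ∉⊥; ∈⊤; x∈⁅x⁆; x∈⁅y⁆⇒x≡y;
         x∈p∪q⁺; x∈p∪q⁻; x∈p∩q⁺; x∈p∩q⁻)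
open import Data.List.Base as List using (List; []; _∷_; [_]; _∷ʳ_; length)
import Data.List.Properties as List
open import Data.List.Membership.Propositional using () renaming (_∈_ to _∈ˡ_; lose to loseˡ)
open import Data.List.Membership.Propositional.Properties
  using (∈-cartesianProductWith⁺; ∈-map⁺; ∈-++⁺ˡ; ∈-++⁺ʳ; ∈-concat⁺′; ∈-filter⁺; ∈-filter⁻; ∈-upTo⁺; ∈-allFin)
open import Data.List.Relation.Unary.All as All using (All; []; _∷_)
open import Data.List.Relation.Unary.Any as Any using (Any; here; there; _─_)
open import Data.List.Relation.Unary.Linked using (Linked)
open import Data.List.Relation.Unary.Unique.Propositional using (Unique)
open import Data.Nat.Base using (ℕ; zero; suc; _+_; _*_; _∸_; _⊔_; _≤_; _<_; z≤n; s≤s)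
import Data.Nat.Properties as ℕ
open import Data.Product.Base using (Σ; ∃; _×_; _,_; proj₁; proj₂)
import Data.Product.Properties as Prod
open import Data.Sum.Base using (_⊎_; inj₁; inj₂; [_,_]′)
open import Data.Vec.Base as Vec using (Vec; []; _∷_; _++_; lookup; tabulate; zipWith; take; drop)
import Data.Vec.Properties as Vec
import Data.Vec.Functional as Vector
open import Function.Base using (_∘_; id)
open import Function.Bundles using (_⇔_; mk⇔; Equivalence)
open import Level using (0ℓ)
open import Relation.Binary.Core using (Rel)
open import Relation.Binary.Definitions using (Decidable; Symmetric; DecidableEquality)
open import Relation.Binary.Construct.Closure.ReflexiveTransitive using (Star; ε; _◅_; _◅◅_)
open import Relation.Binary.PropositionalEquality
  using (_≡_; _≢_; refl; sym; trans; cong; cong₂; subst; subst₂)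
open import Relation.Nullary using (¬_; Dec; yes; no; contradiction)
open import Relation.Nullary.Decidable using (map′; _×-dec_; _⊎-dec_; _→-dec_; ¬?)

record Graph (n : ℕ) : Set₁ where
  field
    Adj        : Rel (Fin n) 0ℓ
    adj?       : Decidable Adj
    adj-sym    : Symmetric Adj
    adj-irrefl : ∀ {v} → ¬ Adj v v

record Cycle {n} (G : Graph n) : Set where
  open Graph G
  field
    first last : Fin n
    middle     : List (Fin n)
    long       : 1 ≤ length middle
    distinct   : Unique (first ∷ middle ∷ʳ last)
    path       : Linked Adj (first ∷ middle ∷ʳ last)
    closing    : Adj last first

IsForest : ∀ {n} → Graph n → Set
IsForest G = ¬ Cycle G

record IsTree {n} (G : Graph n) : Set where
  field
    nonempty  : 1 ≤ n
    connected : ∀ u v → Star (Graph.Adj G) u v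
    forest    : IsForest G

IsMinimum : (ℕ → Set) → ℕ → Set
IsMinimum P m = P m × (∀ j → P j → m ≤ j)

-- An adjacency matrix; each edge is recorded at both of its ends.
EdgeSet : ℕ → Set
EdgeSet n = Vec (Subset n) n

infix 4 _∋_~_
_∋_~_ : ∀ {n} → EdgeSet n → Fin n → Fin n → Set
E ∋ u ~ v = v ∈ lookup E u

noEdges : ∀ {n} → EdgeSet n
noEdges = tabulate λ _ → ⊥

infixr 6 _∪ᴱ_
_∪ᴱ_ : ∀ {n} → EdgeSet n → EdgeSet n → EdgeSet n
_∪ᴱ_ = zipWith _∪_

between : ∀ {n} → Subset n → Subset n → EdgeSet n
between X Y = tabulate λ u →
  (if lookup X u then Y else ⊥) ∪ (if lookup Y u then X else ⊥)

within : ∀ {n} → Subset n → EdgeSet n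
within X = tabulate λ u → if lookup X u then X - u else ⊥

permute : ∀ {A : Set} {p} → Permutation′ p → Vec A p → Vec A p
permute π xs = tabulate λ i → lookup xs (π ⟨$⟩ʳ i)

-- Serial composition is _⨾_, left argument first.  Cable permutations
-- reindex the interface of a term, so they contribute no rank of their
-- own to the width.
infixl 5 _⨾_
infixr 6 _□_
data Expr (n : ℕ) : ℕ → ℕ → Set where
  e       : Expr n 1 1
  ν       : (S : Subset n) → Nonempty S → Expr n 0 1
  κ       : Expr n 1 0
  φ       : Expr n 2 1
  B       : Expr n 2 2
  K       : Expr n 1 1
  _⨾_     : ∀ {p q r} → Expr n p q → Expr n q r → Expr n p r
  _□_     : ∀ {p q p′ q′} → Expr n p q → Expr n p′ q′ → Expr n (p + p′) (q + q′)
  reindex : ∀ {p q} → Permutation′ p → Permutation′ q → Expr n p q → Expr n p q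

exprWidth : ∀ {n p q} → Expr n p q → ℕ
exprWidth {p = p} {q} (s ⨾ t)         = (p + q) ⊔ (exprWidth s ⊔ exprWidth t)
exprWidth {p = p} {q} (s □ t)         = (p + q) ⊔ (exprWidth s ⊔ exprWidth t)
exprWidth             (reindex _ _ t) = exprWidth t
exprWidth {p = p} {q} _               = p + q

outputs : ∀ {n p q} → Expr n p q → Vec (Subset n) p → Vec (Subset n) q
outputs e               Xs           = Xs
outputs (ν S _)         []           = S ∷ []
outputs κ               _            = []
outputs φ               (X ∷ Y ∷ []) = X ∪ Y ∷ []
outputs B               Xs           = Xs
outputs K               Xs           = Xs
outputs (s ⨾ t)         Xs           = outputs t (outputs s Xs)
outputs (_□_ {p} s t)   Xs           = outputs s (take p Xs) ++ outputs t (drop p Xs)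
outputs (reindex π ρ t) Xs           = permute ρ (outputs t (permute π Xs))

addedEdges : ∀ {n p q} → Expr n p q → Vec (Subset n) p → EdgeSet n
addedEdges B               (X ∷ Y ∷ []) = between X Y
addedEdges K               (X ∷ [])     = within X
addedEdges (s ⨾ t)         Xs           = addedEdges s Xs ∪ᴱ addedEdges t (outputs s Xs)
addedEdges (_□_ {p} s t)   Xs           = addedEdges s (take p Xs) ∪ᴱ addedEdges t (drop p Xs)
addedEdges (reindex π ρ t) Xs           = addedEdges t (permute π Xs)
addedEdges _               _            = noEdges

-- Births are counted with multiplicity.
births : ∀ {n p q} → Expr n p q → Fin n → ℕ
births (ν S _)         v = if lookup S v then 1 else 0
births (s ⨾ t)         v = births s v + births t v
births (s □ t)         v = births s v + births t v
births (reindex _ _ t) v = births t v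
births _               v = 0

-- The terms of a parallel product run on disjoint vertex sets in every
-- subterm of a legal closed expression, since no vertex is born twice.
record Legal {n} (G : Graph n) (t : Expr n 0 0) : Set where
  field
    bornOnce : ∀ v → births t v ≡ 1
    value    : ∀ u v → addedEdges t [] ∋ u ~ v ⇔ Graph.Adj G u v

HasExprOfWidth : ∀ {n} → Graph n → ℕ → Set
HasExprOfWidth {n} G w = Σ (Expr n 0 0) λ t → Legal G t × exprWidth t ≡ w

record Config (n : ℕ) : Set where
  constructor config
  field
    born   : Subset n
    live   : List (Subset n)
    placed : EdgeSet n
open Config public

initial : ∀ {n} → Config n
initial = config ⊥ [] noEdges

-- L ─ p deletes the entry of L at position p, so X∈ : X ∈ˡ L and
-- Y ∈ˡ (L ─ X∈) select two distinct cables.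
data Move {n} (G : Graph n) (c : Config n) : Config n → Set where
  birth : (S : Subset n) → Nonempty S → Empty (S ∩ born c) →
          Move G c (config (S ∪ born c) (S ∷ live c) (placed c))
  fold : ∀ {X Y} (X∈ : X ∈ˡ live c) (Y∈ : Y ∈ˡ (live c ─ X∈)) →
         Move G c (config (born c) (X ∪ Y ∷ (live c ─ X∈ ─ Y∈)) (placed c))
  block : ∀ {X Y} (X∈ : X ∈ˡ live c) → Y ∈ˡ (live c ─ X∈) →
          (∀ u v → u ∈ X → v ∈ Y → Graph.Adj G u v) →
          (∃ λ u → ∃ λ v → u ∈ X × v ∈ Y × ¬ placed c ∋ u ~ v) →
          Move G c (config (born c) (live c) (placed c ∪ᴱ between X Y))
  clique : ∀ {X} → X ∈ˡ live c →
           (∀ u v → u ∈ X → v ∈ X → u ≢ v → Graph.Adj G u v) →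
           (∃ λ u → ∃ λ v → u ∈ X × v ∈ X × u ≢ v × ¬ placed c ∋ u ~ v) →
           Move G c (config (born c) (live c) (placed c ∪ᴱ within X))
  close : ∀ {X} (X∈ : X ∈ˡ live c) →
          (∀ u v → u ∈ X → Graph.Adj G u v → placed c ∋ u ~ v) →
          Move G c (config (born c) (live c ─ X∈) (placed c))

cost : ∀ {n} {G : Graph n} {c d} → Move G c d → ℕ
cost {c = c} (birth _ _ _)     = 2 * length (live c) + 1
cost {c = c} (fold _ _)        = 2 * length (live c) ∸ 1
cost {c = c} (block _ _ _ _)   = 2 * length (live c)
cost {c = c} (clique _ _ _)    = 2 * length (live c)
cost {c = c} (close _ _)       = 2 * length (live c) ∸ 1

Play : ∀ {n} → Graph n → Config n → Config n → Set
Play G = Star (Move G)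

playWidth : ∀ {n} {G : Graph n} {c d} → Play G c d → ℕ
playWidth ε       = 0
playWidth (m ◅ π) = cost m ⊔ playWidth π

record Constructed {n} (G : Graph n) (c : Config n) : Set where
  field
    allBorn   : ∀ v → v ∈ born c
    allPlaced : ∀ u v → Graph.Adj G u v → placed c ∋ u ~ v
    allClosed : live c ≡ []

HasPlayOfWidth : ∀ {n} → Graph n → ℕ → Set
HasPlayOfWidth G w =
  ∃ λ c → Constructed G c × Σ (Play G initial c) λ π → playWidth π ≡ w

record PathDecomposition {n} (G : Graph n) : Set where
  field
    bagCount   : ℕ
    bag        : Fin bagCount → Subset n
    vertices   : ∀ v → ∃ λ i → v ∈ bag i
    edges      : ∀ u v → Graph.Adj G u v → ∃ λ i → u ∈ bag i × v ∈ bag i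
    contiguous : ∀ v {i j k} → i Fin.≤ j → j Fin.≤ k → v ∈ bag i → v ∈ bag k → v ∈ bag j

  -- Truncated subtraction: the graph on no vertices gets path-width 0.
  width : ℕ
  width = Vector.foldr _⊔_ 0 (∣_∣ ∘ bag) ∸ 1

HasPathDecompositionOfWidth : ∀ {n} → Graph n → ℕ → Set
HasPathDecompositionOfWidth G w =
  Σ (PathDecomposition G) λ D → PathDecomposition.width D ≡ w

-- From here to sfw, lsfw and pw, the existence of the three minima is
-- established constructively: for each bound k it is decided whether a
-- witness of width at most k exists, by saturating a finite system of
-- derivation rules, and some witness is exhibited.

private
  remaining : ∀ {A : Set} {P : A → Set} {xs y} (p : Any P xs) → y ∈ˡ xs → y ≡ Any.lookup p ⊎ y ∈ˡ (xs ─ p)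
  remaining (here _)  (here q)  = inj₁ q
  remaining (here _)  (there q) = inj₂ q
  remaining (there _) (here q)  = inj₂ (here q)
  remaining (there p) (there q) with remaining p q
  ... | inj₁ r = inj₁ r
  ... | inj₂ r = inj₂ (there r)

  lookup∈ : ∀ {A : Set} {P : A → Set} {xs} (p : Any P xs) → Any.lookup p ∈ˡ xs
  lookup∈ (here _)  = here refl
  lookup∈ (there p) = there (lookup∈ p)

  lookupP : ∀ {A : Set} {P : A → Set} {xs} (p : Any P xs) → P (Any.lookup p)
  lookupP (here px) = px
  lookupP (there p) = lookupP p

  restore : ∀ {A : Set} {P : A → Set} {xs y} (p : Any P xs) → y ∈ˡ (xs ─ p) → y ∈ˡ xs
  restore (here _)  q         = there q
  restore (there p) (here q)  = here q
  restore (there p) (there q) = there (restore p q)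

module Closure {A : Set} (univ : List A) (_≟_ : DecidableEquality A)
  (Axiom : A → Set) (Rule : A → A → A → Set)
  (axiom? : ∀ x → Dec (Axiom x)) (rule? : ∀ x y z → Dec (Rule x y z)) where

  data Derivable : A → Set where
    ax : ∀ {x} → x ∈ˡ univ → Axiom x → Derivable x
    by : ∀ {x y z} → z ∈ˡ univ → Derivable x → Derivable y → Rule x y z → Derivable z

  private
    Next : List A → A → Set
    Next S z = Axiom z ⊎ Any (λ x → Any (λ y → Rule x y z) S) S

    next? : ∀ S z → Dec (Next S z)
    next? S z = axiom? z ⊎-dec Any.any? (λ x → Any.any? (λ y → rule? x y z) S) S

    step : ∀ {S z} → All Derivable S → z ∈ˡ univ → Next S z → Derivable z
    step ds z∈ (inj₁ a) = ax z∈ a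
    step ds z∈ (inj₂ r) =
      let r′ = lookupP r
      in by z∈ (All.lookup ds (lookup∈ r)) (All.lookup ds (lookup∈ r′)) (lookupP r′)

    saturate : ∀ k S rest → length rest ≤ k → All Derivable S → All (_∈ˡ univ) rest →
               (∀ x → x ∈ˡ univ → x ∈ˡ S ⊎ x ∈ˡ rest) →
               ∃ λ S′ → All Derivable S′ × (∀ x → Derivable x → x ∈ˡ S′)
    saturate k S rest le ds us cover with Any.any? (next? S) rest
    ... | no none = S , ds , closed
      where
      inS : ∀ {x} → x ∈ˡ univ → Next S x → x ∈ˡ S
      inS u n with cover _ u
      ... | inj₁ i = i
      ... | inj₂ i = contradiction (loseˡ i n) none
      closed : ∀ x → Derivable x → x ∈ˡ S
      closed x (ax u a)       = inS u (inj₁ a)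
      closed x (by u d d′ r) = inS u (inj₂ (loseˡ (closed _ d) (loseˡ (closed _ d′) r)))
    saturate zero    S []         le ds us cover | yes ()
    saturate (suc k) S rest le ds us cover | yes p =
      saturate k (Any.lookup p ∷ S) (rest ─ p)
        (ℕ.≤-pred (ℕ.≤-trans (ℕ.≤-reflexive (sym (List.length-removeAt′ rest (Any.index p)))) le))
        (step ds (All.lookup us (lookup∈ p)) (lookupP p) ∷ ds)
        (All.tabulate (λ i → All.lookup us (restore p i)))
        cover′
      where
      cover′ : ∀ x → x ∈ˡ univ → x ∈ˡ (Any.lookup p ∷ S) ⊎ x ∈ˡ (rest ─ p)
      cover′ x u with cover x u
      ... | inj₁ i = inj₁ (there i)
      ... | inj₂ i with remaining p i
      ...   | inj₁ q = inj₁ (here q)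
      ...   | inj₂ q = inj₂ q

  derivable? : ∀ x → Dec (Derivable x)
  derivable? x =
    let S , ds , complete = saturate (length univ) [] univ ℕ.≤-refl [] (All.tabulate id) (λ _ → inj₂)
    in map′ (All.lookup ds) (complete x) (Any.any? (x ≟_) S)

Listing : Set → Set
Listing A = Σ (List A) λ xs → ∀ x → x ∈ˡ xs

listVec : ∀ {A} → Listing A → ∀ n → Listing (Vec A n)
listVec L zero = [ [] ] , λ { [] → here refl }
listVec L (suc n) =
  List.cartesianProductWith _∷_ (proj₁ L) (proj₁ (listVec L n)) ,
  λ { (x ∷ xs) → ∈-cartesianProductWith⁺ _∷_ (proj₂ L x) (proj₂ (listVec L n) xs) }

listProduct : ∀ {A B} → Listing A → Listing B → Listing (A × B)
listProduct L M =
  List.cartesianProductWith _,_ (proj₁ L) (proj₁ M) ,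
  λ { (x , y) → ∈-cartesianProductWith⁺ _,_ (proj₂ L x) (proj₂ M y) }

listSubsets : ∀ n → Listing (Subset n)
listSubsets = listVec (false ∷ true ∷ [] , λ { false → here refl ; true → there (here refl) })

listEdgeSets : ∀ n → Listing (EdgeSet n)
listEdgeSets n = listVec (listSubsets n) n

listsUpTo : ∀ {A} → Listing A → ℕ → List (List A)
listsUpTo L zero    = [ [] ]
listsUpTo L (suc k) = [] ∷ List.cartesianProductWith _∷_ (proj₁ L) (listsUpTo L k)

∈-listsUpTo : ∀ {A} (L : Listing A) k xs → length xs ≤ k → xs ∈ˡ listsUpTo L k
∈-listsUpTo L zero    []       _        = here refl
∈-listsUpTo L (suc k) []       _        = here refl
∈-listsUpTo L (suc k) (x ∷ xs) (s≤s le) =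
  there (∈-cartesianProductWith⁺ _∷_ (proj₂ L x) (∈-listsUpTo L k xs le))

any∈? : ∀ {A : Set} {P : A → Set} (L : Listing A) → (∀ x → Dec (P x)) → Dec (∃ P)
any∈? L P? = map′ Any.satisfied (λ (x , px) → loseˡ (proj₂ L x) px) (Any.any? P? (proj₁ L))

_≟ˢ_ : ∀ {n} → DecidableEquality (Subset n)
_≟ˢ_ = Vec.≡-dec Bool._≟_

_≟ᴱ_ : ∀ {n} → DecidableEquality (EdgeSet n)
_≟ᴱ_ = Vec.≡-dec _≟ˢ_

minimum : ∀ {P : ℕ → Set} → (∀ k → Dec (∃ λ w → P w × w ≤ k)) → ∃ P → ∃ (IsMinimum P)
minimum {P} below? (w , Pw) = search w 0 refl (λ _ _ → z≤n)
  where
  search : ∀ fuel m → m + fuel ≡ w → (∀ j → P j → m ≤ j) → ∃ (IsMinimum P)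
  search fuel m eq lower with below? m
  ... | yes (j , Pj , j≤m) = m , subst P (ℕ.≤-antisym j≤m (lower j Pj)) Pj , lower
  search zero m eq lower | no none =
    contradiction (w , Pw , ℕ.≤-reflexive (trans (sym eq) (ℕ.+-identityʳ m))) none
  search (suc fuel) m eq lower | no none =
    search fuel (suc m) (trans (sym (ℕ.+-suc m fuel)) eq) λ j Pj →
      ℕ.≤∧≢⇒< (lower j Pj) λ { refl → none (j , Pj , ℕ.≤-refl) }

_∋_~?_ : ∀ {n} (E : EdgeSet n) u v → Dec (E ∋ u ~ v)
E ∋ u ~? v = v ∈? lookup E u

∪ᴱ⁺ : ∀ {n} (E F : EdgeSet n) {u v} → E ∋ u ~ v ⊎ F ∋ u ~ v → E ∪ᴱ F ∋ u ~ v
∪ᴱ⁺ E F {u} {v} i = subst (v ∈_) (sym (Vec.lookup-zipWith _∪_ u E F)) (x∈p∪q⁺ i)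

∪ᴱ⁻ : ∀ {n} (E F : EdgeSet n) {u v} → E ∪ᴱ F ∋ u ~ v → E ∋ u ~ v ⊎ F ∋ u ~ v
∪ᴱ⁻ E F {u} {v} i = x∈p∪q⁻ _ _ (subst (v ∈_) (Vec.lookup-zipWith _∪_ u E F) i)

noEdges⁻ : ∀ {n} {u v : Fin n} → ¬ noEdges ∋ u ~ v
noEdges⁻ {u = u} {v} i = ∉⊥ (subst (v ∈_) (Vec.lookup∘tabulate (λ _ → ⊥) u) i)

private
  if⁺ : ∀ {n} (X Z : Subset n) {u v} → u ∈ X → v ∈ Z → v ∈ (if lookup X u then Z else ⊥)
  if⁺ X Z u∈ v∈ rewrite Vec.[]=⇒lookup u∈ = v∈

  if⁻ : ∀ {n} (X Z : Subset n) {u v} → v ∈ (if lookup X u then Z else ⊥) → u ∈ X × v ∈ Z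
  if⁻ X Z {u} i with lookup X u in eq
  ... | true  = Vec.lookup⇒[]= u X eq , i
  ... | false = contradiction i ∉⊥

between⁺ : ∀ {n} (X Y : Subset n) {u v} → (u ∈ X × v ∈ Y) ⊎ (u ∈ Y × v ∈ X) → between X Y ∋ u ~ v
between⁺ X Y {u} {v} i = subst (v ∈_) (sym (Vec.lookup∘tabulate _ u)) (x∈p∪q⁺ (side i))
  where
  side : (u ∈ X × v ∈ Y) ⊎ (u ∈ Y × v ∈ X) → _
  side (inj₁ (a , b)) = inj₁ (if⁺ X Y a b)
  side (inj₂ (a , b)) = inj₂ (if⁺ Y X a b)

between⁻ : ∀ {n} (X Y : Subset n) {u v} → between X Y ∋ u ~ v → (u ∈ X × v ∈ Y) ⊎ (u ∈ Y × v ∈ X)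
between⁻ X Y {u} {v} i with x∈p∪q⁻ _ _ (subst (v ∈_) (Vec.lookup∘tabulate _ u) i)
... | inj₁ j = inj₁ (if⁻ X Y j)
... | inj₂ j = inj₂ (if⁻ Y X j)

_≟ᶜ_ : ∀ {n} → DecidableEquality (Config n)
config b l p ≟ᶜ config b′ l′ p′ =
  map′ (λ { (refl , refl , refl) → refl }) (λ { refl → refl , refl , refl })
       (b ≟ˢ b′ ×-dec List.≡-dec _≟ˢ_ l l′ ×-dec p ≟ᴱ p′)

anyMember? : ∀ {A : Set} (xs : List A) {P : ∀ x → x ∈ˡ xs → Set} →
             (∀ x p → Dec (P x p)) → Dec (∃ λ x → Σ (x ∈ˡ xs) (P x))
anyMember? []       P? = no λ { (_ , () , _) }
anyMember? (x ∷ xs) {P} P? =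
  map′ (λ { (inj₁ q) → x , here refl , q ; (inj₂ (y , p , q)) → y , there p , q })
       (λ { (_ , here refl , q) → inj₁ q ; (y , there p , q) → inj₂ (y , p , q) })
       (P? x (here refl) ⊎-dec anyMember? xs (λ y p → P? y (there p)))

module _ {n} (G : Graph n) where
  open Graph G

  private
    pairs? : ∀ {P Q R : Fin n → Fin n → Set} → Decidable P → Decidable Q → Decidable R →
             Dec (∀ u v → P u v → Q u v → R u v)
    pairs? P? Q? R? = Fin.all? λ u → Fin.all? λ v → P? u v →-dec (Q? u v →-dec R? u v)

    blockLegal : Subset n → Subset n → EdgeSet n → Set
    blockLegal X Y E = (∀ u v → u ∈ X → v ∈ Y → Adj u v) ×
                       (∃ λ u → ∃ λ v → u ∈ X × v ∈ Y × ¬ E ∋ u ~ v)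

    cliqueLegal : Subset n → EdgeSet n → Set
    cliqueLegal X E = (∀ u v → u ∈ X → v ∈ X → u ≢ v → Adj u v) ×
                      (∃ λ u → ∃ λ v → u ∈ X × v ∈ X × u ≢ v × ¬ E ∋ u ~ v)

    closeLegal : Subset n → EdgeSet n → Set
    closeLegal X E = ∀ u v → u ∈ X → Adj u v → E ∋ u ~ v

    blockLegal? : ∀ X Y E → Dec (blockLegal X Y E)
    blockLegal? X Y E =
      pairs? (λ u _ → u ∈? X) (λ _ v → v ∈? Y) adj?
      ×-dec Fin.any? λ u → Fin.any? λ v → u ∈? X ×-dec v ∈? Y ×-dec ¬? (E ∋ u ~? v)

    cliqueLegal? : ∀ X E → Dec (cliqueLegal X E)
    cliqueLegal? X E =
      pairs? (λ u _ → u ∈? X) (λ _ v → v ∈? X) (λ u v → ¬? (u Fin.≟ v) →-dec adj? u v)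
      ×-dec Fin.any? λ u → Fin.any? λ v →
              u ∈? X ×-dec v ∈? X ×-dec ¬? (u Fin.≟ v) ×-dec ¬? (E ∋ u ~? v)

    closeLegal? : ∀ X E → Dec (closeLegal X E)
    closeLegal? X E = pairs? (λ u _ → u ∈? X) adj? (λ u v → E ∋ u ~? v)

  moveWithin? : ∀ k c d → Dec (Σ (Move G c d) λ m → cost m ≤ k)
  moveWithin? k c d = map′
    (λ { (inj₁ (S , ne , fr , refl , le)) → birth S ne fr , le
       ; (inj₂ (inj₁ (X , p , Y , q , refl , le))) → fold p q , le
       ; (inj₂ (inj₂ (inj₁ (X , p , Y , q , (a , b) , refl , le)))) → block p q a b , le
       ; (inj₂ (inj₂ (inj₂ (inj₁ (X , p , (a , b) , refl , le))))) → clique p a b , le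
       ; (inj₂ (inj₂ (inj₂ (inj₂ (X , p , a , refl , le))))) → close p a , le })
    (λ { (birth S ne fr , le)  → inj₁ (S , ne , fr , refl , le)
       ; (fold p q , le)       → inj₂ (inj₁ (_ , p , _ , q , refl , le))
       ; (block p q a b , le)  → inj₂ (inj₂ (inj₁ (_ , p , _ , q , (a , b) , refl , le)))
       ; (clique p a b , le)   → inj₂ (inj₂ (inj₂ (inj₁ (_ , p , (a , b) , refl , le))))
       ; (close p a , le)      → inj₂ (inj₂ (inj₂ (inj₂ (_ , p , a , refl , le)))) })
    (anySubset? (λ S → nonempty? S ×-dec ¬? (nonempty? (S ∩ born c)) ×-dec
       config (S ∪ born c) (S ∷ live c) (placed c) ≟ᶜ d ×-dec
       2 * length (live c) + 1 ℕ.≤? k)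
    ⊎-dec anyMember? (live c) (λ X p → anyMember? (live c ─ p) λ Y q →
       config (born c) (X ∪ Y ∷ (live c ─ p ─ q)) (placed c) ≟ᶜ d ×-dec
       2 * length (live c) ∸ 1 ℕ.≤? k)
    ⊎-dec anyMember? (live c) (λ X p → anyMember? (live c ─ p) λ Y q →
       blockLegal? X Y (placed c) ×-dec
       config (born c) (live c) (placed c ∪ᴱ between X Y) ≟ᶜ d ×-dec
       2 * length (live c) ℕ.≤? k)
    ⊎-dec anyMember? (live c) (λ X p →
       cliqueLegal? X (placed c) ×-dec
       config (born c) (live c) (placed c ∪ᴱ within X) ≟ᶜ d ×-dec
       2 * length (live c) ℕ.≤? k)
    ⊎-dec anyMember? (live c) (λ X p →
       closeLegal? X (placed c) ×-dec
       config (born c) (live c ─ p) (placed c) ≟ᶜ d ×-dec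
       2 * length (live c) ∸ 1 ℕ.≤? k))

  constructed? : ∀ c → Dec (Constructed G c)
  constructed? c = map′
    (λ (a , b , l) → record { allBorn = a ; allPlaced = b ; allClosed = l })
    (λ r → let open Constructed r in allBorn , allPlaced , allClosed)
    (Fin.all? (_∈? born c)
     ×-dec (Fin.all? λ u → Fin.all? λ v → adj? u v →-dec (placed c ∋ u ~? v))
     ×-dec List.≡-dec _≟ˢ_ (live c) [])

  private
    removal< : ∀ {xs : List (Subset n)} {X} (p : X ∈ˡ xs) → length (xs ─ p) < length xs
    removal< {xs} p = ℕ.≤-reflexive (sym (List.length-removeAt′ xs (Any.index p)))

    removal≤ : ∀ {xs : List (Subset n)} {X} (p : X ∈ˡ xs) → length (xs ─ p) ≤ length xs
    removal≤ p = ℕ.<⇒≤ (removal< p)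

  module _ (k : ℕ) where
    private
      configs : List (Config n)
      configs = List.map (λ (b , l , p) → config b l p)
        (List.cartesianProductWith _,_ (proj₁ (listSubsets n))
          (List.cartesianProductWith _,_ (listsUpTo (listSubsets n) k) (proj₁ (listEdgeSets n))))

      ∈-configs : ∀ c → length (live c) ≤ k → c ∈ˡ configs
      ∈-configs c le = ∈-map⁺ _ (∈-cartesianProductWith⁺ _,_ (proj₂ (listSubsets n) (born c))
        (∈-cartesianProductWith⁺ _,_ (∈-listsUpTo _ k (live c) le) (proj₂ (listEdgeSets n) (placed c))))

      Start : Config n → Set
      Start c = c ≡ initial

      start? : ∀ c → Dec (Start c)
      start? c = c ≟ᶜ initial

      Next : Config n → Config n → Config n → Set
      Next c _ d = Σ (Move G c d) λ m → cost m ≤ k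

      next? : ∀ c c′ d → Dec (Next c c′ d)
      next? c _ d = moveWithin? k c d

      module C = Closure configs _≟ᶜ_ Start Next start? next?

      moveBound : ∀ {c d} (m : Move G c d) → cost m ≤ k → length (live c) ≤ k → length (live d) ≤ k
      moveBound {c} (birth S _ _) le _ =
        ℕ.≤-trans (ℕ.≤-trans (ℕ.≤-reflexive (ℕ.+-comm 1 _)) (ℕ.+-monoˡ-≤ 1 (ℕ.m≤m+n (length (live c)) _))) le
      moveBound (fold p q) _ le =
        ℕ.≤-trans (ℕ.≤-trans (removal< q) (removal≤ p)) le
      moveBound (block _ _ _ _) _ le = le
      moveBound (clique _ _ _) _ le = le
      moveBound (close p _) _ le = ℕ.≤-trans (removal≤ p) le

      width-◅◅ : ∀ {c d f : Config n} (π : Play G c d) (ρ : Play G d f) →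
                 playWidth π ≤ k → playWidth ρ ≤ k → playWidth (π ◅◅ ρ) ≤ k
      width-◅◅ ε       ρ _ le = le
      width-◅◅ (m ◅ π) ρ l le = ℕ.⊔-lub (ℕ.m⊔n≤o⇒m≤o _ _ l) (width-◅◅ π ρ (ℕ.m⊔n≤o⇒n≤o (cost m) _ l) le)

      sound : ∀ {c} → C.Derivable c → Σ (Play G initial c) λ π → playWidth π ≤ k
      sound (C.ax _ refl) = ε , z≤n
      sound (C.by _ d _ (m , le)) =
        let π , l = sound d
        in π ◅◅ (m ◅ ε) , width-◅◅ π (m ◅ ε) l (ℕ.⊔-lub le z≤n)

      complete : ∀ {c d} → C.Derivable c → length (live c) ≤ k → (π : Play G c d) → playWidth π ≤ k →
                 C.Derivable d × length (live d) ≤ k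
      complete der lc ε _ = der , lc
      complete {c} der lc (_◅_ {j = c′} m π) le =
        let l = ℕ.m⊔n≤o⇒m≤o (cost m) _ le
            lc′ = moveBound m l lc
        in complete (C.by (∈-configs c′ lc′) der der (m , l)) lc′ π (ℕ.m⊔n≤o⇒n≤o (cost m) _ le)

    abstract
      playWithin? : Dec (∃ λ w → HasPlayOfWidth G w × w ≤ k)
      playWithin? = map′ to from (Any.any? (λ c → C.derivable? c ×-dec constructed? c) configs)
        where
        to : Any (λ c → C.Derivable c × Constructed G c) configs → ∃ λ w → HasPlayOfWidth G w × w ≤ k
        to a = let c , d , con = Any.satisfied a
                   π , le = sound d
               in playWidth π , (c , con , π , refl) , le
        from : (∃ λ w → HasPlayOfWidth G w × w ≤ k) → Any (λ c → C.Derivable c × Constructed G c) configs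
        from (_ , (c , con , π , refl) , le) =
          let der , l = complete (C.ax (∈-configs initial z≤n) refl) z≤n π le
          in loseˡ (∈-configs c l) (der , con)

  private
    Singletons : Config n → Set
    Singletons c = ∀ v → v ∈ born c → ⁅ v ⁆ ∈ˡ live c

    birthAll : ∀ vs c → Singletons c →
               ∃ λ d → Play G c d × Singletons d × born c ⊆ born d × (∀ v → v ∈ˡ vs → v ∈ born d)
    birthAll [] c inv = c , ε , inv , id , λ _ ()
    birthAll (v ∷ vs) c inv with v ∈? born c
    ... | yes v∈ =
      let d , π , inv′ , sub , all = birthAll vs c inv
      in d , π , inv′ , sub , λ { _ (here refl) → sub v∈ ; u (there i) → all u i }
    ... | no v∉ =
      let d , π , inv′ , sub , all = birthAll vs c′ invc′
      in d , m ◅ π , inv′ , (λ i → sub (x∈p∪q⁺ (inj₂ i))) ,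
         λ { _ (here refl) → sub (x∈p∪q⁺ (inj₁ (x∈⁅x⁆ v))) ; u (there i) → all u i }
      where
      c′ : Config n
      c′ = config (⁅ v ⁆ ∪ born c) (⁅ v ⁆ ∷ live c) (placed c)
      m : Move G c c′
      m = birth ⁅ v ⁆ (v , x∈⁅x⁆ v) λ (u , i) →
            let a , b = x∈p∩q⁻ _ _ i in v∉ (subst (_∈ born c) (x∈⁅y⁆⇒x≡y v a) b)
      invc′ : Singletons c′
      invc′ u i with x∈p∪q⁻ _ _ i
      ... | inj₁ a = here (cong ⁅_⁆ (x∈⁅y⁆⇒x≡y v a))
      ... | inj₂ b = there (inv u b)

    singleton-injective : ∀ {u v : Fin n} → ⁅ u ⁆ ≡ ⁅ v ⁆ → u ≡ v
    singleton-injective {u} {v} eq = x∈⁅y⁆⇒x≡y v (subst (u ∈_) eq (x∈⁅x⁆ u))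

    placeAll : ∀ (ps : List (Fin n × Fin n)) c → (∀ v → ⁅ v ⁆ ∈ˡ live c) →
               ∃ λ d → Play G c d × born d ≡ born c ×
                 (∀ {u v} → placed c ∋ u ~ v → placed d ∋ u ~ v) ×
                 (∀ u v → (u , v) ∈ˡ ps → Adj u v → placed d ∋ u ~ v)
    placeAll [] c _ = c , ε , refl , id , λ _ _ ()
    placeAll ((u , v) ∷ ps) c inv with adj? u v | placed c ∋ u ~? v
    ... | yes a | no new =
      let d , π , eq , sub , all = placeAll ps c′ inv
      in d , m ◅ π , eq , (λ i → sub (∪ᴱ⁺ (placed c) _ (inj₁ i))) ,
         λ { _ _ (here refl) _ → sub (∪ᴱ⁺ (placed c) _ (inj₂ (between⁺ _ _ (inj₁ (x∈⁅x⁆ u , x∈⁅x⁆ v)))))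
           ; x y (there i) → all x y i }
      where
      c′ : Config n
      c′ = config (born c) (live c) (placed c ∪ᴱ between ⁅ u ⁆ ⁅ v ⁆)
      second : ⁅ v ⁆ ∈ˡ (live c ─ inv u)
      second with remaining (inv u) (inv v)
      ... | inj₂ i = i
      ... | inj₁ eq with refl ← singleton-injective (trans eq (sym (lookupP (inv u)))) =
        contradiction a adj-irrefl
      m : Move G c c′
      m = block (inv u) second
            (λ x y i j → subst₂ Adj (sym (x∈⁅y⁆⇒x≡y u i)) (sym (x∈⁅y⁆⇒x≡y v j)) a)
            (u , v , x∈⁅x⁆ u , x∈⁅x⁆ v , new)
    ... | yes a | yes old =
      let d , π , eq , sub , all = placeAll ps c inv
      in d , π , eq , sub , λ { _ _ (here refl) _ → sub old ; x y (there i) → all x y i }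
    ... | no ¬a | _ =
      let d , π , eq , sub , all = placeAll ps c inv
      in d , π , eq , sub , λ { _ _ (here refl) a → contradiction a ¬a ; x y (there i) → all x y i }

    closeAll : ∀ b L E → (∀ u v → Adj u v → E ∋ u ~ v) → Play G (config b L E) (config b [] E)
    closeAll b []      E _   = ε
    closeAll b (X ∷ L) E all = close (here refl) (λ u v _ → all u v) ◅ closeAll b L E all

  hasPlay : ∃ (HasPlayOfWidth G)
  hasPlay =
    let vs = List.allFin n
        c , π , inv , _ , allBorn = birthAll vs initial (λ _ i → contradiction i ∉⊥)
        born∈ = λ v → allBorn v (∈-allFin v)
        d , ρ , eq , _ , allPlaced = placeAll (List.cartesianProductWith _,_ vs vs) c (λ v → inv v (born∈ v))
        placed∈ = λ u v → allPlaced u v (∈-cartesianProductWith⁺ _,_ (∈-allFin u) (∈-allFin v))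
        σ = closeAll (born d) (live d) (placed d) placed∈
    in _ , config (born d) [] (placed d) ,
       record { allBorn = λ v → subst (v ∈_) (sym eq) (born∈ v) ; allPlaced = placed∈ ; allClosed = refl } ,
       π ◅◅ ρ ◅◅ σ , refl

module _ {n} (G : Graph n) where
  open Graph G

  private
    -- First bag, union of the bags, and pairs sharing a bag.
    Summary : Set
    Summary = Subset n × Subset n × EdgeSet n

    _≟ʷ_ : DecidableEquality Summary
    _≟ʷ_ = Prod.≡-dec _≟ˢ_ (Prod.≡-dec _≟ˢ_ _≟ᴱ_)

    listSummaries : Listing Summary
    listSummaries = listProduct (listSubsets n) (listProduct (listSubsets n) (listEdgeSets n))

    Bags : ℕ → Set
    Bags m = Fin m → Subset n

    front : ∀ {m} → Bags m → Subset n
    front {zero}  bag = ⊥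
    front {suc m} bag = bag zero

    square : Subset n → EdgeSet n
    square X = between X X

    union : ∀ {m} → Bags m → Subset n
    union = Vector.foldr _∪_ ⊥

    pairs : ∀ {m} → Bags m → EdgeSet n
    pairs = Vector.foldr (λ X E → square X ∪ᴱ E) noEdges

    summary : ∀ {m} → Bags m → Summary
    summary bag = front bag , union bag , pairs bag

    union⁺ : ∀ {m} (bag : Bags m) {v} i → v ∈ bag i → v ∈ union bag
    union⁺ bag zero    v∈ = x∈p∪q⁺ (inj₁ v∈)
    union⁺ bag (suc i) v∈ = x∈p∪q⁺ (inj₂ (union⁺ (bag ∘ suc) i v∈))

    union⁻ : ∀ {m} (bag : Bags m) {v} → v ∈ union bag → ∃ λ i → v ∈ bag i
    union⁻ {zero}  bag v∈ = contradiction v∈ ∉⊥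
    union⁻ {suc m} bag v∈ with x∈p∪q⁻ _ _ v∈
    ... | inj₁ a = zero , a
    ... | inj₂ b = let i , c = union⁻ (bag ∘ suc) b in suc i , c

    pairs⁺ : ∀ {m} (bag : Bags m) {u v} i → u ∈ bag i → v ∈ bag i → pairs bag ∋ u ~ v
    pairs⁺ bag zero    u∈ v∈ = ∪ᴱ⁺ (square (bag zero)) _ (inj₁ (between⁺ _ _ (inj₁ (u∈ , v∈))))
    pairs⁺ bag (suc i) u∈ v∈ = ∪ᴱ⁺ (square (bag zero)) _ (inj₂ (pairs⁺ (bag ∘ suc) i u∈ v∈))

    pairs⁻ : ∀ {m} (bag : Bags m) {u v} → pairs bag ∋ u ~ v → ∃ λ i → u ∈ bag i × v ∈ bag i
    pairs⁻ {zero}  bag i = contradiction i noEdges⁻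
    pairs⁻ {suc m} bag i with ∪ᴱ⁻ (square (bag zero)) _ i
    ... | inj₂ b = let j , c = pairs⁻ (bag ∘ suc) b in suc j , c
    ... | inj₁ a with between⁻ _ _ a
    ...   | inj₁ c = zero , c
    ...   | inj₂ c = zero , c

    Contiguous : ∀ {m} → Bags m → Set
    Contiguous bag = ∀ v {i j k} → i Fin.≤ j → j Fin.≤ k → v ∈ bag i → v ∈ bag k → v ∈ bag j

    BagsWithin : ∀ {m} → ℕ → Bags m → Set
    BagsWithin s bag = ∀ i → ∣ bag i ∣ ≤ s

    max⁻ : ∀ {m s} (bag : Bags m) → Vector.foldr _⊔_ 0 (∣_∣ ∘ bag) ≤ s → BagsWithin s bag
    max⁻ bag le zero    = ℕ.m⊔n≤o⇒m≤o _ _ le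
    max⁻ bag le (suc i) = max⁻ (bag ∘ suc) (ℕ.m⊔n≤o⇒n≤o ∣ bag zero ∣ _ le) i

    max⁺ : ∀ {m s} (bag : Bags m) → BagsWithin s bag → Vector.foldr _⊔_ 0 (∣_∣ ∘ bag) ≤ s
    max⁺ {zero}  bag all = z≤n
    max⁺ {suc m} bag all = ℕ.⊔-lub (all zero) (max⁺ (bag ∘ suc) (all ∘ suc))

    prepend : ∀ {m} → Subset n → Bags m → Bags (suc m)
    prepend X bag zero    = X
    prepend X bag (suc i) = bag i

  module _ (s : ℕ) where
    private
      Start : Summary → Set
      Start x = x ≡ (⊥ , ⊥ , noEdges)

      start? : ∀ x → Dec (Start x)
      start? x = x ≟ʷ (⊥ , ⊥ , noEdges)

      Prepend : Summary → Summary → Summary → Set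
      Prepend (F , U , E) _ (F′ , U′ , E′) =
        ∣ F′ ∣ ≤ s × F′ ∩ U ⊆ F × U′ ≡ F′ ∪ U × E′ ≡ square F′ ∪ᴱ E

      prepend? : ∀ x y z → Dec (Prepend x y z)
      prepend? (F , U , E) _ (F′ , U′ , E′) =
        ∣ F′ ∣ ℕ.≤? s ×-dec (F′ ∩ U) ⊆? F ×-dec U′ ≟ˢ (F′ ∪ U) ×-dec E′ ≟ᴱ (square F′ ∪ᴱ E)

      module C = Closure (proj₁ listSummaries) _≟ʷ_ Start Prepend start? prepend?

      inUniv : ∀ x → x ∈ˡ proj₁ listSummaries
      inUniv = proj₂ listSummaries

      sound : ∀ {x} → C.Derivable x →
              ∃ λ m → Σ (Bags m) λ bag → Contiguous bag × BagsWithin s bag × summary bag ≡ x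
      sound (C.ax _ refl) = 0 , (λ ()) , (λ { v {()} }) , (λ ()) , refl
      sound (C.by {z = X , _} _ d _ (size , sub , refl , refl)) with sound d
      ... | m , bag , con , small , refl =
        suc m , prepend X bag , con′ , (λ { zero → size ; (suc i) → small i }) , refl
        where
        meets : ∀ {m} (bag : Bags m) → Contiguous bag → (X ∩ union bag) ⊆ front bag →
                ∀ v {j k} → j Fin.≤ k → v ∈ X → v ∈ bag k → v ∈ bag j
        meets {suc m} bag con sub v {j} {k} le vX vk =
          con v {zero} {j} {k} z≤n le (sub (x∈p∩q⁺ (vX , union⁺ bag k vk))) vk
        con′ : Contiguous (prepend X bag)
        con′ v {zero}  {zero}  {_}     _       _       vi vk = vi
        con′ v {zero}  {suc j} {suc k} _       (s≤s q) vi vk = meets bag con sub v q vi vk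
        con′ v {suc i} {suc j} {suc k} (s≤s p) (s≤s q) vi vk = con v p q vi vk

      complete : ∀ {m} (bag : Bags m) → Contiguous bag → BagsWithin s bag → C.Derivable (summary bag)
      complete {zero}  bag con small = C.ax (inUniv _) refl
      complete {suc m} bag con small =
        let d = complete (bag ∘ suc) (λ v p q → con v (s≤s p) (s≤s q)) (small ∘ suc)
        in C.by (inUniv _) d d (small zero , sub bag con , refl , refl)
        where
        sub : ∀ {m} (bag : Bags (suc m)) → Contiguous bag →
              (bag zero ∩ union (bag ∘ suc)) ⊆ front (bag ∘ suc)
        sub {zero}  bag con i = proj₂ (x∈p∩q⁻ _ _ i)
        sub {suc m} bag con {v} i =
          let a , b = x∈p∩q⁻ _ _ i
              j , c = union⁻ (bag ∘ suc) b
          in con v {zero} {suc zero} {suc j} z≤n (s≤s z≤n) a c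

      Covers : Summary → Set
      Covers (_ , U , E) = (∀ v → v ∈ U) × (∀ u v → Adj u v → E ∋ u ~ v)

      covers? : ∀ x → Dec (Covers x)
      covers? (_ , U , E) =
        Fin.all? (_∈? U) ×-dec Fin.all? λ u → Fin.all? λ v → adj? u v →-dec (E ∋ u ~? v)

      Valid : Set
      Valid = Σ (PathDecomposition G) λ D → BagsWithin s (PathDecomposition.bag D)

    abstract
      bagsWithin? : Dec (Σ (PathDecomposition G) λ D → ∀ i → ∣ PathDecomposition.bag D i ∣ ≤ s)
      bagsWithin? = map′ to from (any∈? listSummaries λ x → C.derivable? x ×-dec covers? x)
        where
        to : (∃ λ x → C.Derivable x × Covers x) → Valid
        to (_ , d , allV , allE) with sound d
        ... | m , bag , con , small , refl =
          record { bagCount = m ; bag = bag ; vertices = λ v → union⁻ bag (allV v)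
                 ; edges = λ u v a → pairs⁻ bag (allE u v a) ; contiguous = con } , small
        from : Valid → ∃ λ x → C.Derivable x × Covers x
        from (D , small) =
          let open PathDecomposition D
          in summary bag , complete bag contiguous small ,
             (λ v → let i , a = vertices v in union⁺ bag i a) ,
             λ u v a → let i , b , c = edges u v a in pairs⁺ bag i b c

  private
    pred⁻ : ∀ {a k} → a ∸ 1 ≤ k → a ≤ suc k
    pred⁻ {zero}  _  = z≤n
    pred⁻ {suc a} le = s≤s le

    pred⁺ : ∀ {a k} → a ≤ suc k → a ∸ 1 ≤ k
    pred⁺ {zero}  _        = z≤n
    pred⁺ {suc a} (s≤s le) = le

  pathDecompositionWithin? : ∀ k → Dec (∃ λ w → HasPathDecompositionOfWidth G w × w ≤ k)
  pathDecompositionWithin? k = map′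
    (λ (D , small) → _ , (D , refl) , pred⁺ (max⁺ (PathDecomposition.bag D) small))
    (λ { (_ , (D , refl) , le) → D , max⁻ (PathDecomposition.bag D) (pred⁻ le) })
    (bagsWithin? (suc k))

  hasPathDecomposition : ∃ (HasPathDecompositionOfWidth G)
  hasPathDecomposition = _ , record
    { bagCount   = 1
    ; bag        = λ _ → ⊤
    ; vertices   = λ _ → zero , ∈⊤
    ; edges      = λ _ _ _ → zero , ∈⊤ , ∈⊤
    ; contiguous = λ _ _ _ _ _ → ∈⊤
    } , refl

private
  take-++ : ∀ {A : Set} {p q} (xs : Vec A p) (ys : Vec A q) → take p (xs ++ ys) ≡ xs
  take-++ []       ys = refl
  take-++ (x ∷ xs) ys = cong (x ∷_) (take-++ xs ys)

  drop-++ : ∀ {A : Set} {p q} (xs : Vec A p) (ys : Vec A q) → drop p (xs ++ ys) ≡ ys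
  drop-++ []       ys = refl
  drop-++ (x ∷ xs) ys = drop-++ xs ys

  rank≤width : ∀ {n p q} (t : Expr n p q) → p + q ≤ exprWidth t
  rank≤width e               = ℕ.≤-refl
  rank≤width (ν S x)         = ℕ.≤-refl
  rank≤width κ               = ℕ.≤-refl
  rank≤width φ               = ℕ.≤-refl
  rank≤width B               = ℕ.≤-refl
  rank≤width K               = ℕ.≤-refl
  rank≤width (s ⨾ t)         = ℕ.m≤m⊔n _ _
  rank≤width (s □ t)         = ℕ.m≤m⊔n _ _
  rank≤width (reindex _ _ t) = rank≤width t

module _ {n : ℕ} where
  private
    Interface : Set
    Interface = Σ ℕ (Vec (Subset n))

    _≟ᴵ_ : DecidableEquality Interface
    _≟ᴵ_ = Prod.≡-dec ℕ._≟_ _≟ᴱ′_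
      where
      _≟ᴱ′_ : ∀ {p} → DecidableEquality (Vec (Subset n) p)
      _≟ᴱ′_ = Vec.≡-dec _≟ˢ_

    _⊕_ : Interface → Interface → Interface
    (p , xs) ⊕ (q , ys) = p + q , xs ++ ys

    -- Inputs, outputs, born vertices and added edges.
    Summary : Set
    Summary = Interface × Interface × Subset n × EdgeSet n

    _≟ʷ_ : DecidableEquality Summary
    _≟ʷ_ = Prod.≡-dec _≟ᴵ_ (Prod.≡-dec _≟ᴵ_ (Prod.≡-dec _≟ˢ_ _≟ᴱ_))

    data Reordered : Interface → Interface → Set where
      reordered : ∀ {p} {xs : Vec (Subset n) p} π → Reordered (p , xs) (p , permute π xs)

    reordered? : ∀ I J → Dec (Reordered I J)
    reordered? (p , xs) (q , ys) with p ℕ.≟ q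
    ... | no p≢q   = no λ { (reordered _) → p≢q refl }
    ... | yes refl = map′ to from (any∈? fns λ f → any∈? fns λ g → spec? f g)
      where
      fns : Listing (Vec (Fin p) p)
      fns = listVec (List.allFin p , ∈-allFin) p
      Spec : Vec (Fin p) p → Vec (Fin p) p → Set
      Spec f g = (∀ i → lookup f (lookup g i) ≡ i) × (∀ i → lookup g (lookup f i) ≡ i) ×
                 tabulate (λ i → lookup xs (lookup f i)) ≡ ys
      spec? : ∀ f g → Dec (Spec f g)
      spec? f g = Fin.all? (λ i → _ Fin.≟ i) ×-dec Fin.all? (λ i → _ Fin.≟ i) ×-dec Vec.≡-dec _≟ˢ_ _ ys
      to : (∃ λ f → ∃ λ g → Spec f g) → Reordered (p , xs) (p , ys)
      to (f , g , a , b , refl) = reordered (permutation (lookup f) (lookup g) a b)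
      from : Reordered (p , xs) (p , ys) → ∃ λ f → ∃ λ g → Spec f g
      from (reordered π) =
        tabulate (π ⟨$⟩ʳ_) , tabulate (π ⟨$⟩ˡ_) ,
        (λ i → trans (Vec.lookup∘tabulate _ (lookup (tabulate (π ⟨$⟩ˡ_)) i))
                     (trans (cong (π ⟨$⟩ʳ_) (Vec.lookup∘tabulate _ i)) (Perm.inverseʳ π))) ,
        (λ i → trans (Vec.lookup∘tabulate _ (lookup (tabulate (π ⟨$⟩ʳ_)) i))
                     (trans (cong (π ⟨$⟩ˡ_) (Vec.lookup∘tabulate _ i)) (Perm.inverseˡ π))) ,
        Vec.tabulate-cong (λ i → cong (lookup xs) (Vec.lookup∘tabulate _ i))

    ⟨_⟩ : Subset n → Interface
    ⟨ X ⟩ = 1 , X ∷ []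

    ⟨_∣_⟩ : Subset n → Subset n → Interface
    ⟨ X ∣ Y ⟩ = 2 , X ∷ Y ∷ []

    ⟨⟩ : Interface
    ⟨⟩ = 0 , []

    Generator : Summary → Set
    Generator x =
      (∃ λ X → x ≡ (⟨ X ⟩ , ⟨ X ⟩ , ⊥ , noEdges)) ⊎
      (∃ λ S → Nonempty S × x ≡ (⟨⟩ , ⟨ S ⟩ , S , noEdges)) ⊎
      (∃ λ X → x ≡ (⟨ X ⟩ , ⟨⟩ , ⊥ , noEdges)) ⊎
      (∃ λ X → ∃ λ Y → x ≡ (⟨ X ∣ Y ⟩ , ⟨ X ∪ Y ⟩ , ⊥ , noEdges)) ⊎
      (∃ λ X → ∃ λ Y → x ≡ (⟨ X ∣ Y ⟩ , ⟨ X ∣ Y ⟩ , ⊥ , between X Y)) ⊎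
      (∃ λ X → x ≡ (⟨ X ⟩ , ⟨ X ⟩ , ⊥ , within X))

    generator? : ∀ x → Dec (Generator x)
    generator? x =
      anySubset? (λ X → x ≟ʷ _) ⊎-dec
      anySubset? (λ S → nonempty? S ×-dec x ≟ʷ _) ⊎-dec
      anySubset? (λ X → x ≟ʷ _) ⊎-dec
      anySubset? (λ X → anySubset? λ Y → x ≟ʷ _) ⊎-dec
      anySubset? (λ X → anySubset? λ Y → x ≟ʷ _) ⊎-dec
      anySubset? (λ X → x ≟ʷ _)

    Combination : Summary → Summary → Summary → Set
    Combination (I , J , S , E) (I′ , J′ , S′ , E′) z =
      (Empty (S ∩ S′) × J ≡ I′ × z ≡ (I , J′ , S ∪ S′ , E ∪ᴱ E′)) ⊎
      (Empty (S ∩ S′) × z ≡ (I ⊕ I′ , J ⊕ J′ , S ∪ S′ , E ∪ᴱ E′)) ⊎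
      (Reordered (proj₁ z) I × Reordered J (proj₁ (proj₂ z)) × proj₂ (proj₂ z) ≡ (S , E))

    combination? : ∀ x y z → Dec (Combination x y z)
    combination? (I , J , S , E) (I′ , J′ , S′ , E′) z =
      (¬? (nonempty? (S ∩ S′)) ×-dec J ≟ᴵ I′ ×-dec z ≟ʷ _) ⊎-dec
      (¬? (nonempty? (S ∩ S′)) ×-dec z ≟ʷ _) ⊎-dec
      (reordered? (proj₁ z) I ×-dec reordered? J (proj₁ (proj₂ z)) ×-dec
       Prod.≡-dec _≟ˢ_ _≟ᴱ_ (proj₂ (proj₂ z)) (S , E))

    indicator : Subset n → Fin n → ℕ
    indicator S v = if lookup S v then 1 else 0

    indicator-∪ : ∀ S S′ → Empty (S ∩ S′) → ∀ v →
                  indicator S v + indicator S′ v ≡ indicator (S ∪ S′) v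
    indicator-∪ S S′ empty v rewrite Vec.lookup-zipWith _∨_ v S S′
      with lookup S v in eq | lookup S′ v in eq′
    ... | true  | true  = contradiction (v , x∈p∩q⁺ (Vec.lookup⇒[]= v S eq , Vec.lookup⇒[]= v S′ eq′)) empty
    ... | true  | false = refl
    ... | false | true  = refl
    ... | false | false = refl

    indicator-⊥ : ∀ v → indicator ⊥ v ≡ 0
    indicator-⊥ v rewrite Vec.lookup-replicate v outside = refl

    bornSet : ∀ {p q} → Expr n p q → Subset n
    bornSet (ν S _)         = S
    bornSet (s ⨾ t)         = bornSet s ∪ bornSet t
    bornSet (s □ t)         = bornSet s ∪ bornSet t
    bornSet (reindex _ _ t) = bornSet t
    bornSet _               = ⊥

    born⁺ : ∀ {p q} (t : Expr n p q) {v} → v ∈ bornSet t → 1 ≤ births t v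
    born⁺ e  i = contradiction i ∉⊥
    born⁺ κ  i = contradiction i ∉⊥
    born⁺ φ  i = contradiction i ∉⊥
    born⁺ B  i = contradiction i ∉⊥
    born⁺ K  i = contradiction i ∉⊥
    born⁺ (ν S _) i rewrite Vec.[]=⇒lookup i = s≤s z≤n
    born⁺ (s ⨾ t) {v} i with x∈p∪q⁻ _ _ i
    ... | inj₁ a = ℕ.≤-trans (born⁺ s a) (ℕ.m≤m+n _ _)
    ... | inj₂ b = ℕ.≤-trans (born⁺ t b) (ℕ.m≤n+m _ (births s v))
    born⁺ (s □ t) {v} i with x∈p∪q⁻ _ _ i
    ... | inj₁ a = ℕ.≤-trans (born⁺ s a) (ℕ.m≤m+n _ _)
    ... | inj₂ b = ℕ.≤-trans (born⁺ t b) (ℕ.m≤n+m _ (births s v))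
    born⁺ (reindex _ _ t) i = born⁺ t i

    +-positive : ∀ a {b} → 1 ≤ a + b → 1 ≤ a ⊎ 1 ≤ b
    +-positive zero    le = inj₂ le
    +-positive (suc a) le = inj₁ (s≤s z≤n)

    born⁻ : ∀ {p q} (t : Expr n p q) {v} → 1 ≤ births t v → v ∈ bornSet t
    born⁻ (ν S _) {v} le with lookup S v in eq
    ... | true = Vec.lookup⇒[]= v S eq
    born⁻ (s ⨾ t) {v} le with +-positive (births s v) le
    ... | inj₁ a = x∈p∪q⁺ (inj₁ (born⁻ s a))
    ... | inj₂ b = x∈p∪q⁺ (inj₂ (born⁻ t b))
    born⁻ (s □ t) {v} le with +-positive (births s v) le
    ... | inj₁ a = x∈p∪q⁺ (inj₁ (born⁻ s a))
    ... | inj₂ b = x∈p∪q⁺ (inj₂ (born⁻ t b))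
    born⁻ (reindex _ _ t) le = born⁻ t le

    disjoint : ∀ {p q p′ q′} (s : Expr n p q) (t : Expr n p′ q′) →
               (∀ v → births s v + births t v ≤ 1) → Empty (bornSet s ∩ bornSet t)
    disjoint s t once (v , i) with x∈p∩q⁻ _ _ i
    ... | a , b with ℕ.≤-trans (ℕ.+-mono-≤ (born⁺ s a) (born⁺ t b)) (once v)
    ...   | s≤s ()

  module _ (k : ℕ) where
    private
      interfaces : List Interface
      interfaces = List.concat
        (List.map (λ p → List.map (p ,_) (proj₁ (listVec (listSubsets n) p))) (List.upTo (suc k)))

      ∈-interfaces : ∀ {p} (xs : Vec (Subset n) p) → p ≤ k → (p , xs) ∈ˡ interfaces
      ∈-interfaces {p} xs le = ∈-concat⁺′ (∈-map⁺ (p ,_) (proj₂ (listVec (listSubsets n) p) xs))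
        (∈-map⁺ (λ p → List.map (p ,_) (proj₁ (listVec (listSubsets n) p))) (∈-upTo⁺ (s≤s le)))

      InRange : Summary → Set
      InRange ((p , _) , (q , _) , _) = p + q ≤ k

      inRange? : ∀ x → Dec (InRange x)
      inRange? ((p , _) , (q , _) , _) = p + q ℕ.≤? k

      allSummaries summaries : List Summary
      allSummaries =
        List.cartesianProductWith _,_ interfaces
          (List.cartesianProductWith _,_ interfaces
            (List.cartesianProductWith _,_ (proj₁ (listSubsets n)) (proj₁ (listEdgeSets n))))
      summaries = List.filter inRange? allSummaries

      ∈-summaries : ∀ x → InRange x → x ∈ˡ summaries
      ∈-summaries ((p , xs) , (q , ys) , S , E) le = ∈-filter⁺ inRange?
        (∈-cartesianProductWith⁺ _,_ (∈-interfaces xs (ℕ.m+n≤o⇒m≤o p le))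
          (∈-cartesianProductWith⁺ _,_ (∈-interfaces ys (ℕ.m+n≤o⇒n≤o p le))
            (∈-cartesianProductWith⁺ _,_ (proj₂ (listSubsets n) S) (proj₂ (listEdgeSets n) E)))) le

      range : ∀ {x} → x ∈ˡ summaries → InRange x
      range i = proj₂ (∈-filter⁻ inRange? {xs = allSummaries} i)

      module C = Closure summaries _≟ʷ_ Generator Combination generator? combination?

      Realised : Summary → Set
      Realised ((p , xs) , (q , ys) , S , E) = Σ (Expr n p q) λ t →
        outputs t xs ≡ ys × addedEdges t xs ≡ E × (∀ v → births t v ≡ indicator S v) × exprWidth t ≤ k

      sound : ∀ {x} → C.Derivable x → Realised x
      sound (C.ax u (inj₁ (X , refl))) = e , refl , refl , (λ v → sym (indicator-⊥ v)) , range u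
      sound (C.ax u (inj₂ (inj₁ (S , ne , refl)))) = ν S ne , refl , refl , (λ v → refl) , range u
      sound (C.ax u (inj₂ (inj₂ (inj₁ (X , refl))))) =
        κ , refl , refl , (λ v → sym (indicator-⊥ v)) , range u
      sound (C.ax u (inj₂ (inj₂ (inj₂ (inj₁ (X , Y , refl)))))) =
        φ , refl , refl , (λ v → sym (indicator-⊥ v)) , range u
      sound (C.ax u (inj₂ (inj₂ (inj₂ (inj₂ (inj₁ (X , Y , refl))))))) =
        B , refl , refl , (λ v → sym (indicator-⊥ v)) , range u
      sound (C.ax u (inj₂ (inj₂ (inj₂ (inj₂ (inj₂ (X , refl))))))) =
        K , refl , refl , (λ v → sym (indicator-⊥ v)) , range u
      sound (C.by {x = x} {y = y} u d d′ (inj₁ (em , refl , refl))) with sound d | sound d′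
      ... | s , refl , refl , b , w | t , refl , refl , b′ , w′ =
        s ⨾ t , refl , refl ,
        (λ v → trans (cong₂ _+_ (b v) (b′ v)) (indicator-∪ _ _ em v)) ,
        ℕ.⊔-lub (range u) (ℕ.⊔-lub w w′)
      sound (C.by {x = (p , xs) , _} {y = (p′ , xs′) , _} u d d′ (inj₂ (inj₁ (em , refl))))
        with sound d | sound d′
      ... | s , refl , refl , b , w | t , refl , refl , b′ , w′ =
        s □ t ,
        cong₂ (λ xs xs′ → outputs s xs ++ outputs t xs′) (take-++ xs xs′) (drop-++ xs xs′) ,
        cong₂ (λ xs xs′ → addedEdges s xs ∪ᴱ addedEdges t xs′) (take-++ xs xs′) (drop-++ xs xs′) ,
        (λ v → trans (cong₂ _+_ (b v) (b′ v)) (indicator-∪ _ _ em v)) ,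
        ℕ.⊔-lub (range u) (ℕ.⊔-lub w w′)
      sound (C.by u d d′ (inj₂ (inj₂ (reordered π , reordered ρ , refl)))) with sound d
      ... | t , refl , refl , b , w = reindex π ρ t , refl , refl , b , w

      complete : ∀ {p q} (t : Expr n p q) xs → (∀ v → births t v ≤ 1) → exprWidth t ≤ k →
                 C.Derivable ((p , xs) , (q , outputs t xs) , bornSet t , addedEdges t xs)
      complete e (X ∷ []) _ w = C.ax (∈-summaries _ w) (inj₁ (X , refl))
      complete (ν S ne) [] _ w = C.ax (∈-summaries _ w) (inj₂ (inj₁ (S , ne , refl)))
      complete κ (X ∷ []) _ w = C.ax (∈-summaries _ w) (inj₂ (inj₂ (inj₁ (X , refl))))
      complete φ (X ∷ Y ∷ []) _ w = C.ax (∈-summaries _ w) (inj₂ (inj₂ (inj₂ (inj₁ (X , Y , refl)))))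
      complete B (X ∷ Y ∷ []) _ w =
        C.ax (∈-summaries _ w) (inj₂ (inj₂ (inj₂ (inj₂ (inj₁ (X , Y , refl))))))
      complete K (X ∷ []) _ w = C.ax (∈-summaries _ w) (inj₂ (inj₂ (inj₂ (inj₂ (inj₂ (X , refl))))))
      complete {p} {q} (s ⨾ t) xs once w =
        C.by (∈-summaries _ (ℕ.≤-trans (rank≤width (s ⨾ t)) w))
          (complete s xs (λ v → ℕ.m+n≤o⇒m≤o _ (once v)) (ℕ.m⊔n≤o⇒m≤o _ _ w″))
          (complete t (outputs s xs) (λ v → ℕ.m+n≤o⇒n≤o (births s v) (once v))
                    (ℕ.m⊔n≤o⇒n≤o (exprWidth s) _ w″))
          (inj₁ (disjoint s t once , refl , refl))
        where w″ = ℕ.m⊔n≤o⇒n≤o (p + q) (exprWidth s ⊔ exprWidth t) w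
      complete (_□_ {p} {q} {p′} {q′} s t) xs once w =
        C.by (∈-summaries _ (ℕ.≤-trans (rank≤width (s □ t)) w))
          (complete s (take p xs) (λ v → ℕ.m+n≤o⇒m≤o _ (once v)) (ℕ.m⊔n≤o⇒m≤o _ _ w″))
          (complete t (drop p xs) (λ v → ℕ.m+n≤o⇒n≤o (births s v) (once v))
                    (ℕ.m⊔n≤o⇒n≤o (exprWidth s) _ w″))
          (inj₂ (inj₁ (disjoint s t once ,
            cong (λ ys → (p + p′ , ys) , (q + q′ , outputs (s □ t) xs) , bornSet s ∪ bornSet t , addedEdges (s □ t) xs)
                 (sym (Vec.take++drop≡id p xs)))))
        where w″ = ℕ.m⊔n≤o⇒n≤o (p + p′ + (q + q′)) (exprWidth s ⊔ exprWidth t) w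
      complete (reindex π ρ t) xs once w =
        let d = complete t (permute π xs) once w
        in C.by (∈-summaries _ (ℕ.≤-trans (rank≤width t) w)) d d
             (inj₂ (inj₂ (reordered π , reordered ρ , refl)))

    module _ (G : Graph n) where
      open Graph G
      private
        Draws : Subset n × EdgeSet n → Set
        Draws (S , E) = C.Derivable (⟨⟩ , ⟨⟩ , S , E) × (∀ v → v ∈ S) ×
                        (∀ u v → E ∋ u ~ v → Adj u v) × (∀ u v → Adj u v → E ∋ u ~ v)

        draws? : ∀ x → Dec (Draws x)
        draws? (S , E) =
          C.derivable? (⟨⟩ , ⟨⟩ , S , E) ×-dec Fin.all? (_∈? S) ×-dec
          (Fin.all? λ u → Fin.all? λ v → (E ∋ u ~? v) →-dec adj? u v) ×-dec
          (Fin.all? λ u → Fin.all? λ v → adj? u v →-dec (E ∋ u ~? v))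

      abstract
        exprWithin? : Dec (∃ λ w → HasExprOfWidth G w × w ≤ k)
        exprWithin? = map′ to from (any∈? (listProduct (listSubsets n) (listEdgeSets n)) draws?)
          where
          one : ∀ {S v} → v ∈ S → indicator S v ≡ 1
          one i rewrite Vec.[]=⇒lookup i = refl
          to : ∃ Draws → ∃ λ w → HasExprOfWidth G w × w ≤ k
          to ((S , E) , d , all , a , b) with sound d
          ... | t , _ , refl , once , w =
            exprWidth t ,
            (t , record { bornOnce = λ v → trans (once v) (one (all v))
                        ; value = λ u v → mk⇔ (a u v) (b u v) } , refl) , w
          outputs-[] : ∀ (xs : Vec (Subset n) 0) → xs ≡ []
          outputs-[] [] = refl
          from : (∃ λ w → HasExprOfWidth G w × w ≤ k) → ∃ Draws
          from (_ , (t , legal , refl) , w) =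
            let open Legal legal
            in (bornSet t , addedEdges t []) ,
               subst (λ ys → C.Derivable (⟨⟩ , (0 , ys) , bornSet t , addedEdges t [])) (outputs-[] _)
                     (complete t [] (λ v → ℕ.≤-reflexive (bornOnce v)) w) ,
               (λ v → born⁻ t (ℕ.≤-reflexive (sym (bornOnce v)))) ,
               (λ u v → Equivalence.to (value u v)) , (λ u v → Equivalence.from (value u v))

private
  module _ {n : ℕ} where
    singletons : ∀ m → (Fin (suc m) → Fin n) → Expr n 0 (suc m)
    singletons zero    f = ν ⁅ f zero ⁆ (f zero , x∈⁅x⁆ _)
    singletons (suc m) f = ν ⁅ f zero ⁆ (f zero , x∈⁅x⁆ _) □ singletons m (f ∘ suc)

    singletons-outputs : ∀ m f → outputs (singletons m f) [] ≡ tabulate (⁅_⁆ ∘ f)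
    singletons-outputs zero    f = refl
    singletons-outputs (suc m) f = cong (⁅ f zero ⁆ ∷_) (singletons-outputs m (f ∘ suc))

    singletons-edges : ∀ m f {u v} → ¬ addedEdges (singletons m f) [] ∋ u ~ v
    singletons-edges zero    f i = noEdges⁻ i
    singletons-edges (suc m) f i with ∪ᴱ⁻ noEdges _ i
    ... | inj₁ a = noEdges⁻ a
    ... | inj₂ b = singletons-edges m (f ∘ suc) b

    hit : ∀ {v w : Fin n} → w ≡ v → (if lookup ⁅ w ⁆ v then 1 else 0) ≡ 1
    hit {v} refl rewrite Vec.[]=⇒lookup (x∈⁅x⁆ v) = refl

    miss : ∀ {v w : Fin n} → w ≢ v → (if lookup ⁅ w ⁆ v then 1 else 0) ≡ 0
    miss {v} {w} w≢v with lookup ⁅ w ⁆ v in eq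
    ... | true  = contradiction (sym (x∈⁅y⁆⇒x≡y w (Vec.lookup⇒[]= v _ eq))) w≢v
    ... | false = refl

    unborn : ∀ m f v → (∀ i → f i ≢ v) → births (singletons m f) v ≡ 0
    unborn zero    f v h = miss (h zero)
    unborn (suc m) f v h = cong₂ _+_ (miss (h zero)) (unborn m (f ∘ suc) v (h ∘ suc))

    bornOne : ∀ m f v → (∀ {i j} → f i ≡ f j → i ≡ j) → ∀ i → f i ≡ v → births (singletons m f) v ≡ 1
    bornOne zero    f v inj zero    eq = hit eq
    bornOne (suc m) f v inj zero    eq =
      cong₂ _+_ (hit eq) (unborn m (f ∘ suc) v λ j eq′ → Fin.0≢1+n (inj (trans eq (sym eq′))))
    bornOne (suc m) f v inj (suc i) eq =
      cong₂ _+_ (miss λ eq′ → Fin.0≢1+n (inj (trans eq′ (sym eq))))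
                (bornOne m (f ∘ suc) v (Fin.suc-injective ∘ inj) i eq)

    wires : ∀ m → Expr n (suc m) (suc m)
    wires zero    = e
    wires (suc m) = e □ wires m

    wires-outputs : ∀ m Xs → outputs (wires m) Xs ≡ Xs
    wires-outputs zero    Xs       = refl
    wires-outputs (suc m) (X ∷ Xs) = cong (X ∷_) (wires-outputs m Xs)

    wires-edges : ∀ m Xs {u v} → ¬ addedEdges (wires m) Xs ∋ u ~ v
    wires-edges zero    Xs       i = noEdges⁻ i
    wires-edges (suc m) (X ∷ Xs) i with ∪ᴱ⁻ noEdges _ i
    ... | inj₁ a = noEdges⁻ a
    ... | inj₂ b = wires-edges m Xs b

    wires-births : ∀ m v → births (wires m) v ≡ 0
    wires-births zero    v = refl
    wires-births (suc m) v = wires-births m v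

    closers : ∀ m → Expr n (suc m) 0
    closers zero    = κ
    closers (suc m) = κ □ closers m

    closers-edges : ∀ m Xs {u v} → ¬ addedEdges (closers m) Xs ∋ u ~ v
    closers-edges zero    Xs       i = noEdges⁻ i
    closers-edges (suc m) (X ∷ Xs) i with ∪ᴱ⁻ noEdges _ i
    ... | inj₁ a = noEdges⁻ a
    ... | inj₂ b = closers-edges m Xs b

    closers-births : ∀ m v → births (closers m) v ≡ 0
    closers-births zero    v = refl
    closers-births (suc m) v = closers-births m v

    record Block {N} (i j : Fin N) : Set where
      field
        term      : Expr n N N
        unchanged : ∀ Xs → outputs term Xs ≡ Xs
        edges⁺    : ∀ Xs {u v} → between (lookup Xs i) (lookup Xs j) ∋ u ~ v → addedEdges term Xs ∋ u ~ v
        edges⁻    : ∀ Xs {u v} → addedEdges term Xs ∋ u ~ v → between (lookup Xs i) (lookup Xs j) ∋ u ~ v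
        noBirths  : ∀ v → births term v ≡ 0

    block01 : ∀ m → Block {2 + m} zero (suc zero)
    block01 zero = record
      { term = B ; unchanged = λ _ → refl
      ; edges⁺ = λ { (X ∷ Y ∷ []) i → i } ; edges⁻ = λ { (X ∷ Y ∷ []) i → i } ; noBirths = λ _ → refl }
    block01 (suc m) = record
      { term = B □ wires m
      ; unchanged = λ { (X ∷ Y ∷ Xs) → cong (λ Xs → X ∷ Y ∷ Xs) (wires-outputs m Xs) }
      ; edges⁺ = λ { (X ∷ Y ∷ Xs) i → ∪ᴱ⁺ (between X Y) _ (inj₁ i) }
      ; edges⁻ = λ { (X ∷ Y ∷ Xs) i → [ id , (λ b → contradiction b (wires-edges m Xs)) ]′
                                         (∪ᴱ⁻ (between X Y) _ i) }
      ; noBirths = wires-births m }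

    blockAt : ∀ {N} (i j : Fin N) → i ≢ j → Block i j
    blockAt {suc zero}    zero zero i≢j = contradiction refl i≢j
    blockAt {suc (suc m)} i    j    i≢j = record
      { term = reindex σ (flip σ) term
      ; unchanged = λ Xs → trans
          (cong (permute (flip σ)) (unchanged (permute σ Xs)))
          (trans (Vec.tabulate-cong λ x →
                    trans (Vec.lookup∘tabulate (λ y → lookup Xs (σ ⟨$⟩ʳ y)) (σ ⟨$⟩ˡ x))
                          (cong (lookup Xs) (Perm.inverseʳ σ {x})))
                 (Vec.tabulate∘lookup Xs))
      ; edges⁺ = λ Xs {u} {v} a → edges⁺ (permute σ Xs)
          (subst₂ (λ X Y → between X Y ∋ u ~ v) (sym (at0 Xs)) (sym (at1 Xs)) a)
      ; edges⁻ = λ Xs {u} {v} a →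
          subst₂ (λ X Y → between X Y ∋ u ~ v) (at0 Xs) (at1 Xs) (edges⁻ (permute σ Xs) a)
      ; noBirths = noBirths }
      where
      open Block (block01 m)
      τ : Permutation′ (suc m)
      τ = insert zero (punchOut i≢j) Perm.id
      σ : Permutation′ (2 + m)
      σ = insert zero i τ
      at0 : ∀ (Xs : Vec (Subset n) (2 + m)) → lookup (permute σ Xs) zero ≡ lookup Xs i
      at0 Xs = refl
      at1 : ∀ (Xs : Vec (Subset n) (2 + m)) → lookup (permute σ Xs) (suc zero) ≡ lookup Xs j
      at1 Xs = cong (lookup Xs) (trans (Perm.insert-punchIn zero i τ zero) (Fin.punchIn-punchOut i≢j))

  module _ {m : ℕ} (G : Graph (suc m)) where
    open Graph G

    points : Vec (Subset (suc m)) (suc m)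
    points = tabulate ⁅_⁆

    at-points : ∀ {i u : Fin (suc m)} → u ∈ lookup points i → u ≡ i
    at-points {i} a = x∈⁅y⁆⇒x≡y i (subst (_ ∈_) (Vec.lookup∘tabulate ⁅_⁆ i) a)

    points-at : ∀ (i : Fin (suc m)) → i ∈ lookup points i
    points-at i = subst (i ∈_) (sym (Vec.lookup∘tabulate ⁅_⁆ i)) (x∈⁅x⁆ i)

    record Drawing (ps : List (Fin (suc m) × Fin (suc m))) : Set where
      field
        term      : Expr (suc m) (suc m) (suc m)
        unchanged : outputs term points ≡ points
        edges⁺    : ∀ u v → (u , v) ∈ˡ ps → Adj u v → addedEdges term points ∋ u ~ v
        edges⁻    : ∀ u v → addedEdges term points ∋ u ~ v → Adj u v
        noBirths  : ∀ v → births term v ≡ 0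

    draw : ∀ ps → Drawing ps
    draw [] = record
      { term = wires m ; unchanged = wires-outputs m points ; edges⁺ = λ _ _ ()
      ; edges⁻ = λ _ _ a → contradiction a (wires-edges m points) ; noBirths = wires-births m }
    draw ((i , j) ∷ ps) with adj? i j
    ... | no ¬a = record
      { term = term ; unchanged = unchanged
      ; edges⁺ = λ { _ _ (here refl) a → contradiction a ¬a ; u v (there i) → edges⁺ u v i }
      ; edges⁻ = edges⁻ ; noBirths = noBirths }
      where open Drawing (draw ps)
    ... | yes a = record
      { term = b.term ⨾ d.term
      ; unchanged = trans (cong (outputs d.term) (b.unchanged points)) d.unchanged
      ; edges⁺ = λ { _ _ (here refl) _ → ∪ᴱ⁺ (addedEdges b.term points) _
                       (inj₁ (b.edges⁺ points (between⁺ _ _ (inj₁ (points-at i , points-at j)))))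
                   ; u v (there p) c → ∪ᴱ⁺ (addedEdges b.term points) _
                       (inj₂ (subst (λ Xs → addedEdges d.term Xs ∋ u ~ v)
                                    (sym (b.unchanged points)) (d.edges⁺ u v p c))) }
      ; edges⁻ = back
      ; noBirths = λ v → cong₂ _+_ (b.noBirths v) (d.noBirths v) }
      where
      i≢j : i ≢ j
      i≢j refl = adj-irrefl a
      module b = Block (blockAt {suc m} i j i≢j)
      module d = Drawing (draw ps)
      back : ∀ u v → addedEdges (b.term ⨾ d.term) points ∋ u ~ v → Adj u v
      back u v x with ∪ᴱ⁻ (addedEdges b.term points) _ x
      ... | inj₂ y = d.edges⁻ u v (subst (λ Xs → addedEdges d.term Xs ∋ u ~ v) (b.unchanged points) y)
      ... | inj₁ y with between⁻ _ _ (b.edges⁻ points y)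
      ...   | inj₁ (p , q) = subst₂ Adj (sym (at-points p)) (sym (at-points q)) a
      ...   | inj₂ (p , q) = subst₂ Adj (sym (at-points p)) (sym (at-points q)) (adj-sym a)

hasExpr : ∀ {m} (G : Graph (suc m)) → ∃ (HasExprOfWidth G)
hasExpr {m} G = _ , t , record { bornOnce = once ; value = λ u v → mk⇔ (to u v) (from u v) } , refl
  where
  open Graph G
  vs = List.allFin (suc m)
  open Drawing (draw G (List.cartesianProductWith _,_ vs vs))
  s = singletons m id
  t = s ⨾ term ⨾ closers m
  once : ∀ v → births t v ≡ 1
  once v = cong₂ _+_ (cong₂ _+_ (bornOne m id v id v refl) (noBirths v)) (closers-births m v)
  to : ∀ u v → addedEdges t [] ∋ u ~ v → Adj u v
  to u v a with ∪ᴱ⁻ (addedEdges (s ⨾ term) []) _ a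
  ... | inj₂ c = contradiction c (closers-edges m _)
  ... | inj₁ b with ∪ᴱ⁻ (addedEdges s []) _ b
  ...   | inj₁ c = contradiction c (singletons-edges m id)
  ...   | inj₂ c = edges⁻ u v (subst (λ Xs → addedEdges term Xs ∋ u ~ v) (singletons-outputs m id) c)
  from : ∀ u v → Adj u v → addedEdges t [] ∋ u ~ v
  from u v a = ∪ᴱ⁺ (addedEdges (s ⨾ term) []) _ (inj₁ (∪ᴱ⁺ (addedEdges s []) _ (inj₂
    (subst (λ Xs → addedEdges term Xs ∋ u ~ v) (sym (singletons-outputs m id))
      (edges⁺ u v (∈-cartesianProductWith⁺ _,_ (∈-allFin u) (∈-allFin v)) a)))))

-- No expression is legal for the graph on no vertices, as every closed
-- term contains a birth; its value 0 is a convention.  For lsfw the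
-- empty play already gives 0.
sfw : ∀ {n} → Graph n → ℕ
sfw {zero}  G = 0
sfw {suc _} G = proj₁ (minimum (λ k → exprWithin? k G) (hasExpr G))

lsfw : ∀ {n} → Graph n → ℕ
lsfw G = proj₁ (minimum (playWithin? G) (hasPlay G))

pw : ∀ {n} → Graph n → ℕ
pw G = proj₁ (minimum (pathDecompositionWithin? G) (hasPathDecomposition G))

sfw-isMinimum : ∀ {m} (G : Graph (suc m)) → IsMinimum (HasExprOfWidth G) (sfw G)
sfw-isMinimum G = proj₂ (minimum (λ k → exprWithin? k G) (hasExpr G))

lsfw-isMinimum : ∀ {n} (G : Graph n) → IsMinimum (HasPlayOfWidth G) (lsfw G)
lsfw-isMinimum G = proj₂ (minimum (playWithin? G) (hasPlay G))

pw-isMinimum : ∀ {n} (G : Graph n) → IsMinimum (HasPathDecompositionOfWidth G) (pw G)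
pw-isMinimum G = proj₂ (minimum (pathDecompositionWithin? G) (hasPathDecomposition G))

module Submission where

-- Lower bound.  Say that a vertex is settled once it has a placed edge
-- and no longer forms a cable by itself.  In a forest all unplaced edges
-- at a cable with two or more vertices lead to one vertex (or are the
-- single edge inside the cable), since a block is a star.  So count an
-- edge as covered when it is placed or has a settled end: each live
-- cable then accounts for at most one vertex that meets both covered and
-- uncovered edges, namely its only vertex or the far end of its unplaced
-- edges.  A block or clique at ℓ cables costs 2ℓ, and no other move
-- enlarges this boundary, so a play of width k keeps it within ⌊k/2⌋
-- vertices.  Sweeping the edges as they become covered gives bags with
-- one more vertex.
--
-- Upper bound.  A rooted tree is drawn as a term 0 → 1 that returns its
-- root: draw two trees in parallel, join the roots by a block and close
-- the second root.
--
-- Gap.  The complete ternary tree of height h has path-width at least h.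

open import Defs
open import Algebra.Properties.CommutativeSemigroup using (xy∙z≈xz∙y)
open import Data.Bool.Base using (true; false; if_then_else_)
import Data.Empty as Empty
open import Data.Fin.Base as Fin using (Fin; zero; suc)
import Data.Fin.Properties as Fin
open import Data.Fin.Subset
  using (Subset; _∈_; _∉_; _⊆_; _∪_; _∩_; ∣_∣; ⁅_⁆; Nonempty; Empty; ⊥)
  renaming (_-_ to _-ˢ_)
open import Data.Fin.Subset.Properties
open import Data.Integer.Base as ℤ using (ℤ; +_; -[1+_]; _-_) renaming (_≤_ to _≤ᶻ_)
import Data.Integer.Properties as ℤ
open import Data.List.Base as List using (List; []; _∷_; _∷ʳ_; length)
import Data.List.Properties as List
open import Data.List.Membership.Propositional using (lose; find) renaming (_∈_ to _∈ˡ_)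
open import Data.List.Membership.Propositional.Properties using (∈-allFin; ∈-++⁺ʳ)
open import Data.List.Relation.Unary.All as All using (All; []; _∷_)
import Data.List.Relation.Unary.All.Properties as All
open import Data.List.Relation.Unary.AllPairs using (AllPairs; []; _∷_)
open import Data.List.Relation.Unary.Any as Any using (Any; here; there; _─_)
open import Data.List.Relation.Unary.Linked as Linked using (Linked; []; [-]; _∷_)
open import Data.List.Relation.Unary.Unique.Propositional using (Unique)
open import Data.Maybe.Base using (just)
open import Data.Nat.Base using (ℕ; zero; suc; _+_; _*_; _∸_; _⊔_; _≤_; _<_; z≤n; s≤s; ⌊_/2⌋; ⌈_/2⌉)
import Data.Nat.Properties as ℕ
open import Data.Product.Base using (Σ; ∃; _×_; _,_; proj₁; proj₂)
open import Data.Sum.Base as Sum using (_⊎_; inj₁; inj₂; [_,_]′)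
open import Data.Vec.Base as Vec using ([]; _∷_; lookup; tabulate)
import Data.Vec.Functional as Vector
import Data.Vec.Properties as Vec
open import Function.Base using (_∘_; id)
open import Function.Bundles using (mk⇔)
open import Level using (0ℓ)
open import Relation.Binary.Core using (Rel)
open import Relation.Binary.Definitions using (Decidable; Symmetric)
open import Relation.Binary.Construct.Closure.ReflexiveTransitive as Star using (Star; ε; _◅_; _◅◅_)
open import Relation.Binary.PropositionalEquality
  using (_≡_; _≢_; refl; sym; trans; cong; subst; subst₂; module ≡-Reasoning)
open import Relation.Nullary using (¬_; Dec; yes; no; contradiction)
open import Relation.Nullary.Decidable
  using (does; dec-true; decidable-stable; map′; ¬?; _×-dec_; _⊎-dec_)

-- Finite subsets and their cardinalities

comprehension : ∀ {n} {P : Fin n → Set} → (∀ v → Dec (P v)) → Subset n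
comprehension P? = tabulate (does ∘ P?)

module _ {n} {P : Fin n → Set} (P? : ∀ v → Dec (P v)) where
  comprehension⁺ : ∀ {v} → P v → v ∈ comprehension P?
  comprehension⁺ {v} p =
    Vec.lookup⇒[]= v _ (trans (Vec.lookup∘tabulate (does ∘ P?) v) (dec-true (P? v) p))

  comprehension⁻ : ∀ {v} → v ∈ comprehension P? → P v
  comprehension⁻ {v} v∈ with P? v | trans (sym (Vec.lookup∘tabulate (does ∘ P?) v)) (Vec.[]=⇒lookup v∈)
  ... | yes p | _ = p

∣⁅x⁆∪p∣≤1+∣p∣ : ∀ {n} (x : Fin n) p → ∣ ⁅ x ⁆ ∪ p ∣ ≤ suc ∣ p ∣
∣⁅x⁆∪p∣≤1+∣p∣ zero    (s ∷ p) rewrite ∪-identityˡ p = s≤s (∣p∣≤∣x∷p∣ s p)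
∣⁅x⁆∪p∣≤1+∣p∣ (suc x) (false ∷ p) = ∣⁅x⁆∪p∣≤1+∣p∣ x p
∣⁅x⁆∪p∣≤1+∣p∣ (suc x) (true ∷ p)  = s≤s (∣⁅x⁆∪p∣≤1+∣p∣ x p)

∣p∣≤length : ∀ {n} (p : Subset n) L → (∀ {v} → v ∈ p → v ∈ˡ L) → ∣ p ∣ ≤ length L
∣p∣≤length {n} p L sub =
  ℕ.≤-trans (p⊆q⇒∣p∣≤∣q∣ (union⁺ L ∘ sub)) (bound L)
  where
  union : List (Fin n) → Subset n
  union = List.foldr (λ x q → ⁅ x ⁆ ∪ q) ⊥
  union⁺ : ∀ L {v} → v ∈ˡ L → v ∈ union L
  union⁺ (x ∷ L) (here refl) = x∈p∪q⁺ (inj₁ (x∈⁅x⁆ x))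
  union⁺ (x ∷ L) (there i)   = x∈p∪q⁺ (inj₂ (union⁺ L i))
  bound : ∀ L → ∣ union L ∣ ≤ length L
  bound []      = ℕ.≤-reflexive (∣⊥∣≡0 n)
  bound (x ∷ L) = ℕ.≤-trans (∣⁅x⁆∪p∣≤1+∣p∣ x (union L)) (s≤s (bound L))

foldr-⊔-lub : ∀ {m s} (f : Fin m → ℕ) → (∀ i → f i ≤ s) → Vector.foldr _⊔_ 0 f ≤ s
foldr-⊔-lub {zero}  f le = z≤n
foldr-⊔-lub {suc m} f le = ℕ.⊔-lub (le zero) (foldr-⊔-lub (f ∘ suc) (le ∘ suc))

-- Path decompositions from sweeps of the edges

module _ {n} (G : Graph n) where
  open Graph G

  record Cover : Set₁ where
    field
      Covered  : Rel (Fin n) 0ℓ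
      covered? : Decidable Covered
      sym-cov  : Symmetric Covered

    Touched Open : Fin n → Set
    Touched w = ∃ λ v → Adj w v × Covered w v
    Open    w = ∃ λ v → Adj w v × ¬ Covered w v

    touched? : ∀ w → Dec (Touched w)
    touched? w = Fin.any? λ v → adj? w v ×-dec covered? w v

    open? : ∀ w → Dec (Open w)
    open? w = Fin.any? λ v → adj? w v ×-dec ¬? (covered? w v)

  open Cover

  infix 4 _⊑_
  _⊑_ : Cover → Cover → Set
  C ⊑ D = ∀ {u v} → Adj u v → Covered C u v → Covered D u v

  touched-mono : ∀ {C D} → C ⊑ D → ∀ {w} → Touched C w → Touched D w
  touched-mono le (v , a , c) = v , a , le a c

  open-anti : ∀ {C D} → C ⊑ D → ∀ {w} → Open D w → Open C w
  open-anti le (v , a , c) = v , a , λ d → c (le a d)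

  -- Extending C to D contributes the bag of the vertices touched by D and open in C.
  data Sweep (s : ℕ) (C : Cover) : Set₁ where
    complete : (∀ {u v} → Adj u v → Covered C u v) → Sweep s C
    extend   : ∀ D → C ⊑ D → (L : List (Fin n)) → length L ≤ s →
               (∀ {w} → Touched D w → Open C w → w ∈ˡ L) → Sweep s D → Sweep s C

  private
    -- The induction hypothesis for reading bags off a sweep: a path decomposition of the edges that
    -- `C` leaves uncovered. A vertex touched by `C` may already lie in an earlier bag, so
    -- `initially` makes its later bags an initial segment; `opens` certifies that such a vertex is
    -- still open.
    record Bags (s : ℕ) (C : Cover) : Set where
      field
        count      : ℕ
        bag        : Fin count → Subset n
        small      : ∀ i → ∣ bag i ∣ ≤ s
        contiguous : ∀ v {i j k} → i Fin.≤ j → j Fin.≤ k → v ∈ bag i → v ∈ bag k → v ∈ bag j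
        initially  : ∀ {v j k} → Touched C v → j Fin.≤ k → v ∈ bag k → v ∈ bag j
        opens      : ∀ {v u} i → v ∈ bag i → Adj v u → Open C v
        edges      : ∀ {u v} → Adj u v → ¬ Covered C u v → ∃ λ i → u ∈ bag i × v ∈ bag i
        isolated   : ∀ {v} → (∀ u → ¬ Adj v u) → ∃ λ i → v ∈ bag i

    bags : ∀ {s C} → 1 ≤ s → Sweep s C → Bags s C
    bags {s} 1≤s (complete all) = record
      { count = n
      ; bag = bag
      ; small = λ i → ℕ.≤-trans (∣p∣≤length (bag i) (i ∷ []) (λ v∈ → here (proj₂ (only i v∈)))) 1≤s
      ; contiguous = λ v {i} {j} {k} i≤j j≤k vi vk →
          subst (λ j → v ∈ bag j)
            (Fin.≤-antisym i≤j (subst (j Fin.≤_) (trans (sym (proj₂ (only k vk))) (proj₂ (only i vi))) j≤k)) vi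
      ; initially = λ { {k = k} (u , a , _) _ vk → contradiction a (proj₁ (only k vk) u) }
      ; opens = λ i vi a → contradiction a (proj₁ (only i vi) _)
      ; edges = λ a ¬c → contradiction (all a) ¬c
      ; isolated = λ {v} iso → v , comprehension⁺ (alone? v) (iso , refl)
      }
      where
      alone? : ∀ i v → Dec ((∀ u → ¬ Adj v u) × v ≡ i)
      alone? i v = Fin.all? (λ u → ¬? (adj? v u)) ×-dec v Fin.≟ i
      bag : Fin n → Subset n
      bag i = comprehension (alone? i)
      only : ∀ i {v} → v ∈ bag i → (∀ u → ¬ Adj v u) × v ≡ i
      only i = comprehension⁻ (alone? i)
    bags {s} {C} 1≤s (extend D C⊑D L len sub σ) = record
      { count = suc count
      ; bag = bag′
      ; small = λ { zero → ℕ.≤-trans (∣p∣≤length (bag′ zero) L (λ v∈ → let t , o = here⁻ v∈ in sub t o)) len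
                  ; (suc i) → small i }
      ; contiguous = contiguous′
      ; initially = initially′
      ; opens = λ { zero vi _ → proj₂ (here⁻ vi) ; (suc i) vi a → open-anti {C} {D} C⊑D (opens i vi a) }
      ; edges = edges′
      ; isolated = λ iso → let i , v∈ = isolated iso in suc i , v∈
      }
      where
      open Bags (bags 1≤s σ)
      now? : ∀ v → Dec (Touched D v × Open C v)
      now? v = touched? D v ×-dec open? C v
      bag′ : Fin (suc count) → Subset n
      bag′ zero    = comprehension now?
      bag′ (suc i) = bag i
      here⁻ : ∀ {v} → v ∈ bag′ zero → Touched D v × Open C v
      here⁻ = comprehension⁻ now?
      initially′ : ∀ {v j k} → Touched C v → j Fin.≤ k → v ∈ bag′ k → v ∈ bag′ j
      initially′ {v} {zero} {zero} t _ v∈ = v∈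
      -- Lying in a later bag and having a neighbour, `v` is open in `D`, hence in `C`; being
      -- touched by `C`, it belongs to the new bag.
      initially′ {v} {zero} {suc k} t@(u , a , _) _ v∈ =
        comprehension⁺ now? (touched-mono {C} {D} C⊑D t , open-anti {C} {D} C⊑D (opens k v∈ a))
      initially′ {v} {suc j} {suc k} t (s≤s j≤k) v∈ = initially (touched-mono {C} {D} C⊑D t) j≤k v∈
      contiguous′ : ∀ v {i j k} → i Fin.≤ j → j Fin.≤ k → v ∈ bag′ i → v ∈ bag′ k → v ∈ bag′ j
      contiguous′ v {zero}  {zero}          _         _         vi _  = vi
      contiguous′ v {zero}  {suc j} {suc k} _         (s≤s j≤k) vi vk = initially (proj₁ (here⁻ vi)) j≤k vk
      contiguous′ v {suc i} {suc j} {suc k} (s≤s i≤j) (s≤s j≤k) vi vk = contiguous v i≤j j≤k vi vk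
      edges′ : ∀ {u v} → Adj u v → ¬ Covered C u v → ∃ λ i → u ∈ bag′ i × v ∈ bag′ i
      edges′ {u} {v} a ¬c with covered? D u v
      -- The edge itself witnesses at both ends that they are touched by `D` and open in `C`.
      ... | yes d = zero , comprehension⁺ now? ((v , a , d) , (v , a , ¬c)) ,
                    comprehension⁺ now? ((u , adj-sym a , sym-cov D d) , (u , adj-sym a , λ c → ¬c (sym-cov C c)))
      ... | no ¬d = let i , u∈ , v∈ = edges a ¬d in suc i , u∈ , v∈

  -- A sweep that starts with nothing covered puts every edge into a bag; the successor is the one
  -- that `width` subtracts.
  pw-≤-sweep : ∀ {s C} → (∀ {u v} → ¬ Covered C u v) → Sweep (suc s) C → pw G ≤ s
  pw-≤-sweep {s} {C} none σ = ℕ.≤-trans (proj₂ (pw-isMinimum G) _ (D , refl)) (ℕ.∸-monoˡ-≤ 1 (foldr-⊔-lub _ small))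
    where
    open Bags (bags (s≤s z≤n) σ)
    covering : ∀ v → ∃ λ i → v ∈ bag i
    covering v with Fin.any? (adj? v)
    ... | yes (u , a) = let i , v∈ , _ = edges a none in i , v∈
    ... | no ¬a       = isolated λ u a → ¬a (u , a)
    D : PathDecomposition G
    D = record { bagCount = count ; bag = bag ; vertices = covering
               ; edges = λ u v a → edges a none ; contiguous = contiguous }

-- Deletion from lists, functional images, and the edges inside a subset

remaining : ∀ {A : Set} {xs : List A} {x y} (p : x ∈ˡ xs) → y ∈ˡ xs → y ≡ x ⊎ y ∈ˡ (xs ─ p)
remaining (here refl) (here q)  = inj₁ q
remaining (here _)    (there q) = inj₂ q
remaining (there _)   (here q)  = inj₂ (here q)
remaining (there p)   (there q) = Sum.map₂ there (remaining p q)

restore : ∀ {A : Set} {xs : List A} {x y} (p : x ∈ˡ xs) → y ∈ˡ (xs ─ p) → y ∈ˡ xs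
restore (here _)  q         = there q
restore (there p) (here q)  = here q
restore (there p) (there q) = there (restore p q)

length-─ : ∀ {A : Set} {xs : List A} {x} (p : x ∈ˡ xs) → length xs ≡ suc (length (xs ─ p))
length-─ {xs = xs} p = List.length-removeAt′ xs (Any.index p)

module _ {A : Set} {R : Rel A 0ℓ} where
  AllPairs-─⁺ : ∀ {xs x} → AllPairs R xs → (p : x ∈ˡ xs) → AllPairs R (xs ─ p)
  AllPairs-─⁺ (_ ∷ rs) (here _)  = rs
  AllPairs-─⁺ (r ∷ rs) (there p) = All.─⁺ p r ∷ AllPairs-─⁺ rs p

  related-to-rest : Symmetric R → ∀ {xs x} → AllPairs R xs → (p : x ∈ˡ xs) → All (R x) (xs ─ p)
  related-to-rest sm (r ∷ _)  (here refl) = r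
  related-to-rest sm (r ∷ rs) (there p)   = sm (All.lookup r p) ∷ related-to-rest sm rs p

-- Each entry contributes at most one vertex. This turns the number of live cables into a bound on
-- the boundary.
list-image : ∀ {A : Set} {n} {R : A → Fin n → Set} → (∀ x w → Dec (R x w)) →
             ∀ xs → (∀ {x w w′} → x ∈ˡ xs → R x w → R x w′ → w ≡ w′) →
             ∃ λ L → length L ≤ length xs × (∀ {x w} → x ∈ˡ xs → R x w → w ∈ˡ L)
list-image R? [] fn = [] , z≤n , λ ()
list-image R? (x ∷ xs) fn with Fin.any? (R? x) | list-image R? xs (fn ∘ there)
... | yes (w , r) | L , le , all =
  w ∷ L , s≤s le , λ { (here refl) r′ → here (fn (here refl) r′ r) ; (there i) r′ → there (all i r′) }
... | no ¬r | L , le , all =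
  L , ℕ.m≤n⇒m≤1+n le , λ { (here refl) r′ → contradiction (_ , r′) ¬r ; (there i) r′ → all i r′ }

x∉p-x : ∀ {n} (p : Subset n) x → x ∉ p -ˢ x
x∉p-x (_ ∷ p) (suc x) (Vec.there x∈) = x∉p-x p x x∈

within⁺ : ∀ {n} (X : Subset n) {u v} → u ∈ X → v ∈ X → u ≢ v → within X ∋ u ~ v
within⁺ X {u} {v} u∈ v∈ u≢v =
  subst (v ∈_) (sym (trans (Vec.lookup∘tabulate _ u) (cong (if_then X -ˢ u else ⊥) (Vec.[]=⇒lookup u∈))))
        (x∈p∧x≢y⇒x∈p-y v∈ (u≢v ∘ sym))

within⁻ : ∀ {n} (X : Subset n) {u v} → within X ∋ u ~ v → u ∈ X × v ∈ X × u ≢ v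
within⁻ X {u} {v} i with lookup X u in eq | subst (v ∈_) (Vec.lookup∘tabulate _ u) i
... | true  | j = Vec.lookup⇒[]= u X eq , p─q⊆p X ⁅ u ⁆ j , λ { refl → x∉p-x X u j }
... | false | j = contradiction j ∉⊥

singleton-or-other : ∀ {n} {X : Subset n} {u} → u ∈ X → X ≡ ⁅ u ⁆ ⊎ (∃ λ v → v ∈ X × u ≢ v)
singleton-or-other {X = X} {u} u∈ with Fin.any? (λ v → v ∈? X ×-dec ¬? (u Fin.≟ v))
... | yes p = inj₂ p
... | no ¬p = inj₁ (⊆-antisym
  (λ {v} v∈ → subst (_∈ ⁅ u ⁆) (decidable-stable (u Fin.≟ v) λ u≢v → ¬p (v , v∈ , u≢v)) (x∈⁅x⁆ u))
  (λ v∈ → subst (_∈ X) (sym (x∈⁅y⁆⇒x≡y u v∈)) u∈))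

⁅⁆-injective : ∀ {n} {u v : Fin n} → ⁅ u ⁆ ≡ ⁅ v ⁆ → u ≡ v
⁅⁆-injective {u = u} {v} eq = x∈⁅y⁆⇒x≡y v (subst (u ∈_) eq (x∈⁅x⁆ u))

-- Configurations of plays on a forest

module _ {n} {G : Graph n} (forest : IsForest G) where
  open Graph G

  adj⇒≢ : ∀ {u v} → Adj u v → u ≢ v
  adj⇒≢ a refl = adj-irrefl a

  triangle-free : ∀ {a b c} → Adj a b → Adj b c → ¬ Adj c a
  triangle-free {a} {b} {c} ab bc ca = forest record
    { first = a ; last = c ; middle = b ∷ [] ; long = s≤s z≤n
    ; distinct = (adj⇒≢ ab ∷ (adj⇒≢ ca ∘ sym) ∷ []) ∷ (adj⇒≢ bc ∷ []) ∷ [] ∷ []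
    ; path = ab ∷ bc ∷ [-] ; closing = ca }

  square-free : ∀ {a b c d} → a ≢ c → b ≢ d → Adj a b → Adj b c → Adj c d → ¬ Adj d a
  square-free {a} {b} {c} {d} a≢c b≢d ab bc cd da = forest record
    { first = a ; last = d ; middle = b ∷ c ∷ [] ; long = s≤s z≤n
    ; distinct = (adj⇒≢ ab ∷ a≢c ∷ (adj⇒≢ da ∘ sym) ∷ []) ∷ (adj⇒≢ bc ∷ b≢d ∷ []) ∷ (adj⇒≢ cd ∷ []) ∷ [] ∷ []
    ; path = ab ∷ bc ∷ cd ∷ [-] ; closing = da }

module _ {n} (G : Graph n) where
  open Graph G

  Disjoint : Subset n → Subset n → Set
  Disjoint X Y = ∀ v → v ∈ X → ¬ v ∈ Y

  Disjoint-sym : Symmetric Disjoint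
  Disjoint-sym d v y x = d v x y

  -- Invariants of a play. A vertex leaves the live cables only by a closing, which demands that all
  -- its edges be placed; this is `housed`.
  record Consistent (c : Config n) : Set where
    field
      disjoint    : AllPairs Disjoint (live c)
      nonempty    : All Nonempty (live c)
      live⊆born   : All (_⊆ born c) (live c)
      placed-sym  : ∀ {u v} → placed c ∋ u ~ v → placed c ∋ v ~ u
      placed-adj  : ∀ {u v} → placed c ∋ u ~ v → Adj u v
      placed-born : ∀ {u v} → placed c ∋ u ~ v → u ∈ born c
      housed      : ∀ {v} → v ∈ born c → Any (v ∈_) (live c) ⊎ (∀ {u} → Adj v u → placed c ∋ v ~ u)

    same-cable : ∀ {X Y v} → X ∈ˡ live c → Y ∈ˡ live c → v ∈ X → v ∈ Y → X ≡ Y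
    same-cable X∈ Y∈ vX vY with remaining X∈ Y∈
    ... | inj₁ eq = sym eq
    ... | inj₂ Y∈′ = contradiction vY (All.lookup (related-to-rest Disjoint-sym disjoint X∈) Y∈′ _ vX)

  initial-consistent : Consistent initial
  initial-consistent = record
    { disjoint = [] ; nonempty = [] ; live⊆born = []
    ; placed-sym = λ i → contradiction i noEdges⁻ ; placed-adj = λ i → contradiction i noEdges⁻
    ; placed-born = λ i → contradiction i noEdges⁻ ; housed = λ i → contradiction i ∉⊥ }

  add-edges : ∀ {c} → Consistent c → ∀ E → Symmetric (E ∋_~_) →
              (∀ {u v} → E ∋ u ~ v → Adj u v × u ∈ born c) →
              Consistent (config (born c) (live c) (placed c ∪ᴱ E))
  add-edges {c} I E E-sym E-ok = record
    { disjoint = disjoint ; nonempty = nonempty ; live⊆born = live⊆born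
    ; placed-sym = λ i → ∪ᴱ⁺ (placed c) E (Sum.map placed-sym E-sym (∪ᴱ⁻ (placed c) E i))
    ; placed-adj = λ i → [ placed-adj , proj₁ ∘ E-ok ]′ (∪ᴱ⁻ (placed c) E i)
    ; placed-born = λ i → [ placed-born , proj₂ ∘ E-ok ]′ (∪ᴱ⁻ (placed c) E i)
    ; housed = λ b → Sum.map₂ (λ all a → ∪ᴱ⁺ (placed c) E (inj₁ (all a))) (housed b) }
    where open Consistent I

  between-sym : ∀ (X Y : Subset n) → Symmetric (between X Y ∋_~_)
  between-sym X Y i with between⁻ X Y i
  ... | inj₁ (a , b) = between⁺ X Y (inj₂ (b , a))
  ... | inj₂ (a , b) = between⁺ X Y (inj₁ (b , a))

  move-consistent : ∀ {c d} → Consistent c → Move G c d → Consistent d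
  move-consistent {c} I (birth S ne fresh) = record
    { disjoint = All.map (λ X⊆ v vS vX → fresh (_ , x∈p∩q⁺ (vS , X⊆ vX))) live⊆born ∷ disjoint
    ; nonempty = ne ∷ nonempty
    ; live⊆born = (λ i → x∈p∪q⁺ (inj₁ i)) ∷ All.map grow live⊆born
    ; placed-sym = placed-sym ; placed-adj = placed-adj
    ; placed-born = λ i → x∈p∪q⁺ (inj₂ (placed-born i))
    ; housed = λ b → [ (λ s → inj₁ (here s)) , (λ o → Sum.map₁ there (housed o)) ]′ (x∈p∪q⁻ S _ b) }
    where
    open Consistent I
    grow : ∀ {X} → X ⊆ born c → X ⊆ S ∪ born c
    grow X⊆ i = x∈p∪q⁺ (inj₂ (X⊆ i))
  move-consistent {c} I (fold {X} {Y} X∈ Y∈) = record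
    { disjoint = All.zipWith (λ (f , g) v i j → [ (λ x → f v x j) , (λ y → g v y j) ]′ (x∈p∪q⁻ X Y i))
                   (All.─⁺ Y∈ (related-to-rest Disjoint-sym disjoint X∈) ,
                    related-to-rest Disjoint-sym (AllPairs-─⁺ disjoint X∈) Y∈)
                 ∷ AllPairs-─⁺ (AllPairs-─⁺ disjoint X∈) Y∈
    ; nonempty = (let v , i = All.lookup nonempty X∈ in v , x∈p∪q⁺ (inj₁ i)) ∷ All.─⁺ Y∈ (All.─⁺ X∈ nonempty)
    ; live⊆born = (λ i → [ All.lookup live⊆born X∈ , All.lookup live⊆born (restore X∈ Y∈) ]′ (x∈p∪q⁻ X Y i))
                  ∷ All.─⁺ Y∈ (All.─⁺ X∈ live⊆born)
    ; placed-sym = placed-sym ; placed-adj = placed-adj ; placed-born = placed-born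
    ; housed = λ b → Sum.map₁ move (housed b) }
    where
    open Consistent I
    move : ∀ {v} → Any (v ∈_) (live c) → Any (v ∈_) (X ∪ Y ∷ (live c ─ X∈ ─ Y∈))
    move a with find a
    ... | Z , Z∈ , v∈ with remaining X∈ Z∈
    ... | inj₁ refl = here (x∈p∪q⁺ (inj₁ v∈))
    ... | inj₂ Z∈′ with remaining Y∈ Z∈′
    ... | inj₁ refl = here (x∈p∪q⁺ (inj₂ v∈))
    ... | inj₂ Z∈″ = there (lose Z∈″ v∈)
  move-consistent {c} I (block {X} {Y} X∈ Y∈ legal _) = add-edges I (between X Y) (between-sym X Y) ok
    where
    open Consistent I
    ok : ∀ {u v} → between X Y ∋ u ~ v → Adj u v × u ∈ born c
    ok i with between⁻ X Y i
    ... | inj₁ (a , b) = legal _ _ a b , All.lookup live⊆born X∈ a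
    ... | inj₂ (a , b) = adj-sym (legal _ _ b a) , All.lookup live⊆born (restore X∈ Y∈) a
  move-consistent {c} I (clique {X} X∈ legal _) = add-edges I (within X)
    (λ i → let a , b , u≢v = within⁻ X i in within⁺ X b a (u≢v ∘ sym))
    (λ i → let a , b , u≢v = within⁻ X i in legal _ _ a b u≢v , All.lookup live⊆born X∈ a)
    where open Consistent I
  move-consistent {c} I (close {X} X∈ legal) = record
    { disjoint = AllPairs-─⁺ disjoint X∈ ; nonempty = All.─⁺ X∈ nonempty ; live⊆born = All.─⁺ X∈ live⊆born
    ; placed-sym = placed-sym ; placed-adj = placed-adj ; placed-born = placed-born
    ; housed = λ b → [ move , inj₂ ]′ (housed b) }
    where
    open Consistent I
    move : ∀ {v} → Any (v ∈_) (live c) → Any (v ∈_) (live c ─ X∈) ⊎ (∀ {u} → Adj v u → placed c ∋ v ~ u)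
    move a with find a
    ... | Z , Z∈ , v∈ with remaining X∈ Z∈
    ... | inj₁ refl = inj₂ (legal _ _ v∈)
    ... | inj₂ Z∈′ = inj₁ (lose Z∈′ v∈)

  Completes : Config n → Set
  Completes c = ∃ λ d → Constructed G d × Play G c d

  Pending : Config n → Fin n → Fin n → Set
  Pending c v z = Adj v z × ¬ placed c ∋ v ~ z

  Clique : Subset n → Set
  Clique X = ∀ u v → u ∈ X → v ∈ X → u ≢ v → Adj u v

  -- A pending edge is placed while its end x lies in a cable containing X.
  pending-end : ∀ {c} → Consistent c → Completes c → ∀ {X x z} → X ∈ˡ live c → x ∈ X → Pending c x z →
                (∀ {v} → v ∈ X → Adj v z) ⊎ (z ∈ X × Clique X)
  pending-end I (_ , con , ε) X∈ x∈ p with () ← subst (_ ∈ˡ_) (Constructed.allClosed con) X∈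
  pending-end {c} I (d , con , m ◅ π) {X} {x} {z} X∈ x∈ (a , ¬p) = go m (pending-end (move-consistent I m) (d , con , π))
    where
    open Consistent I
    Fate : Subset n → Set
    Fate X = (∀ {v} → v ∈ X → Adj v z) ⊎ (z ∈ X × Clique X)
    shrink : ∀ {W} → X ⊆ W → (∀ {v} → v ∈ W → Adj v z) ⊎ (z ∈ W × Clique W) → Fate X
    shrink X⊆ (inj₁ star) = inj₁ (star ∘ X⊆)
    shrink X⊆ (inj₂ (zW , cl)) with z ∈? X
    ... | yes zX = inj₂ (zX , λ u v a b → cl u v (X⊆ a) (X⊆ b))
    ... | no z∉X = inj₁ λ v∈ → cl _ z (X⊆ v∈) zW λ { refl → z∉X v∈ }
    go : ∀ {c′} → Move G c c′ → (∀ {X x z} → X ∈ˡ live c′ → x ∈ X → Pending c′ x z →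
           (∀ {v} → v ∈ X → Adj v z) ⊎ (z ∈ X × Clique X)) → Fate X
    go (birth _ _ _) ih = ih (there X∈) x∈ (a , ¬p)
    go (fold {Y} {Z} Y∈ Z∈) ih with remaining Y∈ X∈
    ... | inj₁ refl = shrink X⊆ (ih (here refl) (X⊆ x∈) (a , ¬p))
      where
      X⊆ : Y ⊆ Y ∪ Z
      X⊆ i = x∈p∪q⁺ (inj₁ i)
    ... | inj₂ X∈′ with remaining Z∈ X∈′
    ... | inj₁ refl = shrink X⊆ (ih (here refl) (X⊆ x∈) (a , ¬p))
      where
      X⊆ : Z ⊆ Y ∪ Z
      X⊆ i = x∈p∪q⁺ (inj₂ i)
    ... | inj₂ X∈″ = ih (there X∈″) x∈ (a , ¬p)
    go (block {Y} {Z} Y∈ Z∈ legal _) ih with between Y Z ∋ x ~? z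
    ... | no ¬b = ih X∈ x∈ (a , λ i → [ ¬p , ¬b ]′ (∪ᴱ⁻ (placed c) _ i))
    ... | yes b with between⁻ Y Z b
    ...   | inj₁ (xY , zZ) with refl ← same-cable X∈ Y∈ x∈ xY = inj₁ λ v∈ → legal _ _ v∈ zZ
    ...   | inj₂ (xZ , zY) with refl ← same-cable X∈ (restore Y∈ Z∈) x∈ xZ = inj₁ λ v∈ → adj-sym (legal _ _ zY v∈)
    go (clique {Y} Y∈ legal _) ih with within Y ∋ x ~? z
    ... | no ¬b = ih X∈ x∈ (a , λ i → [ ¬p , ¬b ]′ (∪ᴱ⁻ (placed c) _ i))
    ... | yes b with within⁻ Y b
    ...   | xY , zY , _ with refl ← same-cable X∈ Y∈ x∈ xY = inj₂ (zY , legal)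
    go (close {Y} Y∈ legal) ih with remaining Y∈ X∈
    ... | inj₁ refl = contradiction (legal _ _ x∈ a) ¬p
    ... | inj₂ X∈′  = ih X∈′ x∈ (a , ¬p)

module _ {n} {G : Graph n} (forest : IsForest G) {c : Config n} (I : Consistent G c) (fin : Completes G c) where
  open Graph G
  open Consistent I

  -- By `pending-end` each far end is adjacent to all of `X`, or lies in `X` and `X` is a clique.
  -- Two distinct far ends of the first kind form a square with `a` and `b`; one of each kind gives
  -- a triangle on `a`, `b` and the outer far end; two of the second kind give a triangle in `X`,
  -- unless both pending edges are the same edge read from its two ends, which is the second
  -- alternative.
  pending-unique : ∀ {X a b v v′ z z′} → X ∈ˡ live c → a ∈ X → b ∈ X → a ≢ b → v ∈ X → v′ ∈ X →
                   Pending G c v z → Pending G c v′ z′ → z ≡ z′ ⊎ (z ≡ v′ × z′ ≡ v)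
  pending-unique {a = a} {b} {v} {v′} {z} {z′} X∈ a∈ b∈ a≢b v∈ v′∈ p p′
    with z Fin.≟ z′
  ... | yes eq = inj₁ eq
  ... | no z≢z′ with pending-end G I fin X∈ v∈ p | pending-end G I fin X∈ v′∈ p′
  ... | inj₁ s | inj₁ s′ =
    contradiction (adj-sym (s′ a∈)) (square-free forest a≢b z≢z′ (s a∈) (adj-sym (s b∈)) (s′ b∈))
  ... | inj₁ s | inj₂ (_ , q) =
    contradiction (adj-sym (s a∈)) (triangle-free forest (q _ _ a∈ b∈ a≢b) (s b∈))
  ... | inj₂ (_ , q) | inj₁ s =
    contradiction (adj-sym (s a∈)) (triangle-free forest (q _ _ a∈ b∈ a≢b) (s b∈))
  ... | inj₂ (z∈ , q) | inj₂ (z′∈ , _) with z Fin.≟ v′ | z′ Fin.≟ v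
  ... | yes eq | yes eq′ = inj₂ (eq , eq′)
  ... | no z≢v′ | _ =
    contradiction (q _ _ z∈ v′∈ z≢v′) (triangle-free forest (proj₁ p′) (q _ _ z′∈ z∈ (z≢z′ ∘ sym)))
  ... | yes _ | no z′≢v =
    contradiction (q _ _ z′∈ v∈ z′≢v) (triangle-free forest (proj₁ p) (q _ _ z∈ z′∈ z≢z′))

-- Settled vertices and the cables that represent the boundary

module _ {n} (G : Graph n) (c : Config n) where
  open Graph G

  Used Settled : Fin n → Set
  Used u    = ∃ λ v → placed c ∋ u ~ v
  Settled u = Used u × ¬ ⁅ u ⁆ ∈ˡ live c

  used? : ∀ u → Dec (Used u)
  used? u = Fin.any? λ v → placed c ∋ u ~? v

  settled? : ∀ u → Dec (Settled u)
  settled? u = used? u ×-dec ¬? (Any.any? (⁅ u ⁆ ≟ˢ_) (live c))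

  settledCover : (∀ {u v} → placed c ∋ u ~ v → placed c ∋ v ~ u) → Cover G
  settledCover sy = record
    { Covered  = λ u v → placed c ∋ u ~ v ⊎ Settled u ⊎ Settled v
    ; covered? = λ u v → (placed c ∋ u ~? v) ⊎-dec settled? u ⊎-dec settled? v
    ; sym-cov  = λ { (inj₁ p) → inj₁ (sy p) ; (inj₂ (inj₁ s)) → inj₂ (inj₂ s) ; (inj₂ (inj₂ s)) → inj₂ (inj₁ s) } }

  Represents : Subset n → Fin n → Set
  Represents X w = X ≡ ⁅ w ⁆ ⊎ (¬ Used w × ∃ λ v → v ∈ X × Settled v × Adj v w)

  represents? : ∀ X w → Dec (Represents X w)
  represents? X w = (X ≟ˢ ⁅ w ⁆) ⊎-dec ¬? (used? w) ×-dec Fin.any? λ v → v ∈? X ×-dec settled? v ×-dec adj? v w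

coverOf : ∀ {n} (G : Graph n) {c} → Consistent G c → Cover G
coverOf G {c} I = settledCover G c (Consistent.placed-sym I)

Boundary : ∀ {n} (G : Graph n) {c} → Consistent G c → Fin n → Set
Boundary G I w = Cover.Touched (coverOf G I) w × Cover.Open (coverOf G I) w

module _ {n} {G : Graph n} (forest : IsForest G) {c : Config n} (I : Consistent G c) (fin : Completes G c) where
  open Graph G
  open Consistent I

  settled-other : ∀ {X v} → X ∈ˡ live c → v ∈ X → Settled G c v → ∃ λ u → u ∈ X × v ≢ u
  settled-other X∈ v∈ (_ , ¬single) with singleton-or-other v∈
  ... | inj₁ refl  = contradiction X∈ ¬single
  ... | inj₂ other = other

  unused-pending : ∀ {v w} → ¬ Used G c w → Adj v w → Pending G c v w
  unused-pending ¬u a = a , λ p → ¬u (_ , placed-sym p)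

  represents-functional : ∀ {X w w′} → X ∈ˡ live c → Represents G c X w → Represents G c X w′ → w ≡ w′
  represents-functional X∈ (inj₁ refl) (inj₁ eq) = ⁅⁆-injective eq
  represents-functional {w = w} X∈ (inj₁ refl) (inj₂ (_ , v , v∈ , (_ , ¬single) , _))
    with refl ← x∈⁅y⁆⇒x≡y w v∈ = contradiction X∈ ¬single
  represents-functional {w′ = w} X∈ (inj₂ (_ , v , v∈ , (_ , ¬single) , _)) (inj₁ refl)
    with refl ← x∈⁅y⁆⇒x≡y w v∈ = contradiction X∈ ¬single
  represents-functional X∈ (inj₂ (¬u , v , v∈ , s , a)) (inj₂ (¬u′ , v′ , v′∈ , s′ , a′))
    with b , b∈ , v≢b ← settled-other X∈ v∈ s
    with pending-unique forest I fin X∈ v∈ b∈ v≢b v∈ v′∈ (unused-pending ¬u a) (unused-pending ¬u′ a′)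
  ... | inj₁ eq         = eq
  ... | inj₂ (refl , _) = contradiction (proj₁ s′) ¬u

  settled-housed : ∀ {v z} → Settled G c v → Pending G c v z → ∃ λ X → X ∈ˡ live c × v ∈ X
  settled-housed ((_ , p) , _) (a , ¬p) with housed (placed-born p)
  ... | inj₁ h   = find h
  ... | inj₂ all = contradiction (all a) ¬p

  boundary-represented : ∀ {w} → Boundary G I w → ∃ λ X → X ∈ˡ live c × Represents G c X w
  boundary-represented {w} ((v , a , cov) , (v′ , a′ , ¬cov)) with Any.any? (⁅ w ⁆ ≟ˢ_) (live c)
  ... | yes w∈ = _ , w∈ , inj₁ refl
  ... | no w∉ with cov
  ...   | inj₁ p          = contradiction (inj₂ (inj₁ ((_ , p) , w∉))) ¬cov
  ...   | inj₂ (inj₁ s)   = contradiction (inj₂ (inj₁ s)) ¬cov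
  ...   | inj₂ (inj₂ s)   =
    let ¬u = λ u → ¬cov (inj₂ (inj₁ (u , w∉)))
        X , X∈ , v∈ = settled-housed s (unused-pending ¬u (adj-sym a))
    in X , X∈ , inj₂ (¬u , v , v∈ , s , adj-sym a)

  -- Singleton cables are listed even off the boundary: the sweep of a block needs room for the
  -- centre of its star throughout.
  representatives : ∃ λ L → length L ≤ length (live c) × (∀ {w} → Boundary G I w → w ∈ˡ L) ×
                            (∀ {w} → ⁅ w ⁆ ∈ˡ live c → w ∈ˡ L)
  representatives =
    let L , le , all = list-image (represents? G c) (live c) represents-functional
    in L , le , (λ b → let _ , X∈ , r = boundary-represented b in all X∈ r) , λ w∈ → all w∈ (inj₁ refl)

-- Plays sweep the forest

module _ {n} {G : Graph n} (forest : IsForest G) where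
  open Graph G
  open Cover

  BoundedBoundary : ∀ {c} → Consistent G c → ℕ → Set
  BoundedBoundary I h = ∃ λ L → length L ≤ h × (∀ {w} → Boundary G I w → w ∈ˡ L)

  module _ {c : Config n} {d} (I : Consistent G c) (J : Consistent G d) where
    private
      C D : Cover G
      C = coverOf G I
      D = coverOf G J

    -- Neither births nor closings change which edges are covered.
    quiet : ∀ {h} → (∀ {u v} → Adj u v → Covered C u v → Covered D u v) →
            (∀ {u v} → Adj u v → Covered D u v → Covered C u v) →
            BoundedBoundary I h →
            (BoundedBoundary J h → Sweep G (suc h) D) → Sweep G (suc h) C
    quiet C⊑D D⊑C (L , le , bd) next =
      extend D C⊑D L (ℕ.m≤n⇒m≤1+n le) (λ t o → bd (touched-mono G {D} {C} D⊑C t , o))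
        (next (L , le , λ (t , o) → bd (touched-mono G {D} {C} D⊑C t , open-anti G {C} {D} C⊑D o)))

  module Birth {c S} (I : Consistent G c) (m : Nonempty S) (fresh : Empty (S ∩ born c)) where
    open Consistent I
    private
      J : Consistent G _
      J = move-consistent G I (birth S m fresh)

    -- Used vertices are born, so a fresh cable cannot be the singleton of one.
    birth-settled⁺ : ∀ {u} → Settled G c u → Settled G (config (S ∪ born c) (S ∷ live c) (placed c)) u
    birth-settled⁺ ((v , p) , ¬l) = (v , p) , λ
      { (here refl) → fresh (_ , x∈p∩q⁺ (x∈⁅x⁆ _ , placed-born p)) ; (there i) → ¬l i }

    birth-settled⁻ : ∀ {u} → Settled G (config (S ∪ born c) (S ∷ live c) (placed c)) u → Settled G c u
    birth-settled⁻ (u , ¬l) = u , ¬l ∘ there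

    birth-sweep : ∀ {h} → BoundedBoundary I h → (BoundedBoundary J h → Sweep G (suc h) (coverOf G J)) →
                  Sweep G (suc h) (coverOf G I)
    birth-sweep = quiet I J (λ _ → Sum.map₂ (Sum.map birth-settled⁺ birth-settled⁺))
                            (λ _ → Sum.map₂ (Sum.map birth-settled⁻ birth-settled⁻))

  module Close {c X} (I : Consistent G c) (X∈ : X ∈ˡ live c)
               (legal : ∀ u v → u ∈ X → Adj u v → placed c ∋ u ~ v) where
    open Consistent I
    private
      J : Consistent G _
      J = move-consistent G I (close X∈ legal)

      c′ : Config n
      c′ = config (born c) (live c ─ X∈) (placed c)

    close-settled⁺ : ∀ {u} → Settled G c u → Settled G c′ u
    close-settled⁺ (u , ¬l) = u , λ i → ¬l (restore X∈ i)

    -- Closing a singleton cable can settle its vertex, but it is legal only when all edges there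
    -- are placed, so no edge becomes covered by it.
    close-settled⁻ : ∀ {u v} → Adj u v → Settled G c′ u → placed c ∋ u ~ v ⊎ Settled G c u
    close-settled⁻ {u} a (us , ¬l) with Any.any? (⁅ u ⁆ ≟ˢ_) (live c)
    ... | no ¬l′ = inj₂ (us , ¬l′)
    ... | yes l with remaining X∈ l
    ...   | inj₁ refl = inj₁ (legal _ _ (x∈⁅x⁆ u) a)
    ...   | inj₂ l′   = contradiction l′ ¬l

    close-sweep : ∀ {h} → BoundedBoundary I h → (BoundedBoundary J h → Sweep G (suc h) (coverOf G J)) →
                  Sweep G (suc h) (coverOf G I)
    close-sweep = quiet I J (λ _ → Sum.map₂ (Sum.map close-settled⁺ close-settled⁺)) back
      where
      back : ∀ {u v} → Adj u v → Covered (coverOf G J) u v → Covered (coverOf G I) u v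
      back a (inj₁ p) = inj₁ p
      back a (inj₂ (inj₁ s)) = [ inj₁ , inj₂ ∘ inj₁ ]′ (close-settled⁻ a s)
      back a (inj₂ (inj₂ s)) = [ inj₁ ∘ placed-sym , inj₂ ∘ inj₂ ]′ (close-settled⁻ (adj-sym a) s)

  module Fold {c X Y} (I : Consistent G c) (X∈ : X ∈ˡ live c) (Y∈ : Y ∈ˡ (live c ─ X∈)) where
    open Consistent I
    private
      c′ : Config n
      c′ = config (born c) (X ∪ Y ∷ (live c ─ X∈ ─ Y∈)) (placed c)

      J : Consistent G c′
      J = move-consistent G I (fold X∈ Y∈)

      C D : Cover G
      C = coverOf G I
      D = coverOf G J

    -- The union of two disjoint nonempty cables is never a singleton.
    fold-settled : ∀ {u} → Settled G c u → Settled G c′ u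
    fold-settled {u} (us , ¬l) = us , λ { (here eq) → apart eq ; (there i) → ¬l (restore X∈ (restore Y∈ i)) }
      where
      apart : ⁅ u ⁆ ≢ X ∪ Y
      apart eq =
        let x , xX = All.lookup nonempty X∈
            y , yY = All.lookup (All.─⁺ X∈ nonempty) Y∈
            at = λ {v} v∈ → x∈⁅y⁆⇒x≡y {x = v} u (subst (v ∈_) (sym eq) v∈)
        in All.lookup (related-to-rest (Disjoint-sym G) disjoint X∈) Y∈ u
             (subst (_∈ X) (at (x∈p∪q⁺ (inj₁ xX))) xX) (subst (_∈ Y) (at (x∈p∪q⁺ (inj₂ yY))) yY)

    newly-settled : ∀ {v} → Settled G c′ v → ¬ Settled G c v → v ∈ X ∪ Y
    newly-settled {v} (us , ¬l′) ¬s with Any.any? (⁅ v ⁆ ≟ˢ_) (live c)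
    ... | no ¬l = contradiction (us , ¬l) ¬s
    ... | yes l with remaining X∈ l
    ...   | inj₁ refl = x∈p∪q⁺ (inj₁ (x∈⁅x⁆ v))
    ...   | inj₂ l′ with remaining Y∈ l′
    ...     | inj₁ refl = x∈p∪q⁺ (inj₂ (x∈⁅x⁆ v))
    ...     | inj₂ l″   = contradiction (there l″) ¬l′

    C⊑D : ∀ {u v} → Adj u v → Covered C u v → Covered D u v
    C⊑D _ = Sum.map₂ (Sum.map fold-settled fold-settled)

    newly-reached : ∀ {w} → Touched D w → ¬ Touched C w →
                    ¬ Used G c w × ∃ λ v → v ∈ X ∪ Y × Settled G c′ v × ¬ Settled G c v × Adj v w
    newly-reached {w} (v , a , cov) ¬t = ¬u , via cov
      where
      ¬u : ¬ Used G c w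
      ¬u (_ , p) = ¬t (_ , placed-adj p , inj₁ p)
      via : Covered D w v → _
      via (inj₁ p) = contradiction (_ , p) ¬u
      via (inj₂ (inj₁ (u , _))) = contradiction u ¬u
      via (inj₂ (inj₂ s)) =
        let ¬s = λ s → ¬t (v , a , inj₂ (inj₂ s))
        in v , newly-settled s ¬s , s , ¬s , adj-sym a

    -- All newly touched vertices are represented by the merged cable, so there is at most one, `y`.
    -- Its newly settled neighbour `v` was on the boundary before and leaves it, so `y` takes over
    -- the place of `v`; only the bag in between has to hold both.
    fold-sweep : ∀ {h} → Completes G c′ → BoundedBoundary I h →
                 (BoundedBoundary J h → Sweep G (suc h) D) → Sweep G (suc h) C
    fold-sweep {h} fin (L , le , bd) next with Fin.any? (λ w → touched? D w ×-dec open? C w ×-dec ¬? (touched? C w))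
    ... | no ¬new = extend D C⊑D L (ℕ.m≤n⇒m≤1+n le) sub
                      (next (L , le , λ (t , o) → sub t (open-anti G {C} {D} C⊑D o)))
      where
      sub : ∀ {w} → Touched D w → Open C w → w ∈ˡ L
      sub {w} t o with touched? C w
      ... | yes t′ = bd (t′ , o)
      ... | no ¬t′ = contradiction (w , t , o , ¬t′) ¬new
    ... | yes (y , t , o , ¬t) with newly-reached t ¬t
    ... | ¬uy , v , v∈ , s@((z , p) , _) , ¬s , a =
      extend D C⊑D (y ∷ L) (s≤s le) sub
        (next (y ∷ (L ─ v∈L) , subst (_≤ h) (length-─ v∈L) le , bd′))
      where
      sub : ∀ {w} → Touched D w → Open C w → w ∈ˡ y ∷ L
      sub {w} t′ o′ with touched? C w
      ... | yes t″ = there (bd (t″ , o′))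
      ... | no ¬t″ =
        let ¬u′ , v′ , v′∈ , s′ , _ , a′ = newly-reached t′ ¬t″
        in here (represents-functional forest J fin (here refl)
                   (inj₂ (¬u′ , v′ , v′∈ , s′ , a′)) (inj₂ (¬uy , v , v∈ , s , a)))
      v∈L : v ∈ˡ L
      v∈L = bd ((z , placed-adj p , inj₁ p) , y , a , λ
        { (inj₁ q) → ¬uy (_ , placed-sym q) ; (inj₂ (inj₁ s′)) → ¬s s′ ; (inj₂ (inj₂ (u , _))) → ¬uy u })
      bd′ : ∀ {w} → Boundary G J w → w ∈ˡ y ∷ (L ─ v∈L)
      bd′ (t′ , o′@(_ , _ , ¬cov)) with sub t′ (open-anti G {C} {D} C⊑D o′)
      ... | here eq = here eq
      ... | there i with remaining v∈L i
      -- After the fold `v` is settled, so no edge at it is uncovered.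
      ...   | inj₁ refl = contradiction (inj₂ (inj₁ s)) ¬cov
      ...   | inj₂ i′   = there i′

  add-settled : ∀ c E → (∀ {u v} → placed c ∋ u ~ v → E ∋ u ~ v) →
                ∀ {u} → Settled G c u → Settled G (config (born c) (live c) E) u
  add-settled c E mono ((v , p) , ¬l) = (v , mono p) , ¬l

  module Block {c x Y E} (I : Consistent G c) (J : Consistent G (config (born c) (live c) E))
               (fin : Completes G c) (fin′ : Completes G (config (born c) (live c) E))
               (x∈ : ⁅ x ⁆ ∈ˡ live c) (Y∈ : Y ∈ˡ live c) (star : ∀ {v} → v ∈ Y → Adj x v)
               (old : ∀ {u v} → placed c ∋ u ~ v → E ∋ u ~ v)
               (new : ∀ {v} → v ∈ Y → E ∋ x ~ v)
               (E⁻ : ∀ {u v} → E ∋ u ~ v → placed c ∋ u ~ v ⊎ (u ≡ x × v ∈ Y) ⊎ (v ≡ x × u ∈ Y)) where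
    open Consistent I
    private
      c′ : Config n
      c′ = config (born c) (live c) E

      C D : Cover G
      C = coverOf G I
      D = coverOf G J

      -- The star is covered one edge at a time, so that a bag needs only one leaf beyond the
      -- representatives; `ps` lists the vertices already processed.
      partial : List (Fin n) → Cover G
      partial ps = record
        { Covered = λ u v → Covered C u v ⊎ (u ≡ x × v ∈ Y × v ∈ˡ ps) ⊎ (v ≡ x × u ∈ Y × u ∈ˡ ps)
        ; covered? = λ u v → covered? C u v ⊎-dec
            (u Fin.≟ x ×-dec v ∈? Y ×-dec Any.any? (v Fin.≟_) ps) ⊎-dec
            (v Fin.≟ x ×-dec u ∈? Y ×-dec Any.any? (u Fin.≟_) ps)
        ; sym-cov = λ { (inj₁ s) → inj₁ (sym-cov C s) ; (inj₂ s) → inj₂ (Sum.swap s) } }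

    C⊑D : ∀ {u v} → Covered C u v → Covered D u v
    C⊑D = Sum.map old (Sum.map (add-settled c E old) (add-settled c E old))

    partial⊑D : ∀ {ps u v} → Covered (partial ps) u v → Covered D u v
    partial⊑D (inj₁ s)                          = C⊑D s
    partial⊑D (inj₂ (inj₁ (refl , v∈ , _))) = inj₁ (new v∈)
    partial⊑D (inj₂ (inj₂ (refl , u∈ , _))) = inj₁ (Consistent.placed-sym J (new u∈))

    x-unsettled : ¬ Settled G c x
    x-unsettled (_ , ¬l) = ¬l x∈

    only-x : ∀ {u z} → u ∈ Y → ¬ ⁅ u ⁆ ∈ˡ live c → ¬ Used G c u → Adj u z → z ≡ x
    only-x {u} {z} u∈ ¬l ¬u a with singleton-or-other u∈
    ... | inj₁ refl = contradiction Y∈ ¬l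
    ... | inj₂ (b , b∈ , u≢b)
      with pending-unique forest I fin Y∈ u∈ b∈ u≢b u∈ u∈ (a , λ p → ¬u (_ , p)) (adj-sym (star u∈) , λ p → ¬u (_ , p))
    ...   | inj₁ eq = eq
    ...   | inj₂ (_ , refl) = contradiction (star u∈) adj-irrefl

    Within : Fin n → Fin n → Set
    Within u v = (u ≡ x × v ∈ Y) ⊎ (v ≡ x × u ∈ Y)

    settled′ : ∀ {u v} → Adj u v → Settled G c′ u → Covered C u v ⊎ Within u v
    settled′ {u} a ((w , p′) , ¬l) with used? G c u
    ... | yes us = inj₁ (inj₂ (inj₁ (us , ¬l)))
    ... | no ¬us with E⁻ p′
    ...   | inj₁ p = contradiction (w , p) ¬us
    ...   | inj₂ (inj₁ (refl , _)) = contradiction x∈ ¬l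
    ...   | inj₂ (inj₂ (refl , u∈)) = inj₂ (inj₂ (only-x u∈ ¬l ¬us a , u∈))

    D⁻ : ∀ {u v} → Adj u v → Covered D u v → Covered C u v ⊎ Within u v
    D⁻ a (inj₁ p) = Sum.map₁ inj₁ (E⁻ p)
    D⁻ a (inj₂ (inj₁ s)) = settled′ a s
    D⁻ a (inj₂ (inj₂ s)) = Sum.map (sym-cov C) Sum.swap (settled′ (adj-sym a) s)

    -- One list `R` of representatives, taken after the block, serves in every bag. A vertex outside
    -- `R` that the bags need has its only edge at `x`, so it is needed just when that edge is
    -- covered.
    block-sweep : ∀ {h} → length (live c) ≤ h →
                  (BoundedBoundary J h → Sweep G (suc h) D) → Sweep G (suc h) C
    block-sweep {h} ℓ≤h next =
      -- With no vertex processed, `partial []` covers the same edges as `C`; this extension only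
      -- switches to the family of partial covers.
      extend (partial []) (λ _ → inj₁) R (ℕ.m≤n⇒m≤1+n R≤h) start (go (List.allFin n) [] (λ v → inj₁ (∈-allFin v)))
      where
      reps = representatives forest J fin′
      R = proj₁ reps
      R≤h : length R ≤ h
      R≤h = ℕ.≤-trans (proj₁ (proj₂ reps)) ℓ≤h
      bd : ∀ {w} → Boundary G J w → w ∈ˡ R
      bd = proj₁ (proj₂ (proj₂ reps))
      single : ∀ {w} → ⁅ w ⁆ ∈ˡ live c → w ∈ˡ R
      single = proj₂ (proj₂ (proj₂ reps))
      missed : ∀ ps {w v} → Adj w v → ¬ Covered (partial ps) w v → Touched D w →
               w ∈ˡ R ⊎ (v ≡ x × w ∈ Y × ¬ Used G c w × ¬ ⁅ w ⁆ ∈ˡ live c)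
      missed ps {w} {v} a ¬cov t with covered? D w v
      ... | no ¬d = inj₁ (bd (t , v , a , ¬d))
      ... | yes d with D⁻ a d
      ...   | inj₁ cov = contradiction (inj₁ cov) ¬cov
      ...   | inj₂ (inj₁ (refl , _)) = inj₁ (single x∈)
      ...   | inj₂ (inj₂ (refl , w∈)) with Any.any? (⁅ w ⁆ ≟ˢ_) (live c)
      ...     | yes l = inj₁ (single l)
      ...     | no ¬l = inj₂ (refl , w∈ , (λ u → ¬cov (inj₁ (inj₂ (inj₁ (u , ¬l))))) , ¬l)
      untouched : ∀ {w v} → w ∈ Y → ¬ Used G c w → ¬ ⁅ w ⁆ ∈ˡ live c → Adj w v → ¬ Covered C w v
      untouched w∈ ¬u ¬l a (inj₁ p) = ¬u (_ , p)
      untouched w∈ ¬u ¬l a (inj₂ (inj₁ (u , _))) = ¬u u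
      untouched w∈ ¬u ¬l a (inj₂ (inj₂ s)) with refl ← only-x w∈ ¬l ¬u a = x-unsettled s
      start : ∀ {w} → Touched (partial []) w → Open C w → w ∈ˡ R
      start {w} t@(v , a , cov) (v′ , a′ , ¬cov)
        with missed [] a′ (λ { (inj₁ s) → ¬cov s ; (inj₂ (inj₁ (_ , _ , ()))) ; (inj₂ (inj₂ (_ , _ , ()))) })
                    (v , a , partial⊑D cov) | cov
      ... | inj₁ i | _ = i
      ... | inj₂ (_ , w∈ , ¬u , ¬l) | inj₁ cov′ = contradiction cov′ (untouched w∈ ¬u ¬l a)
      ... | inj₂ _ | inj₂ (inj₁ (_ , _ , ()))
      ... | inj₂ _ | inj₂ (inj₂ (_ , _ , ()))
      go : ∀ rs ps → (∀ v → v ∈ˡ rs ⊎ v ∈ˡ ps) → Sweep G (suc h) (partial ps)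
      go [] ps all = extend D (λ _ → partial⊑D) R (ℕ.m≤n⇒m≤1+n R≤h)
        (λ t (v , a , ¬cov) → bd (t , v , a , λ d → ¬cov (Sum.map₂ (Sum.map full full) (D⁻ a d))))
        (next (R , R≤h , bd))
        where
        full : ∀ {u v} → u ≡ x × v ∈ Y → u ≡ x × v ∈ Y × v ∈ˡ ps
        full (eq , v∈) = eq , v∈ , [ (λ ()) , id ]′ (all _)
      go (b ∷ rs) ps all = extend (partial (b ∷ ps))
        (λ _ → Sum.map₂ (Sum.map (λ (p , q , i) → p , q , there i) (λ (p , q , i) → p , q , there i)))
        (b ∷ R) (s≤s R≤h) sub
        (go rs (b ∷ ps) λ v → [ (λ { (here eq) → inj₂ (here eq) ; (there i) → inj₁ i }) , inj₂ ∘ there ]′ (all v))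
        where
        sub : ∀ {w} → Touched (partial (b ∷ ps)) w → Open (partial ps) w → w ∈ˡ b ∷ R
        sub {w} (v , a , cov) (v′ , a′ , ¬cov) with missed ps a′ ¬cov (v , a , partial⊑D cov) | cov
        ... | inj₁ i | _ = there i
        ... | inj₂ (_ , w∈ , ¬u , ¬l) | inj₁ cov′ = contradiction cov′ (untouched w∈ ¬u ¬l a)
        ... | inj₂ _ | inj₂ (inj₁ (refl , _)) = there (single x∈)
        ... | inj₂ _ | inj₂ (inj₂ (refl , _ , here eq)) = here eq
        -- A leaf processed earlier has its edge to `x` covered already.
        ... | inj₂ (refl , w∈ , _) | inj₂ (inj₂ (_ , _ , there i)) = contradiction (inj₂ (inj₂ (refl , w∈ , i))) ¬cov

  module CliqueMove {c X E} (I : Consistent G c) (J : Consistent G (config (born c) (live c) E))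
               (fin : Completes G c) (fin′ : Completes G (config (born c) (live c) E))
               (X∈ : X ∈ˡ live c) (legal : Clique G X)
               {a b} (a∈ : a ∈ X) (b∈ : b ∈ X) (a≢b : a ≢ b) (unplaced : ¬ placed c ∋ a ~ b)
               (old : ∀ {u v} → placed c ∋ u ~ v → E ∋ u ~ v)
               (new : ∀ {u v} → u ∈ X → v ∈ X → u ≢ v → E ∋ u ~ v)
               (E⁻ : ∀ {u v} → E ∋ u ~ v → placed c ∋ u ~ v ⊎ (u ∈ X × v ∈ X)) where
    open Consistent I
    private
      c′ : Config n
      c′ = config (born c) (live c) E

      C D : Cover G
      C = coverOf G I
      D = coverOf G J

    C⊑D : ∀ {u v} → Covered C u v → Covered D u v
    C⊑D = Sum.map old (Sum.map (add-settled c E old) (add-settled c E old))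

    two : ∀ {v} → v ∈ X → v ≡ a ⊎ v ≡ b
    two {v} v∈ with v Fin.≟ a | v Fin.≟ b
    ... | yes eq | _      = inj₁ eq
    ... | _      | yes eq = inj₂ eq
    ... | no v≢a | no v≢b = contradiction (legal _ _ b∈ v∈ (v≢b ∘ sym))
                              (triangle-free forest (legal _ _ v∈ a∈ v≢a) (legal _ _ a∈ b∈ a≢b))

    -- The edge `ab` is itself pending, so `pending-unique` can compare every other pending edge at
    -- `X` with it.
    only-inside : ∀ {v w} → v ∈ X → Pending G c v w → w ∈ X
    only-inside v∈ p
      with pending-unique forest I fin X∈ a∈ b∈ a≢b v∈ a∈ p (legal _ _ a∈ b∈ a≢b , unplaced)
    ... | inj₁ refl       = b∈
    ... | inj₂ (refl , _) = a∈

    used′ : ∀ {w} → w ∈ X → Used G c′ w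
    used′ w∈ with two w∈
    ... | inj₁ refl = b , new a∈ b∈ a≢b
    ... | inj₂ refl = a , new b∈ a∈ (a≢b ∘ sym)

    newly-used : ∀ {v} → Settled G c′ v → ¬ Settled G c v → v ∈ X × ¬ Used G c v
    newly-used {v} ((w , p′) , ¬l) ¬s with used? G c v
    ... | yes u = contradiction (u , ¬l) ¬s
    ... | no ¬u with E⁻ p′
    ...   | inj₁ p = contradiction (w , p) ¬u
    ...   | inj₂ (v∈ , _) = v∈ , ¬u

    newly-covered : ∀ {w v} → Adj w v → ¬ Covered C w v → Covered D w v → w ∈ X
    newly-covered a ¬cov (inj₁ p′) = [ (λ p → contradiction (inj₁ p) ¬cov) , proj₁ ]′ (E⁻ p′)
    newly-covered a ¬cov (inj₂ (inj₁ s)) = proj₁ (newly-used s λ s → ¬cov (inj₂ (inj₁ s)))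
    newly-covered a ¬cov (inj₂ (inj₂ s)) =
      only-inside (proj₁ (newly-used s λ s → ¬cov (inj₂ (inj₂ s)))) (adj-sym a , ¬cov ∘ inj₁ ∘ placed-sym)

    -- X represents nothing after the move, so its slot is free for a.
    Slot : Subset n → Fin n → Set
    Slot Z w = Represents G c′ Z w ⊎ (Z ≡ X × w ≡ a)

    slot? : ∀ Z w → Dec (Slot Z w)
    slot? Z w = represents? G c′ Z w ⊎-dec (Z ≟ˢ X ×-dec w Fin.≟ a)

    X-represents-nothing : ∀ {w} → ¬ Represents G c′ X w
    X-represents-nothing {w} (inj₁ refl) = a≢b (trans (x∈⁅y⁆⇒x≡y w a∈) (sym (x∈⁅y⁆⇒x≡y w b∈)))
    X-represents-nothing (inj₂ (¬u , v , v∈ , _ , adj)) =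
      ¬u (used′ (only-inside v∈ (adj , λ p → ¬u (_ , old (placed-sym p)))))

    slot-functional : ∀ {Z w w′} → Z ∈ˡ live c → Slot Z w → Slot Z w′ → w ≡ w′
    slot-functional Z∈ (inj₁ r) (inj₁ r′) = represents-functional forest J fin′ Z∈ r r′
    slot-functional Z∈ (inj₁ r) (inj₂ (refl , _)) = contradiction r X-represents-nothing
    slot-functional Z∈ (inj₂ (refl , _)) (inj₁ r) = contradiction r X-represents-nothing
    slot-functional Z∈ (inj₂ (_ , refl)) (inj₂ (_ , refl)) = refl

    -- Any newly covered edge joins `a` and `b`. The vertex `a` takes the free slot of `X` in `L`,
    -- and `b` is the one extra vertex of the bag.
    clique-sweep : ∀ {h} → length (live c) ≤ h →
                   (BoundedBoundary J h → Sweep G (suc h) D) → Sweep G (suc h) C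
    clique-sweep {h} ℓ≤h next with list-image slot? (live c) slot-functional
    ... | L , le , all = extend D (λ _ → C⊑D) (b ∷ L) (s≤s (ℕ.≤-trans le ℓ≤h)) sub
                           (next (L , ℕ.≤-trans le ℓ≤h , bd))
      where
      bd : ∀ {w} → Boundary G J w → w ∈ˡ L
      bd β = let _ , Z∈ , r = boundary-represented forest J fin′ β in all Z∈ (inj₁ r)
      sub : ∀ {w} → Touched D w → Open C w → w ∈ˡ b ∷ L
      sub {w} t (v , adj , ¬cov) with covered? D w v
      ... | no ¬d = there (bd (t , v , adj , ¬d))
      ... | yes d with two (newly-covered adj ¬cov d)
      ...   | inj₁ refl = there (all X∈ (inj₂ (refl , refl)))
      ...   | inj₂ refl = here refl

  -- A forest contains no K₂₂.
  one-singleton : ∀ {X Y} → Nonempty X → Nonempty Y → (∀ u v → u ∈ X → v ∈ Y → Adj u v) →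
                  (∃ λ x → X ≡ ⁅ x ⁆) ⊎ (∃ λ y → Y ≡ ⁅ y ⁆)
  one-singleton (x , x∈) (y , y∈) legal with singleton-or-other x∈ | singleton-or-other y∈
  ... | inj₁ eq | _ = inj₁ (x , eq)
  ... | _ | inj₁ eq = inj₂ (y , eq)
  ... | inj₂ (x′ , x′∈ , x≢x′) | inj₂ (y′ , y′∈ , y≢y′) =
    contradiction (adj-sym (legal _ _ x∈ y′∈))
      (square-free forest x≢x′ y≢y′ (legal _ _ x∈ y∈) (adj-sym (legal _ _ x′∈ y∈)) (legal _ _ x′∈ y′∈))

  module _ {k h} (halve : ∀ {ℓ} → 2 * ℓ ≤ k → ℓ ≤ h) where
    play-sweep : ∀ {c d} (I : Consistent G c) → Constructed G d → (π : Play G c d) → playWidth π ≤ k →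
                 BoundedBoundary I h → Sweep G (suc h) (coverOf G I)
    -- The rest of the sweep enters as the continuation `next`, so the recursion along the play
    -- stays in `play-sweep`.
    move-sweep : ∀ {c c′ d} (I : Consistent G c) (m : Move G c c′) → cost m ≤ k →
                 Constructed G d → Play G c′ d → BoundedBoundary I h →
                 (BoundedBoundary (move-consistent G I m) h → Sweep G (suc h) (coverOf G (move-consistent G I m))) →
                 Sweep G (suc h) (coverOf G I)

    play-sweep I con ε _ _ = complete λ a → inj₁ (Constructed.allPlaced con _ _ a)
    play-sweep I con (m ◅ π) le bd =
      move-sweep I m (ℕ.m⊔n≤o⇒m≤o _ _ le) con π bd
        (play-sweep (move-consistent G I m) con π (ℕ.m⊔n≤o⇒n≤o (cost m) _ le))

    move-sweep I (birth S ne fresh) le con π bd next = Birth.birth-sweep I ne fresh bd next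
    move-sweep I (fold X∈ Y∈) le con π bd next = Fold.fold-sweep I X∈ Y∈ (_ , con , π) bd next
    move-sweep {c} I m@(block {X} {Y} X∈ Y∈ legal _) le con π bd next
      with one-singleton (All.lookup (Consistent.nonempty I) X∈)
                         (All.lookup (Consistent.nonempty I) (restore X∈ Y∈)) legal
    ... | inj₁ (x , refl) = Block.block-sweep I (move-consistent G I m) (_ , con , m ◅ π) (_ , con , π)
          X∈ (restore X∈ Y∈) (legal _ _ (x∈⁅x⁆ x))
          (λ p → ∪ᴱ⁺ (placed c) _ (inj₁ p))
          (λ v∈ → ∪ᴱ⁺ (placed c) _ (inj₂ (between⁺ X Y (inj₁ (x∈⁅x⁆ x , v∈)))))
          (λ i → Sum.map₂ (Sum.map (λ (p , q) → x∈⁅y⁆⇒x≡y x p , q) (λ (p , q) → x∈⁅y⁆⇒x≡y x q , p) ∘ between⁻ X Y)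
                   (∪ᴱ⁻ (placed c) _ i))
          (halve le) next
    ... | inj₂ (y , refl) = Block.block-sweep I (move-consistent G I m) (_ , con , m ◅ π) (_ , con , π)
          (restore X∈ Y∈) X∈ (λ v∈ → adj-sym (legal _ _ v∈ (x∈⁅x⁆ y)))
          (λ p → ∪ᴱ⁺ (placed c) _ (inj₁ p))
          (λ v∈ → ∪ᴱ⁺ (placed c) _ (inj₂ (between⁺ X Y (inj₂ (x∈⁅x⁆ y , v∈)))))
          (λ i → Sum.map₂ (Sum.swap ∘ Sum.map (λ (p , q) → x∈⁅y⁆⇒x≡y y q , p) (λ (p , q) → x∈⁅y⁆⇒x≡y y p , q) ∘ between⁻ X Y)
                   (∪ᴱ⁻ (placed c) _ i))
          (halve le) next
    move-sweep {c} I m@(clique {X} X∈ legal (a , b , a∈ , b∈ , a≢b , unplaced)) le con π bd next =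
      CliqueMove.clique-sweep I (move-consistent G I m) (_ , con , m ◅ π) (_ , con , π)
        X∈ legal a∈ b∈ a≢b unplaced
        (λ p → ∪ᴱ⁺ (placed c) _ (inj₁ p))
        (λ u∈ v∈ u≢v → ∪ᴱ⁺ (placed c) _ (inj₂ (within⁺ X u∈ v∈ u≢v)))
        (λ i → Sum.map₂ (λ w → let u∈ , v∈ , _ = within⁻ X w in u∈ , v∈) (∪ᴱ⁻ (placed c) _ i))
        (halve le) next
    move-sweep I (close X∈ legal) le con π bd next = Close.close-sweep I X∈ legal bd next

  2*pw≤lsfw : 2 * pw G ≤ lsfw G
  2*pw≤lsfw with proj₁ (lsfw-isMinimum G)
  ... | _ , con , π , eq = ℕ.≤-trans (ℕ.*-monoʳ-≤ 2 (pw-≤-sweep G none sweep)) double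
    where
    k = lsfw G
    h = ⌊ k /2⌋
    halve : ∀ {ℓ} → 2 * ℓ ≤ k → ℓ ≤ h
    halve {ℓ} le = subst (_≤ h) (sym (trans (ℕ.n≡⌊n+n/2⌋ ℓ) (cong (λ m → ⌊ ℓ + m /2⌋) (sym (ℕ.+-identityʳ ℓ))))) (ℕ.⌊n/2⌋-mono le)
    double : 2 * h ≤ k
    double = ℕ.≤-trans (ℕ.+-monoʳ-≤ h (subst (_≤ ⌈ k /2⌉) (sym (ℕ.+-identityʳ h)) (ℕ.⌊n/2⌋≤⌈n/2⌉ k)))
                       (ℕ.≤-reflexive (ℕ.⌊n/2⌋+⌈n/2⌉≡n k))
    none : ∀ {u v} → ¬ Covered (coverOf G (initial-consistent G)) u v
    none (inj₁ p) = noEdges⁻ p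
    none (inj₂ (inj₁ ((_ , p) , _))) = noEdges⁻ p
    none (inj₂ (inj₂ ((_ , p) , _))) = noEdges⁻ p
    sweep : Sweep G (suc h) (coverOf G (initial-consistent G))
    sweep = play-sweep halve (initial-consistent G) con π (ℕ.≤-reflexive eq)
              ([] , z≤n , λ ((_ , _ , cov) , _) → contradiction cov none)

-- Drawing trees

module _ {A : Set} (_≟_ : (x y : A) → Dec (x ≡ y)) {R : Rel A 0ℓ} where
  private
    Simple : A → A → Set
    Simple u v = ∃ λ xs → Unique (u ∷ xs) × Linked R (u ∷ xs) × List.last (u ∷ xs) ≡ just v

    cut : ∀ {u v} xs → u ∈ˡ xs → Unique xs → Linked R xs → List.last xs ≡ just v → Simple u v
    cut (x ∷ xs) (here refl) un li la = xs , un , li , la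
    cut (x ∷ y ∷ xs) (there i) (_ ∷ un) (_ ∷ li) la = cut (y ∷ xs) i un li la

    -- Loop erasure: if the new first vertex is already on the path, `cut` restarts the path there.
    erase : ∀ {u v} → Star R u v → Simple u v
    erase {u} ε = [] , [] ∷ [] , [-] , refl
    erase {u} (_◅_ {j = w} r σ) with erase σ
    ... | xs , un , li , la with Any.any? (u ≟_) (w ∷ xs)
    ...   | yes i = cut (w ∷ xs) i un li la
    ...   | no ¬i = w ∷ xs , All.¬Any⇒All¬ (w ∷ xs) ¬i ∷ un , r ∷ li , la

    snoc : ∀ {v} (xs : List A) → List.last xs ≡ just v → ∃ λ ys → xs ≡ ys ∷ʳ v
    snoc (x ∷ [])     refl = [] , refl
    snoc (x ∷ y ∷ xs) eq   = let ys , eq′ = snoc (y ∷ xs) eq in x ∷ ys , cong (x ∷_) eq′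

  simple-path : ∀ {u v} → u ≢ v → Star R u v →
                ∃ λ xs → Unique (u ∷ xs ∷ʳ v) × Linked R (u ∷ xs ∷ʳ v)
  simple-path u≢v σ with erase σ
  ... | [] , _ , _ , refl = contradiction refl u≢v
  ... | x ∷ xs , un , li , la with snoc (x ∷ xs) la
  ...   | ys , eq rewrite eq = ys , un , li

module _ {n} {G : Graph n} (forest : IsForest G) where
  open Graph G

  Inside : (Fin n → Set) → Rel (Fin n) 0ℓ
  Inside S u v = Adj u v × S u × S v

  private
    all-inside : ∀ {S x y xs} → Linked (Inside S) (x ∷ y ∷ xs) → All S (x ∷ y ∷ xs)
    all-inside ((_ , sx , sy) ∷ [-])       = sx ∷ sy ∷ []
    all-inside ((_ , sx , _) ∷ (r ∷ rs)) = sx ∷ all-inside (r ∷ rs)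

  -- Otherwise a simple path from `u` to `v` inside `S` closes up to a cycle through `w`, which lies
  -- outside `S`.
  single-attachment : ∀ {S u v w} → ¬ S w → Star (Inside S) u v → Adj w u → Adj w v → u ≡ v
  single-attachment {S} {u} {v} {w} ¬w σ wu wv with u Fin.≟ v
  ... | yes eq = eq
  ... | no u≢v with simple-path Fin._≟_ u≢v σ
  ...   | xs , un , li = contradiction cyc forest
    where
    ne : ∀ xs → Linked (Inside S) (u ∷ xs ∷ʳ v) → All S (u ∷ xs ∷ʳ v)
    ne []       li = all-inside li
    ne (_ ∷ xs) li = all-inside li
    cyc : Cycle G
    cyc = record { first = w ; middle = u ∷ xs ; last = v ; long = s≤s z≤n
                 ; distinct = All.map (λ { s refl → ¬w s }) (ne xs li) ∷ un
                 ; path = wu ∷ Linked.map proj₁ li ; closing = adj-sym wv }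

-- Terms that draw rooted trees

data Tree (n : ℕ) : Set where
  leaf  : Fin n → Tree n
  graft : Tree n → Tree n → Tree n

module _ {n : ℕ} where
  root : Tree n → Fin n
  root (leaf v)    = v
  root (graft s _) = root s

  draw : Tree n → Expr n 0 1
  draw (leaf v)    = ν ⁅ v ⁆ (v , x∈⁅x⁆ v)
  draw (graft s t) = ((draw s □ draw t) ⨾ B) ⨾ (e □ κ)

  infix 4 _∈ᵗ_
  data _∈ᵗ_ (v : Fin n) : Tree n → Set where
    it    : v ∈ᵗ leaf v
    left  : ∀ {s t} → v ∈ᵗ s → v ∈ᵗ graft s t
    right : ∀ {s t} → v ∈ᵗ t → v ∈ᵗ graft s t

  Join : Fin n → Fin n → Fin n → Fin n → Set
  Join a b u v = (u ≡ a × v ≡ b) ⊎ (u ≡ b × v ≡ a)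

  Edge : Tree n → Fin n → Fin n → Set
  Edge (leaf _)    u v = Empty.⊥
  Edge (graft s t) u v = (Edge s u v ⊎ Edge t u v) ⊎ Join (root s) (root t) u v

  -- Replacing `leaf v` by a graft with the same root leaves all other joins intact, so a child can
  -- be attached at any vertex without rerooting.
  sprout : ∀ {v} (t : Tree n) → v ∈ᵗ t → Fin n → Tree n
  sprout (leaf v)    it        w = graft (leaf v) (leaf w)
  sprout (graft s t) (left i)  w = graft (sprout s i w) t
  sprout (graft s t) (right i) w = graft s (sprout t i w)

  -- The 4 is the rank of `B`. Parallel products here have rank 2 and `e □ κ` has rank 3, whatever
  -- the size of the subtrees.
  draw-width : ∀ t → exprWidth (draw t) ≤ 4
  draw-width (leaf _)    = s≤s z≤n
  draw-width (graft s t) =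
    ℕ.⊔-lub (s≤s z≤n) (ℕ.⊔-lub (ℕ.⊔-lub (s≤s (s≤s z≤n))
      (ℕ.⊔-lub (ℕ.⊔-lub (s≤s (s≤s z≤n)) (ℕ.⊔-lub (draw-width s) (draw-width t))) ℕ.≤-refl)) (s≤s (s≤s (s≤s z≤n))))

  draw-outputs : ∀ t → outputs (draw t) [] ≡ ⁅ root t ⁆ ∷ []
  draw-outputs (leaf _) = refl
  draw-outputs (graft s t) rewrite draw-outputs s = refl

  Join⇒between : ∀ {a b u v} → Join a b u v → between ⁅ a ⁆ ⁅ b ⁆ ∋ u ~ v
  Join⇒between {a} {b} (inj₁ (refl , refl)) = between⁺ ⁅ a ⁆ ⁅ b ⁆ (inj₁ (x∈⁅x⁆ a , x∈⁅x⁆ b))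
  Join⇒between {a} {b} (inj₂ (refl , refl)) = between⁺ ⁅ a ⁆ ⁅ b ⁆ (inj₂ (x∈⁅x⁆ b , x∈⁅x⁆ a))

  between⇒Join : ∀ {a b u v} → between ⁅ a ⁆ ⁅ b ⁆ ∋ u ~ v → Join a b u v
  between⇒Join {a} {b} i with between⁻ ⁅ a ⁆ ⁅ b ⁆ i
  ... | inj₁ (p , q) = inj₁ (x∈⁅y⁆⇒x≡y a p , x∈⁅y⁆⇒x≡y b q)
  ... | inj₂ (p , q) = inj₂ (x∈⁅y⁆⇒x≡y b p , x∈⁅y⁆⇒x≡y a q)

  graft-edges : ∀ s t → addedEdges (draw (graft s t)) [] ≡
    ((addedEdges (draw s) [] ∪ᴱ addedEdges (draw t) []) ∪ᴱ between ⁅ root s ⁆ ⁅ root t ⁆) ∪ᴱ (noEdges ∪ᴱ noEdges)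
  graft-edges s t rewrite draw-outputs s | draw-outputs t = refl

  private
    subtrees joining : Tree n → Tree n → EdgeSet n
    subtrees s t = addedEdges (draw s) [] ∪ᴱ addedEdges (draw t) []
    joining s t = between ⁅ root s ⁆ ⁅ root t ⁆

  drawn⁺ : ∀ t {u v} → Edge t u v → addedEdges (draw t) [] ∋ u ~ v
  drawn⁺ (graft s t) {u} {v} x = subst (_∋ u ~ v) (sym (graft-edges s t))
    (∪ᴱ⁺ (subtrees s t ∪ᴱ joining s t) (noEdges ∪ᴱ noEdges) (inj₁ (∪ᴱ⁺ (subtrees s t) (joining s t) (side x))))
    where
    side : Edge (graft s t) u v → subtrees s t ∋ u ~ v ⊎ joining s t ∋ u ~ v
    side (inj₁ y) = inj₁ (∪ᴱ⁺ (addedEdges (draw s) []) _ (Sum.map (drawn⁺ s) (drawn⁺ t) y))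
    side (inj₂ j) = inj₂ (Join⇒between j)

  drawn⁻ : ∀ t {u v} → addedEdges (draw t) [] ∋ u ~ v → Edge t u v
  drawn⁻ (leaf _) {u} {v} i = noEdges⁻ {u = u} {v} i
  drawn⁻ (graft s t) {u} {v} i
    with ∪ᴱ⁻ (subtrees s t ∪ᴱ joining s t) (noEdges ∪ᴱ noEdges) (subst (_∋ u ~ v) (graft-edges s t) i)
  ... | inj₂ j = contradiction (∪ᴱ⁻ noEdges noEdges j) λ { (inj₁ k) → noEdges⁻ k ; (inj₂ k) → noEdges⁻ k }
  ... | inj₁ j with ∪ᴱ⁻ (subtrees s t) (joining s t) j
  ...   | inj₁ k = inj₁ (Sum.map (drawn⁻ s) (drawn⁻ t) (∪ᴱ⁻ (addedEdges (draw s) []) _ k))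
  ...   | inj₂ k = inj₂ (between⇒Join k)

  graft-births : ∀ s t v → births (draw (graft s t)) v ≡ births (draw s) v + births (draw t) v
  graft-births s t v = trans (ℕ.+-identityʳ _) (ℕ.+-identityʳ _)

  module _ {x : Fin n} (w : Fin n) where
    sprout-root : ∀ t (i : x ∈ᵗ t) → root (sprout t i w) ≡ root t
    sprout-root (leaf _)    it        = refl
    sprout-root (graft s t) (left i)  = sprout-root s i
    sprout-root (graft s t) (right i) = refl

    sprout-new : ∀ t (i : x ∈ᵗ t) → w ∈ᵗ sprout t i w
    sprout-new (leaf _)    it        = right it
    sprout-new (graft s t) (left i)  = left (sprout-new s i)
    sprout-new (graft s t) (right i) = right (sprout-new t i)

    sprout-old : ∀ t (i : x ∈ᵗ t) {v} → v ∈ᵗ t → v ∈ᵗ sprout t i w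
    sprout-old (leaf _)    it        it        = left it
    sprout-old (graft s t) (left i)  (left j)  = left (sprout-old s i j)
    sprout-old (graft s t) (left i)  (right j) = right j
    sprout-old (graft s t) (right i) (left j)  = left j
    sprout-old (graft s t) (right i) (right j) = right (sprout-old t i j)

    sprout-∈⁻ : ∀ t (i : x ∈ᵗ t) {v} → v ∈ᵗ sprout t i w → v ∈ᵗ t ⊎ v ≡ w
    sprout-∈⁻ (leaf _)    it        (left it)  = inj₁ it
    sprout-∈⁻ (leaf _)    it        (right it) = inj₂ refl
    sprout-∈⁻ (graft s t) (left i)  (left j)   = Sum.map₁ left (sprout-∈⁻ s i j)
    sprout-∈⁻ (graft s t) (left i)  (right j)  = inj₁ (right j)
    sprout-∈⁻ (graft s t) (right i) (left j)   = inj₁ (left j)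
    sprout-∈⁻ (graft s t) (right i) (right j)  = Sum.map₁ right (sprout-∈⁻ t i j)

    sprout-edge⁺ : ∀ t (i : x ∈ᵗ t) {u v} → Edge t u v ⊎ Join x w u v → Edge (sprout t i w) u v
    sprout-edge⁺ (leaf _)    it        (inj₂ j)               = inj₂ j
    sprout-edge⁺ (graft s t) (left i)  (inj₁ (inj₁ (inj₁ a))) = inj₁ (inj₁ (sprout-edge⁺ s i (inj₁ a)))
    sprout-edge⁺ (graft s t) (left i)  (inj₁ (inj₁ (inj₂ b))) = inj₁ (inj₂ b)
    sprout-edge⁺ (graft s t) (left i)  (inj₂ j)               = inj₁ (inj₁ (sprout-edge⁺ s i (inj₂ j)))
    sprout-edge⁺ (graft s t) (left i) {u} {v} (inj₁ (inj₂ j)) =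
      inj₂ (subst (λ r → Join r (root t) u v) (sym (sprout-root s i)) j)
    sprout-edge⁺ (graft s t) (right i) (inj₁ (inj₁ (inj₁ a))) = inj₁ (inj₁ a)
    sprout-edge⁺ (graft s t) (right i) (inj₁ (inj₁ (inj₂ b))) = inj₁ (inj₂ (sprout-edge⁺ t i (inj₁ b)))
    sprout-edge⁺ (graft s t) (right i) (inj₂ j)               = inj₁ (inj₂ (sprout-edge⁺ t i (inj₂ j)))
    sprout-edge⁺ (graft s t) (right i) {u} {v} (inj₁ (inj₂ j)) =
      inj₂ (subst (λ r → Join (root s) r u v) (sym (sprout-root t i)) j)

    sprout-edge⁻ : ∀ t (i : x ∈ᵗ t) {u v} → Edge (sprout t i w) u v → Edge t u v ⊎ Join x w u v
    sprout-edge⁻ (leaf _)    it        (inj₁ (inj₁ ()))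
    sprout-edge⁻ (leaf _)    it        (inj₁ (inj₂ ()))
    sprout-edge⁻ (leaf _)    it        (inj₂ j) = inj₂ j
    sprout-edge⁻ (graft s t) (left i)  (inj₁ (inj₁ a)) = Sum.map₁ (inj₁ ∘ inj₁) (sprout-edge⁻ s i a)
    sprout-edge⁻ (graft s t) (left i)  (inj₁ (inj₂ b)) = inj₁ (inj₁ (inj₂ b))
    sprout-edge⁻ (graft s t) (left i) {u} {v} (inj₂ j) =
      inj₁ (inj₂ (subst (λ r → Join r (root t) u v) (sprout-root s i) j))
    sprout-edge⁻ (graft s t) (right i) (inj₁ (inj₁ a)) = inj₁ (inj₁ (inj₁ a))
    sprout-edge⁻ (graft s t) (right i) (inj₁ (inj₂ b)) = Sum.map₁ (inj₁ ∘ inj₂) (sprout-edge⁻ t i b)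
    sprout-edge⁻ (graft s t) (right i) {u} {v} (inj₂ j) =
      inj₁ (inj₂ (subst (λ r → Join (root s) r u v) (sprout-root t i) j))

    sprout-births : ∀ t (i : x ∈ᵗ t) v →
                    births (draw (sprout t i w)) v ≡ births (draw t) v + births (draw (leaf w)) v
    sprout-births (leaf _)    it        v = graft-births (leaf x) (leaf w) v
    sprout-births (graft s t) (left i)  v = begin
      births (draw (graft (sprout s i w) t)) v           ≡⟨ graft-births (sprout s i w) t v ⟩
      births (draw (sprout s i w)) v + births (draw t) v ≡⟨ cong (_+ births (draw t) v) (sprout-births s i v) ⟩
      births (draw s) v + b + births (draw t) v          ≡⟨ xy∙z≈xz∙y ℕ.+-commutativeSemigroup (births (draw s) v) b (births (draw t) v) ⟩
      births (draw s) v + births (draw t) v + b          ≡⟨ cong (_+ b) (graft-births s t v) ⟨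
      births (draw (graft s t)) v + b                    ∎
      where
      open ≡-Reasoning
      b = births (draw (leaf w)) v
    sprout-births (graft s t) (right i) v = begin
      births (draw (graft s (sprout t i w))) v           ≡⟨ graft-births s (sprout t i w) v ⟩
      births (draw s) v + births (draw (sprout t i w)) v ≡⟨ cong (λ m → births (draw s) v + m) (sprout-births t i v) ⟩
      births (draw s) v + (births (draw t) v + b)        ≡⟨ ℕ.+-assoc (births (draw s) v) _ b ⟨
      births (draw s) v + births (draw t) v + b          ≡⟨ cong (_+ b) (graft-births s t v) ⟨
      births (draw (graft s t)) v + b                    ∎
      where
      open ≡-Reasoning
      b = births (draw (leaf w)) v

  births-leaf-≡ : ∀ v → births (draw (leaf v)) v ≡ 1
  births-leaf-≡ v rewrite Vec.[]=⇒lookup (x∈⁅x⁆ v) = refl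

  births-leaf-≢ : ∀ v w → v ≢ w → births (draw (leaf w)) v ≡ 0
  births-leaf-≢ v w v≢w with lookup ⁅ w ⁆ v in eq
  ... | true  = contradiction (x∈⁅y⁆⇒x≡y w (Vec.lookup⇒[]= v _ eq)) v≢w
  ... | false = refl

-- Invariant of the growth: `t` spans a connected set of vertices and its edges are exactly those
-- induced there. Births are tracked as exact counts because legality asks for exactly one.
record Grown {n} (G : Graph n) (t : Tree n) : Set where
  open Graph G
  field
    member?   : ∀ v → Dec (v ∈ᵗ t)
    inside    : ∀ {v} → v ∈ᵗ t → births (draw t) v ≡ 1
    outside   : ∀ {v} → ¬ v ∈ᵗ t → births (draw t) v ≡ 0
    induced   : ∀ {u v} → u ∈ᵗ t → v ∈ᵗ t → Adj u v → Edge t u v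
    edge-adj  : ∀ {u v} → Edge t u v → Adj u v
    connected : ∀ {u v} → u ∈ᵗ t → v ∈ᵗ t → Star (λ u v → Adj u v × u ∈ᵗ t × v ∈ᵗ t) u v

module _ {n} {G : Graph n} (forest : IsForest G) where
  open Graph G

  seed : ∀ v → Grown G (leaf v)
  seed v = record
    { member?   = λ u → map′ (λ { refl → it }) (λ { it → refl }) (u Fin.≟ v)
    ; inside    = λ { it → births-leaf-≡ v }
    ; outside   = λ {u} ¬i → births-leaf-≢ u v λ { refl → ¬i it }
    ; induced   = λ { it it a → contradiction a adj-irrefl }
    ; edge-adj  = λ ()
    ; connected = λ { it it → ε } }

  -- As `t` is connected, `single-attachment` makes `x` the only neighbour of `w` in it, so the one
  -- new edge keeps the drawn subgraph induced.
  grow : ∀ {t x w} → Grown G t → (i : x ∈ᵗ t) → ¬ w ∈ᵗ t → Adj x w → Grown G (sprout t i w)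
  grow {t} {x} {w} g i w∉ a = record
    { member?   = λ v → map′ [ old , (λ { refl → new }) ]′ (sprout-∈⁻ w t i) (member? v ⊎-dec (v Fin.≟ w))
    ; inside    = inside′
    ; outside   = λ {v} ¬j → trans (sprout-births w t i v)
                    (trans (cong (_+ births (draw (leaf w)) v) (outside (¬j ∘ old))) (births-leaf-≢ v w λ { refl → ¬j new }))
    ; induced   = induced′
    ; edge-adj  = λ {u} {v} y → [ edge-adj , join-adj ]′ (sprout-edge⁻ w t i y)
    ; connected = connected′ }
    where
    open Grown g
    old : ∀ {v} → v ∈ᵗ t → v ∈ᵗ sprout t i w
    old = sprout-old w t i
    new : w ∈ᵗ sprout t i w
    new = sprout-new w t i
    inside′ : ∀ {v} → v ∈ᵗ sprout t i w → births (draw (sprout t i w)) v ≡ 1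
    inside′ {v} j with sprout-∈⁻ w t i j
    ... | inj₁ k    = trans (sprout-births w t i v)
                        (trans (cong (λ m → births (draw t) v + m) (births-leaf-≢ v w λ { refl → w∉ k }))
                               (trans (ℕ.+-identityʳ _) (inside k)))
    ... | inj₂ refl = trans (sprout-births w t i w)
                        (trans (cong (_+ births (draw (leaf w)) w) (outside w∉)) (births-leaf-≡ w))
    join-adj : ∀ {u v} → Join x w u v → Adj u v
    join-adj (inj₁ (refl , refl)) = a
    join-adj (inj₂ (refl , refl)) = adj-sym a
    attach : ∀ {u} → u ∈ᵗ t → Adj w u → x ≡ u
    attach j a′ = single-attachment forest w∉ (connected i j) (adj-sym a) a′
    induced′ : ∀ {u v} → u ∈ᵗ sprout t i w → v ∈ᵗ sprout t i w → Adj u v → Edge (sprout t i w) u v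
    induced′ j k b with sprout-∈⁻ w t i j | sprout-∈⁻ w t i k
    ... | inj₁ j′   | inj₁ k′   = sprout-edge⁺ w t i (inj₁ (induced j′ k′ b))
    ... | inj₁ j′   | inj₂ refl = sprout-edge⁺ w t i (inj₂ (inj₁ (sym (attach j′ (adj-sym b)) , refl)))
    ... | inj₂ refl | inj₁ k′   = sprout-edge⁺ w t i (inj₂ (inj₂ (refl , sym (attach k′ b))))
    ... | inj₂ refl | inj₂ refl = contradiction b adj-irrefl
    widen : ∀ {u v} → u ∈ᵗ t → v ∈ᵗ t → Star (λ u v → Adj u v × u ∈ᵗ sprout t i w × v ∈ᵗ sprout t i w) u v
    widen j k = Star.map (λ (b , p , q) → b , old p , old q) (connected j k)
    connected′ : ∀ {u v} → u ∈ᵗ sprout t i w → v ∈ᵗ sprout t i w →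
                 Star (λ u v → Adj u v × u ∈ᵗ sprout t i w × v ∈ᵗ sprout t i w) u v
    connected′ j k with sprout-∈⁻ w t i j | sprout-∈⁻ w t i k
    ... | inj₁ j′   | inj₁ k′   = widen j′ k′
    ... | inj₁ j′   | inj₂ refl = widen j′ i ◅◅ ((a , old i , new) ◅ ε)
    ... | inj₂ refl | inj₁ k′   = (adj-sym a , new , old i) ◅ widen i k′
    ... | inj₂ refl | inj₂ refl = ε

  Extends : Tree n → Fin n → Set
  Extends t v = ∃ λ t′ → Grown G t′ × v ∈ᵗ t′ × (∀ {u} → u ∈ᵗ t → u ∈ᵗ t′)

  grow-along : ∀ {t u v} → Grown G t → u ∈ᵗ t → Star Adj u v → Extends t v
  grow-along g i ε = _ , g , i , id
  grow-along {t} g i (_◅_ {j = w} a σ) with Grown.member? g w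
  ... | yes j = grow-along g j σ
  ... | no ¬j = let t′ , g′ , k , sub = grow-along (grow g i ¬j a) (sprout-new w t i) σ
                in t′ , g′ , k , sub ∘ sprout-old w t i

  grow-all : ∀ {t r} → (∀ v → Star Adj r v) → Grown G t → r ∈ᵗ t → (vs : List (Fin n)) →
             ∃ λ t′ → Grown G t′ × r ∈ᵗ t′ × (∀ {v} → v ∈ˡ vs ⊎ v ∈ᵗ t → v ∈ᵗ t′)
  grow-all conn g i []       = _ , g , i , λ { (inj₂ j) → j }
  grow-all conn g i (v ∷ vs) =
    let t₁ , g₁ , j , sub = grow-along g i (conn v)
        t₂ , g₂ , k , sub′ = grow-all conn g₁ (sub i) vs
    in t₂ , g₂ , k , λ { (inj₁ (here refl)) → sub′ (inj₂ j) ; (inj₁ (there m)) → sub′ (inj₁ m) ; (inj₂ m) → sub′ (inj₂ (sub m)) }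

sfw≤4 : ∀ {n} (T : Graph n) → IsTree T → sfw T ≤ 4
-- On no vertices `sfw` has the value 0 by convention.
sfw≤4 {zero}  T tree = z≤n
sfw≤4 {suc n} T tree with grow-all forest (connected zero) (seed forest zero) it (List.allFin (suc n))
  where open IsTree tree
... | t , g , _ , all = ℕ.≤-trans (proj₂ (sfw-isMinimum T) _ (draw t ⨾ κ , legal , refl))
                                  (ℕ.⊔-lub z≤n (ℕ.⊔-lub (draw-width t) (s≤s z≤n)))
  where
  open Grown g
  member : ∀ v → v ∈ᵗ t
  member v = all (inj₁ (∈-allFin v))
  legal : Legal T (draw t ⨾ κ)
  legal = record
    { bornOnce = λ v → trans (ℕ.+-identityʳ _) (inside (member v))
    ; value = λ u v → mk⇔
        (λ i → [ edge-adj ∘ drawn⁻ t , (λ j → contradiction j (noEdges⁻ {u = u} {v})) ]′ (∪ᴱ⁻ (addedEdges (draw t) []) noEdges i))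
        (λ a → ∪ᴱ⁺ (addedEdges (draw t) []) noEdges (inj₁ (drawn⁺ t (induced (member u) (member v) a)))) }

-- Ternary trees have unbounded path-width

unique-length : ∀ {n} {p : Subset n} {L} → Unique L → All (_∈ p) L → length L ≤ ∣ p ∣
unique-length [] _ = z≤n
unique-length {p = p} {x ∷ L} (x∉ ∷ un) (x∈ ∷ all) =
  ℕ.≤-trans (s≤s (unique-length un (All.zipWith (λ (x≢y , y∈) → x∈p∧x≢y⇒x∈p-y y∈ (x≢y ∘ sym)) (x∉ , all))))
            (x∈p⇒∣p-x∣<∣p∣ x∈)

≤-foldr-⊔ : ∀ {m} (f : Fin m → ℕ) i → f i ≤ Vector.foldr _⊔_ 0 f
≤-foldr-⊔ f zero    = ℕ.m≤m⊔n _ _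
≤-foldr-⊔ f (suc i) = ℕ.≤-trans (≤-foldr-⊔ (f ∘ suc) i) (ℕ.m≤n⊔m (f zero) _)

-- Acyclicity from a parent relation

module Rooted {n} (G : Graph n) (Parent : Rel (Fin n) 0ℓ) (depth : Fin n → ℕ)
              (oriented : ∀ {u v} → Graph.Adj G u v → Parent u v ⊎ Parent v u)
              (unique : ∀ {u v w} → Parent u w → Parent v w → u ≡ v)
              (deeper : ∀ {u v} → Parent u v → depth u < depth v) where
  open Graph G

  -- Walks that never turn back, given by their first and last steps.
  data Walk : (x y p z : Fin n) → Set where
    step : ∀ {p z} → Adj p z → Walk p z p z
    on   : ∀ {w x y p z} → Adj w x → w ≢ y → Walk x y p z → Walk w x p z

  -- Once a walk goes down it keeps going down: a step up would return to the unique parent it has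
  -- just left.
  descends : ∀ {x y p z} → Walk x y p z → Parent x y → Parent p z × depth x < depth z
  descends (step _) q = q , deeper q
  descends (on a w≢y W) q with W
  ... | step b with oriented b
  ...   | inj₁ r = r , ℕ.<-trans (deeper q) (deeper r)
  ...   | inj₂ r = contradiction (unique q r) w≢y
  descends (on a w≢y W) q | on b _ _ with oriented b
  ...   | inj₁ r = let s , lt = descends W r in s , ℕ.<-trans (deeper q) lt
  ...   | inj₂ r = contradiction (unique q r) w≢y

  -- Either some step goes down, and then so does the last one by `descends`, or every step goes up.
  ascends : ∀ {x y p z} → Walk x y p z → Parent p z ⊎ depth z < depth x
  ascends (step a) = Sum.map₂ deeper (oriented a)
  ascends W@(on a _ W′) with oriented a
  ... | inj₁ q = inj₁ (proj₁ (descends W q))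
  ... | inj₂ q = Sum.map₂ (λ lt → ℕ.<-trans lt (deeper q)) (ascends W′)

  -- A cycle is a closed walk that never turns back. If its first step goes down or all steps go up,
  -- its depth cannot return to the initial value. Otherwise it leaves `first` upwards and re-enters
  -- it downwards, so both neighbours of `first` on the cycle are its unique parent, although they
  -- are distinct.
  acyclic : IsForest G
  acyclic record { middle = [] ; long = () }
  acyclic record { first = f ; middle = m ∷ ms ; last = l ; distinct = f∉ ∷ un ; path = a ∷ li ; closing = b } =
    let y , y∈ , W = around m ms li un f∉
        whole = on a (All.lookup f∉ (there y∈)) W
    in absurd whole (λ { refl → All.lookup (head un) (∈-++⁺ʳ ms (here refl)) refl }) (oriented a)
    where
    head : ∀ {x xs} → Unique (x ∷ xs) → All (x ≢_) xs
    head (p ∷ _) = p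
    around : ∀ x xs → Linked Adj (x ∷ xs ∷ʳ l) → Unique (x ∷ xs ∷ʳ l) → All (f ≢_) (x ∷ xs ∷ʳ l) →
             ∃ λ y → y ∈ˡ (xs ∷ʳ l) × Walk x y l f
    around x []       (c ∷ _)  _          (f≢x ∷ _) = l , here refl , on c (f≢x ∘ sym) (step b)
    around x (y ∷ ys) (c ∷ li) (x∉ ∷ un) (_ ∷ f∉) =
      let z , z∈ , W = around y ys li un f∉
      in y , here refl , on c (All.lookup x∉ (there z∈)) W
    absurd : Walk f m l f → l ≢ m → Parent f m ⊎ Parent m f → Empty.⊥
    absurd W l≢m (inj₁ q) = ℕ.<-irrefl refl (proj₂ (descends W q))
    absurd W l≢m (inj₂ q) with ascends W
    ... | inj₁ r  = l≢m (unique r q)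
    ... | inj₂ lt = ℕ.<-irrefl refl lt

-- The complete ternary tree

data Node : ℕ → Set where
  top   : ∀ {h} → Node h
  child : ∀ {h} → Fin 3 → Node h → Node (suc h)

data Parent : ∀ {h} → Node h → Node h → Set where
  above : ∀ {h} i → Parent {suc h} top (child i top)
  below : ∀ {h} {u v : Node h} i → Parent u v → Parent (child i u) (child i v)

Link : ∀ {h} → Node h → Node h → Set
Link u v = Parent u v ⊎ Parent v u

parent? : ∀ {h} (u v : Node h) → Dec (Parent u v)
parent? top top = no λ ()
parent? top (child i top) = yes (above i)
parent? top (child i (child j v)) = no λ ()
parent? (child i u) top = no λ ()
parent? (child i u) (child j v) with i Fin.≟ j | parent? u v
... | yes refl | yes p = yes (below i p)
... | yes refl | no ¬p = no λ { (below _ p) → ¬p p }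
... | no i≢j   | _     = no λ { (below _ _) → i≢j refl }

parent-unique : ∀ {h} {u v w : Node h} → Parent u w → Parent v w → u ≡ v
parent-unique (above i)   (above .i)   = refl
parent-unique (below i p) (below .i q) = cong (child i) (parent-unique p q)

level : ∀ {h} → Node h → ℕ
level top         = 0
level (child _ v) = suc (level v)

parent-level : ∀ {h} {u v : Node h} → Parent u v → level u < level v
parent-level (above i)   = s≤s z≤n
parent-level (below i p) = s≤s (parent-level p)

size : ℕ → ℕ
size zero    = 1
size (suc h) = suc (3 * size h)

encode : ∀ {h} → Node h → Fin (size h)
encode {zero}  top         = zero
encode {suc h} top         = zero
encode {suc h} (child i v) = suc (Fin.combine i (encode v))

decode : ∀ {h} → Fin (size h) → Node h
decode {zero}  _       = top
decode {suc h} zero    = top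
decode {suc h} (suc x) = child (Fin.quotient {3} (size h) x) (decode (Fin.remainder {3} (size h) x))

decode-encode : ∀ {h} (v : Node h) → decode (encode v) ≡ v
decode-encode {zero}  top = refl
decode-encode {suc h} top = refl
decode-encode {suc h} (child i v) =
  trans (cong (λ (j , y) → child j (decode y)) (Fin.remQuot-combine {3} i (encode v)))
        (cong (child i) (decode-encode v))

encode-decode : ∀ {h} (x : Fin (size h)) → encode {h} (decode x) ≡ x
encode-decode {zero}  zero = refl
encode-decode {suc h} zero = refl
encode-decode {suc h} (suc x) =
  cong suc (trans (cong (Fin.combine (Fin.quotient {3} (size h) x)) (encode-decode (Fin.remainder {3} (size h) x)))
                  (Fin.combine-remQuot {3} (size h) x))

link-sym : ∀ {h} {u v : Node h} → Link u v → Link v u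
link-sym = Sum.swap

link-child : ∀ {h} {u v : Node h} i → Link u v → Link (child i u) (child i v)
link-child i = Sum.map (below i) (below i)

to-top : ∀ {h} (v : Node h) → Star Link v top
to-top top         = ε
to-top (child i v) = Star.gmap (child i) (link-child i) (to-top v) ◅◅ (inj₂ (above i) ◅ ε)

linked : ∀ {h} (u v : Node h) → Star Link u v
linked u v = to-top u ◅◅ Star.reverse link-sym (to-top v)

ternary : ∀ h → Graph (size h)
ternary h = record
  { Adj = λ x y → Link (decode {h} x) (decode y)
  ; adj? = λ x y → parent? (decode {h} x) (decode y) ⊎-dec parent? (decode {h} y) (decode x)
  ; adj-sym = link-sym
  ; adj-irrefl = [ irr , irr ]′ }
  where
  irr : ∀ {v : Node h} → ¬ Parent v v
  irr p = ℕ.<-irrefl refl (parent-level p)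

ternary-isTree : ∀ h → IsTree (ternary h)
ternary-isTree h = record
  { nonempty = positive h
  ; connected = λ x y → subst₂ (Star (Graph.Adj (ternary h))) (encode-decode {h} x) (encode-decode {h} y)
      (Star.gmap encode (λ {u} {v} → subst₂ Link (sym (decode-encode u)) (sym (decode-encode v)))
                 (linked (decode {h} x) (decode y)))
  ; forest = Rooted.acyclic (ternary h) (λ x y → Parent (decode {h} x) (decode y)) (level ∘ decode {h}) id
      (λ {x} {y} p q → trans (sym (encode-decode {h} x)) (trans (cong encode (parent-unique p q)) (encode-decode {h} y)))
      parent-level }
  where
  positive : ∀ h → 1 ≤ size h
  positive zero    = s≤s z≤n
  positive (suc h) = s≤s z≤n

-- Large bags in path decompositions of ternary trees

median : ∀ {m} (t : Fin 3 → Fin m) → ∃ λ a → ∃ λ b → ∃ λ c → a ≢ b × c ≢ b × t a Fin.≤ t b × t b Fin.≤ t c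
median t with Fin.≤-total (t zero) (t (suc zero)) | Fin.≤-total (t (suc zero)) (t (suc (suc zero)))
            | Fin.≤-total (t zero) (t (suc (suc zero)))
... | inj₁ p | inj₁ q | _      = zero , suc zero , suc (suc zero) , (λ ()) , (λ ()) , p , q
... | inj₁ p | inj₂ q | inj₁ r = zero , suc (suc zero) , suc zero , (λ ()) , (λ ()) , r , q
... | inj₁ p | inj₂ q | inj₂ r = suc (suc zero) , zero , suc zero , (λ ()) , (λ ()) , r , p
... | inj₂ p | inj₁ q | inj₁ r = suc zero , zero , suc (suc zero) , (λ ()) , (λ ()) , p , r
... | inj₂ p | inj₁ q | inj₂ r = suc zero , suc (suc zero) , zero , (λ ()) , (λ ()) , q , r
... | inj₂ p | inj₂ q | _      = suc (suc zero) , suc zero , zero , (λ ()) , (λ ()) , q , p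

module _ {n} {G : Graph n} (D : PathDecomposition G) where
  open Graph G
  open PathDecomposition D

  -- Each edge of the walk lies in some bag `l`. As soon as `l` is not before `j`, contiguity puts
  -- the current vertex into bag `j`; until then the walk moves on with `l` as the new left end.
  crossing : ∀ {A : Set} {R : Rel A 0ℓ} (f : A → Fin n) (S : A → Set) → (∀ {u v} → R u v → Adj (f u) (f v) × S v) →
             ∀ {u v i j k} → Star R u v → S u → i Fin.≤ j → j Fin.≤ k → f u ∈ bag i → f v ∈ bag k →
             ∃ λ w → S w × f w ∈ bag j
  crossing f S ok ε s i≤j j≤k u∈ v∈ = _ , s , contiguous _ i≤j j≤k u∈ v∈
  crossing f S ok {j = j} (r ◅ σ) s i≤j j≤k u∈ v∈ with ok r
  ... | a , s′ with edges _ _ a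
  ...   | l , u∈′ , w∈ with Fin.≤-total j l
  ...     | inj₁ j≤l = _ , s , contiguous _ i≤j j≤l u∈ u∈′
  ...     | inj₂ l≤j = crossing f S ok σ s′ l≤j j≤k w∈ v∈

  -- The median of the three big bags of the subtrees also meets the
  -- path joining the other two subtrees through the top.
  big-bag : ∀ {h} (f : Node h → Fin n) → (∀ {u v} → f u ≡ f v → u ≡ v) → (∀ {u v} → Link u v → Adj (f u) (f v)) →
            ∃ λ i → ∃ λ L → Unique L × length L ≡ suc h × All (λ x → x ∈ bag i × ∃ λ u → x ≡ f u) L
  big-bag {zero} f inj hom =
    let i , x∈ = vertices (f top) in i , f top ∷ [] , [] ∷ [] , refl , (x∈ , top , refl) ∷ []
  big-bag {suc h} f inj hom = add-crossing (median t)
    where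
    child-injective : ∀ {i} {u v : Node h} → child i u ≡ child i v → u ≡ v
    child-injective refl = refl
    branch : ∀ i → ∃ λ j → ∃ λ L → Unique L × length L ≡ suc h × All (λ x → x ∈ bag j × ∃ λ u → x ≡ f (child i u)) L
    branch i = big-bag (f ∘ child i) (child-injective ∘ inj) (hom ∘ link-child i)
    t : Fin 3 → Fin bagCount
    t i = proj₁ (branch i)
    inhabitant : ∀ i → ∃ λ u → f (child i u) ∈ bag (t i)
    inhabitant i with branch i
    ... | _ , _ ∷ _ , _ , _ , (x∈ , u , refl) ∷ _ = u , x∈
    Outside : Fin 3 → Node (suc h) → Set
    Outside b v = ∀ u → v ≢ child b u
    outside : ∀ {a b u} → a ≢ b → Outside b (child a u)
    outside a≢b _ refl = a≢b refl
    -- Walks along `R b` avoid branch `b`, so the vertex at which they cross the median bag is not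
    -- among those supplied by that branch.
    R : Fin 3 → Rel (Node (suc h)) 0ℓ
    R b u v = Link u v × Outside b u × Outside b v
    to-top′ : ∀ {a b} u → a ≢ b → Star (R b) (child a u) top
    to-top′ {a} u a≢b = Star.gmap (child a) (λ l → link-child a l , outside a≢b , outside a≢b) (to-top u)
                        ◅◅ ((inj₂ (above a) , outside a≢b , λ _ ()) ◅ ε)
    add-crossing : (∃ λ a → ∃ λ b → ∃ λ c → a ≢ b × c ≢ b × t a Fin.≤ t b × t b Fin.≤ t c) →
             ∃ λ i → ∃ λ L → Unique L × length L ≡ suc (suc h) × All (λ x → x ∈ bag i × ∃ λ u → x ≡ f u) L
    add-crossing (a , b , c , a≢b , c≢b , ta≤tb , tb≤tc) =
      let u , u∈ = inhabitant a
          v , v∈ = inhabitant c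
          w , w-out , w∈ = crossing f (Outside b) (λ (l , _ , o) → hom l , o)
            (to-top′ u a≢b ◅◅ Star.reverse (λ (l , o , o′) → link-sym l , o′ , o) (to-top′ v c≢b))
            (outside a≢b) ta≤tb tb≤tc u∈ v∈
          _ , L , un , len , all = branch b
      in t b , f w ∷ L , All.map (λ { (_ , u′ , refl) eq → w-out u′ (inj eq) }) all ∷ un , cong suc len ,
         (w∈ , w , refl) ∷ All.map (λ { (x∈ , u′ , eq) → x∈ , child b u′ , eq }) all

-- Some bag has at least `suc h` vertices, one of which is lost to the definition of width.
h≤pw-ternary : ∀ h → h ≤ pw (ternary h)
h≤pw-ternary h with proj₁ (pw-isMinimum (ternary h))
... | D , eq with big-bag D (encode {h}) (λ {u} {v} eq → trans (sym (decode-encode u)) (trans (cong decode eq) (decode-encode v)))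
                          (λ {u} {v} → subst₂ Link (sym (decode-encode u)) (sym (decode-encode v)))
... | i , L , un , len , all = subst (h ≤_) eq (ℕ.∸-monoˡ-≤ 1 (ℕ.≤-trans (ℕ.≤-reflexive (sym len))
      (ℕ.≤-trans (unique-length un (All.map proj₁ all)) (≤-foldr-⊔ (∣_∣ ∘ PathDecomposition.bag D) i))))

-- The gap on trees

unbounded : ∀ N → Σ ℕ λ n → Σ (Graph n) λ T → IsTree T × N ℤ.≤ (+ lsfw T ℤ.- + sfw T)
unbounded N = size h , T , tree , (begin
  N                        ≤⟨ i≤∣i∣ N ⟩
  + ℤ.∣ N ∣                ≤⟨ ℤ.+≤+ (ℕ.m+n≤o⇒m≤o∸n ℤ.∣ N ∣ bound) ⟩
  + (lsfw T ∸ sfw T)       ≡⟨ ℤ.⊖-≥ (ℕ.m+n≤o⇒n≤o ℤ.∣ N ∣ bound) ⟨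
  lsfw T ℤ.⊖ sfw T         ≡⟨ ℤ.m-n≡m⊖n (lsfw T) (sfw T) ⟨
  + lsfw T ℤ.- + sfw T     ∎)
  where
  open ℤ.≤-Reasoning
  -- The 4 absorbs the bound on `sfw`, and the absolute value takes care of negative `N`. The weaker
  -- estimate `pw T ≤ lsfw T` then suffices.
  h = ℤ.∣ N ∣ + 4
  T = ternary h
  tree = ternary-isTree h
  i≤∣i∣ : ∀ i → i ℤ.≤ + ℤ.∣ i ∣
  i≤∣i∣ (+ _)    = ℤ.≤-refl
  i≤∣i∣ -[1+ _ ] = ℤ.-≤+
  bound : ℤ.∣ N ∣ + sfw T ≤ lsfw T
  bound = ℕ.≤-trans (ℕ.+-monoʳ-≤ ℤ.∣ N ∣ (sfw≤4 T tree))
            (ℕ.≤-trans (h≤pw-ternary h) (ℕ.≤-trans (ℕ.m≤m+n (pw T) _) (2*pw≤lsfw (IsTree.forest tree))))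

corollary4p2 : (∀ (N : ℤ) → Σ ℕ λ n → Σ (Graph n) λ T → IsTree T × N ≤ᶻ (+ lsfw T - + sfw T))
    × (∀ {n} (F : Graph n) → IsForest F → 2 * pw F ≤ lsfw F)
    × (∀ {n} (T : Graph n) → IsTree T → sfw T ≤ 4)
corollary4p2 = unbounded , (λ _ → 2*pw≤lsfw) , sfw≤4
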